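{- There is an absolute constant $C$ such that the following holds. Let $\delta>0$, $s\in\mathbb N$ and let $f:\mathbb N\to(0,1)$ be a decreasing function. For any graph $G$ of density $p$ and any vertex equipartition $\mathcal P_0$ of $V(G)$ of order $s$, one can add/remove at most $\delta|E(G)|$ edges of $G$ to obtain a graph that has an $f$-regular equipartition refining $\mathcal P_0$ of order at most $F^{(h)}(s)$, where $F(x)=2^{x/f(x)}$, $F^{(h)}$ is the $h$-fold iterate of $F$, and $h\le C\log(1/p)/\delta^2$.
   Context: For a graph $G$ on $n$ vertices, density is $2|E(G)|/n^2$. For vertex sets $X,Y$, $d(X,Y)=e(X,Y)/(|X||Y|)$ where $e(X,Y)$ counts ordered pairs $(x,y)\in X\times Y$ with $xy\in E$. A pair $(X,Y)$ is $\varepsilon$-regular if $|d(X,Y)-d(X',Y')|\le\varepsilon$ for all $X'\subseteq X,Y'\subseteq Y$ with $|X'|\ge\varepsilon|X|,|Y'|\ge\varepsilon|Y|$. An equipartition is a partition whose part sizes differ by at most $1$; its order is its number of parts. A vertex partition of order $k$ is $f$-regular if all pairs of distinct parts are $f(k)$-regular.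
   Formalization: The number δ and the values of the function f are taken rational instead of real; F is rounded down to an integer at each iteration, which only strengthens the bound on the order. -}

module Defs where

open import Data.Bool using (Bool; true; false; if_then_else_; _∧_; not; _xor_)
open import Data.Nat using (ℕ; zero; suc; _+_; _*_; _^_; _≤_; _<_; _≤ᵇ_; _<ᵇ_)
open import Data.Fin using (Fin; toℕ)
import Data.Fin as Fin
open import Data.Integer using (ℤ; +_)
import Data.Integer as ℤ
open import Data.Rational using (ℚ; _/_; ↥_; ↧ₙ_; ∣_∣; _-_)
import Data.Rational as ℚ
open import Data.Product using (Σ; _×_; _,_)
open import Relation.Binary.PropositionalEquality using (_≡_; _≢_)
open import Relation.Nullary.Decidable using (⌊_⌋)

sumF : ∀ {n} → (Fin n → ℕ) → ℕ
sumF {zero}  g = 0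
sumF {suc n} g = g Fin.zero + sumF (λ i → g (Fin.suc i))

count : ∀ {n} → (Fin n → Bool) → ℕ
count p = sumF (λ i → if p i then 1 else 0)

ℕ→ℚ : ℕ → ℚ
ℕ→ℚ m = + m / 1

record Graph (n : ℕ) : Set where
  field
    adj   : Fin n → Fin n → Bool
    sym   : ∀ u v → adj u v ≡ adj v u
    irrefl : ∀ u → adj u u ≡ false
open Graph public

VSet : ℕ → Set
VSet n = Fin n → Bool

_⊆_ : ∀ {n} → VSet n → VSet n → Set
X ⊆ Y = ∀ v → X v ≡ true → Y v ≡ true

size : ∀ {n} → VSet n → ℕ
size X = count X

edges : ∀ {n} → Graph n → ℕ
edges G = sumF (λ u → count (λ v → (toℕ u <ᵇ toℕ v) ∧ adj G u v))

editDist : ∀ {n} → Graph n → Graph n → ℕ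
editDist G H =
  sumF (λ u → count (λ v → (toℕ u <ᵇ toℕ v) ∧ (adj G u v xor adj H u v)))

eXY : ∀ {n} → Graph n → VSet n → VSet n → ℕ
eXY G X Y = sumF (λ x → count (λ y → X x ∧ Y y ∧ adj G x y))

-- e/m as a rational (convention: value 0 if m = 0; never used for
-- empty sets in the statement)
ratio : ℕ → ℕ → ℚ
ratio e zero    = ℚ.0ℚ
ratio e (suc m) = (+ e) / suc m

dens : ∀ {n} → Graph n → VSet n → VSet n → ℚ
dens G X Y = ratio (eXY G X Y) (size X * size Y)

IsRegularPair : ∀ {n} → Graph n → ℚ → VSet n → VSet n → Set
IsRegularPair {n} G ε X Y =
  (X' Y' : VSet n) → X' ⊆ X → Y' ⊆ Y →
  ε ℚ.* ℕ→ℚ (size X) ℚ.≤ ℕ→ℚ (size X') →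
  ε ℚ.* ℕ→ℚ (size Y) ℚ.≤ ℕ→ℚ (size Y') →
  ∣ dens G X Y - dens G X' Y' ∣ ℚ.≤ ε

part : ∀ {n k} → (Fin n → Fin k) → Fin k → VSet n
part P j v = ⌊ P v Fin.≟ j ⌋

IsPartition : ∀ {n k} → (Fin n → Fin k) → Set
IsPartition {n} P = ∀ j → Σ (Fin n) (λ v → P v ≡ j)

IsEquipartition : ∀ {n k} → (Fin n → Fin k) → Set
IsEquipartition P =
  IsPartition P × (∀ i j → size (part P i) ≤ suc (size (part P j)))

Refines : ∀ {n k l} → (Fin n → Fin l) → (Fin n → Fin k) → Set
Refines Q P = ∀ u v → Q u ≡ Q v → P u ≡ P v

IsFRegular : ∀ {n k} → (ℕ → ℚ) → Graph n → (Fin n → Fin k) → Set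
IsFRegular {k = k} f G P =
  ∀ i j → i ≢ j → IsRegularPair G (f k) (part P i) (part P j)

largestRoot : (b N : ℕ) → ℕ → ℕ
largestRoot b N zero    = zero
largestRoot b N (suc m) =
  if (suc m) ^ b ≤ᵇ N then suc m else largestRoot b N m

-- ⌊ 2^(a/b) ⌋ for b ≥ 1
floor2^ : (a b : ℕ) → ℕ
floor2^ a b = largestRoot b (2 ^ a) (2 ^ a)

-- with f x = num/den (lowest terms, num > 0):  x / f x = x*den/num
Ffloor : (ℕ → ℚ) → ℕ → ℕ
Ffloor f x = floor2^ (x * ↧ₙ (f x)) (ℤ.∣ ↥ (f x) ∣)

iter : (ℕ → ℕ) → ℕ → ℕ → ℕ
iter F zero    x = x
iter F (suc h) x = F (iter F h x)

-- h ≤ C · log(1/p) / δ²  with p = 2|E|/n² and δ = a/b, written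
-- exactly (base-2 log, base absorbed in C) as
--   2^(h·a²) · (2|E|)^(C·b²) ≤ n^(2·C·b²)

HBound : ∀ {n} → ℕ → ℚ → Graph n → ℕ → Set
HBound {n} C δ G h =
  2 ^ (h * (a * a)) * (2 * edges G) ^ (C * (b * b)) ≤ n ^ (2 * (C * (b * b)))
  where
    a = ℤ.∣ ↥ δ ∣
    b = ↧ₙ δ

{- The densities of G on an equipartition P form a conditional expectation d_P of its adjacency
matrix. A convex potential Φ with Φ″ of order 1/x has range O(p log(1/p)) on such densities, and its
mean grows by Ω(δ²p) when P is refined to some Q with ‖d_P - d_Q‖₁ of order δp; this can happen only
O(log(1/p)/δ²) times. So it suffices to find, for P of order k, either such a Q whose order is a
bounded iterate of F at k, or a graph near G that is f(k)-regular on P.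

This alternative is a minimax argument. As long as ‖d_P - d_Q‖₁ is small, rescaling G on the blocks of
Q gives a [0,1]-valued W* near G whose averages on Q are d_P. Start with W = G. While W deviates from
d_P on some rectangle X × Y, refine Q so that X and Y are almost unions of classes and move W against
X × Y; while W is too far from G, move it back. Every step brings W closer to each W* that is balanced
for the current Q, so after boundedly many steps W is close to d_P on all rectangles, or no W* is left
and Q has changed the densities.

Finally W is rounded to a 0/1 matrix entry by entry. The direction of each rounding is chosen greedily
so that the rows of the error matrix stay almost orthogonal, which bounds the error on all rectangles. -}
module Submission where

open import Defs hiding (sym; irrefl)
open import Data.Bool using (Bool; true; false; if_then_else_; _∧_; _∨_; not; _xor_)
open import Data.Bool.Properties using (T-≡)
open import Data.Nat as ℕ using (ℕ; zero; suc; z≤n; s≤s)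
import Data.Nat.Properties as ℕP
open import Data.Nat.DivMod using (m≡m%n+[m/n]*n; m%n<n; m/n*n≤m; /-monoˡ-≤; n/n≡1)
import Data.Nat.Solver as ℕS
open import Data.Fin as Fin using (Fin; toℕ)
open import Data.Fin.Patterns using (0F)
import Data.Fin.Properties as FinP
open import Data.Fin.Subset using (Subset)
open import Data.Fin.Subset.Properties using (anySubset?)
open import Data.Vec as Vec using (Vec)
open import Data.Vec.Properties using (lookup∘tabulate)
open import Data.Integer as ℤ using (ℤ)
import Data.Integer.Properties as ℤP
open import Data.Rational as ℚ using (ℚ; 0ℚ; 1ℚ; ½; _/_; _+_; _*_; _-_; -_; _≤_; _<_; ∣_∣; _⊔_; _⊓_; mkℚ; ↥_; ↧ₙ_)
open import Data.Rational.Properties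
import Data.Rational.Unnormalised as ℚᵘ
import Data.Rational.Unnormalised.Properties as ℚᵘP
open import Data.Rational.Solver using (module +-*-Solver)
open import Data.Product using (Σ; _×_; _,_; proj₁; proj₂; ∃; Σ-syntax)
open import Data.Sum using (_⊎_; inj₁; inj₂; [_,_]′)
open import Data.Empty using (⊥; ⊥-elim)
open import Function using (_∘_; case_of_; module Equivalence)
import Relation.Binary
open import Relation.Binary.PropositionalEquality
open import Relation.Nullary using (Dec; yes; no)
open import Relation.Nullary.Decidable using (⌊_⌋)
open +-*-Solver using (solve; _:=_; _:+_; _:*_; _:-_; :-_; con)
open ℕS.+-*-Solver using () renaming (solve to solveℕ; _:+_ to _⊞_; _:*_ to _⊠_; _:=_ to _≐_; con to conℕ)

-- Edits are charged to |E(G)| and not to n², so a change of densities of L¹ order δp already has to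
-- pay; hence a curvature of order 1/x instead of a constant one. The range of the potential is the
-- second obstacle. For p near 1, log(1/p) is only of order 1 - p, so a range of order p would be
-- too large. The top scale of the potential is therefore bounded by a chord against a tangent and
-- contributes p(1 - p); the other J scales contribute 2p each, J being the integral part of
-- log₂(1/p).
--
-- The starting costs of the iteration are additive, of order 1/δ + J, and must also fit below
-- log(1/p)/δ². They do unless 1 - p is below order δ, and in that case all pairs of classes can
-- simply be made complete.
--
-- All arithmetic is rational. Cauchy-Schwarz becomes 2ab ≤ a² + b² with a free multiplier, x log x
-- becomes a sum of truncated quadratics, and log₂(1/p) is replaced by its lower bounds 1 - p and J,
-- stated as inequalities between powers.

private variable
  n m k l : ℕ
  x y z w : ℚ

-- Ordered-field arithmetic in ℚ

≤-by : ∀ d → 0ℚ ≤ d → y ≡ x + d → x ≤ y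
≤-by {y} {x} d 0≤d eq = subst₂ _≤_ (+-identityʳ x) (sym eq) (+-monoʳ-≤ x 0≤d)

0≤diff : x ≤ y → 0ℚ ≤ y - x
0≤diff {x} {y} h = subst (_≤ y - x) (+-inverseʳ x) (+-monoˡ-≤ (- x) h)

diff≤ : 0ℚ ≤ y - x → x ≤ y
diff≤ {y} {x} h = ≤-by (y - x) h (solve 2 (λ x y → y := x :+ (y :- x)) refl x y)

0≤+ : 0ℚ ≤ x → 0ℚ ≤ y → 0ℚ ≤ x + y
0≤+ a b = +-mono-≤ a b

0≤* : 0ℚ ≤ x → 0ℚ ≤ y → 0ℚ ≤ x * y
0≤* {x} {y} a b = subst (_≤ x * y) (*-zeroʳ x) (*-monoˡ-≤-nonNeg x {{ℚ.nonNegative a}} b)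

0<* : 0ℚ < x → 0ℚ < y → 0ℚ < x * y
0<* {x} {y} a b = subst (_< x * y) (*-zeroʳ x) (*-monoʳ-<-pos x {{ℚ.positive a}} b)

*-monoʳ : 0ℚ ≤ z → x ≤ y → z * x ≤ z * y
*-monoʳ {z} a b = *-monoˡ-≤-nonNeg z {{ℚ.nonNegative a}} b

*-monoˡ : 0ℚ ≤ z → x ≤ y → x * z ≤ y * z
*-monoˡ {z} a b = *-monoʳ-≤-nonNeg z {{ℚ.nonNegative a}} b

*-mono : 0ℚ ≤ x → 0ℚ ≤ w → x ≤ y → z ≤ w → x * z ≤ y * w
*-mono a b c d = ≤-trans (*-monoʳ a d) (*-monoˡ b c)

*-cancel : 0ℚ < z → z * x ≤ z * y → x ≤ y
*-cancel {z} a = *-cancelˡ-≤-pos z {{ℚ.positive a}}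

neg-sq : ∀ x → (- x) * (- x) ≡ x * x
neg-sq = solve 1 (λ x → (:- x) :* (:- x) := x :* x) refl

0≤sq : ∀ x → 0ℚ ≤ x * x
0≤sq x with ≤-total 0ℚ x
... | inj₁ a = 0≤* a a
... | inj₂ a = subst (0ℚ ≤_) (neg-sq x) (0≤* (neg-antimono-≤ a) (neg-antimono-≤ a))

0≤1 : 0ℚ ≤ 1ℚ
0≤1 = <⇒≤ (positive⁻¹ 1ℚ)

0<1 : 0ℚ < 1ℚ
0<1 = positive⁻¹ 1ℚ

0≤½ : 0ℚ ≤ ½
0≤½ = <⇒≤ (positive⁻¹ ½)

≤-dec⊎ : ∀ x y → x ≤ y ⊎ y < x
≤-dec⊎ x y with x ≤? y
... | yes a = inj₁ a
... | no a = inj₂ (≰⇒> a)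

abs-≤ : x ≤ y → - x ≤ y → ∣ x ∣ ≤ y
abs-≤ {x} {y} a b with ∣p∣≡p∨∣p∣≡-p x
... | inj₁ e = subst (_≤ y) (sym e) a
... | inj₂ e = subst (_≤ y) (sym e) b

-- The embedding of ℕ and total inverses

/1-toℚᵘ : ∀ i → ℚ.toℚᵘ (i / 1) ℚᵘ.≃ ℚᵘ.mkℚᵘ i 0
/1-toℚᵘ i = toℚᵘ-fromℚᵘ (ℚᵘ.mkℚᵘ i 0)

-- ι is ℕ→ℚ, made opaque so that unification never unfolds the gcd normalisation behind it.
opaque
  ι : ℕ → ℚ
  ι = ℕ→ℚ

  ι≡ : ∀ a → ι a ≡ ℕ→ℚ a
  ι≡ a = refl

  ι-0 : ι 0 ≡ 0ℚ
  ι-0 = refl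

  ι-1 : ι 1 ≡ 1ℚ
  ι-1 = refl

  ι-+ : ∀ a b → ι (a ℕ.+ b) ≡ ι a + ι b
  ι-+ a b = toℚᵘ-injective (ℚᵘP.≃-trans (/1-toℚᵘ (ℤ.+ (a ℕ.+ b)))
    (ℚᵘP.≃-trans (ℚᵘ.*≡* eq) (ℚᵘP.≃-sym (ℚᵘP.≃-trans (toℚᵘ-homo-+ (ι a) (ι b))
       (ℚᵘP.+-cong (/1-toℚᵘ (ℤ.+ a)) (/1-toℚᵘ (ℤ.+ b)))))))
    where
    eq : ℤ.+ (a ℕ.+ b) ℤ.* (ℤ.+ 1) ≡ (ℤ.+ a ℤ.* ℤ.+ 1 ℤ.+ (ℤ.+ b) ℤ.* ℤ.+ 1) ℤ.* ℤ.+ 1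
    eq = cong (ℤ._* ℤ.+ 1) (sym (cong₂ ℤ._+_ (ℤP.*-identityʳ (ℤ.+ a)) (ℤP.*-identityʳ (ℤ.+ b))))

  ι-* : ∀ a b → ι (a ℕ.* b) ≡ ι a * ι b
  ι-* a b = toℚᵘ-injective (ℚᵘP.≃-trans (/1-toℚᵘ (ℤ.+ (a ℕ.* b)))
    (ℚᵘP.≃-trans (ℚᵘ.*≡* (cong (ℤ._* ℤ.+ 1) (ℤP.pos-* a b)))
       (ℚᵘP.≃-sym (ℚᵘP.≃-trans (toℚᵘ-homo-* (ι a) (ι b))
       (ℚᵘP.*-cong (/1-toℚᵘ (ℤ.+ a)) (/1-toℚᵘ (ℤ.+ b)))))))

  ι-mono : ∀ {a b} → a ℕ.≤ b → ι a ≤ ι b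
  ι-mono {a} {b} h = toℚᵘ-cancel-≤ (ℚᵘP.≤-trans (ℚᵘP.≤-reflexive (/1-toℚᵘ (ℤ.+ a)))
    (ℚᵘP.≤-trans (ℚᵘ.*≤* (subst₂ ℤ._≤_ (sym (ℤP.*-identityʳ (ℤ.+ a))) (sym (ℤP.*-identityʳ (ℤ.+ b))) (ℤ.+≤+ h)))
      (ℚᵘP.≤-reflexive (ℚᵘP.≃-sym (/1-toℚᵘ (ℤ.+ b))))))

  ι-mono-< : ∀ {a b} → a ℕ.< b → ι a < ι b
  ι-mono-< {a} {b} h = toℚᵘ-cancel-< (ℚᵘP.≤-<-trans (ℚᵘP.≤-reflexive (/1-toℚᵘ (ℤ.+ a)))
    (ℚᵘP.<-≤-trans (ℚᵘ.*<* (subst₂ ℤ._<_ (sym (ℤP.*-identityʳ (ℤ.+ a))) (sym (ℤP.*-identityʳ (ℤ.+ b))) (ℤ.+<+ h)))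
      (ℚᵘP.≤-reflexive (ℚᵘP.≃-sym (/1-toℚᵘ (ℤ.+ b))))))

ι-suc : ∀ a → ι (suc a) ≡ 1ℚ + ι a
ι-suc a = trans (ι-+ 1 a) (cong (_+ ι a) ι-1)

ι-reflect-≤ : ∀ {a b} → ι a ≤ ι b → a ℕ.≤ b
ι-reflect-≤ {a} {b} h = ℕP.≮⇒≥ λ b<a → <-irrefl refl (<-≤-trans (ι-mono-< b<a) h)

0≤ι : ∀ a → 0ℚ ≤ ι a
0≤ι a = subst (_≤ ι a) ι-0 (ι-mono {0} {a} z≤n)

0<ι : ∀ {a} → 0 ℕ.< a → 0ℚ < ι a
0<ι {a} h = subst (_< ι a) ι-0 (ι-mono-< {0} h)

inv : ℚ → ℚ
inv x with x ≟ 0ℚ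
... | yes _ = 0ℚ
... | no x≢0 = ℚ.1/_ x {{ℚ.≢-nonZero x≢0}}

*-inv : 0ℚ < x → x * inv x ≡ 1ℚ
*-inv {x} 0<x with x ≟ 0ℚ
... | yes x≡0 = ⊥-elim (<⇒≢ 0<x (sym x≡0))
... | no x≢0 = *-inverseʳ x {{ℚ.≢-nonZero x≢0}}

0<inv : 0ℚ < x → 0ℚ < inv x
0<inv {x} 0<x with ≤-dec⊎ (inv x) 0ℚ
... | inj₂ h = h
... | inj₁ h = ⊥-elim (<-irrefl refl (<-≤-trans 0<1
     (subst₂ _≤_ (*-inv 0<x) (*-zeroʳ x) (*-monoʳ (<⇒≤ 0<x) h))))

χ : Bool → ℚ
χ b = if b then 1ℚ else 0ℚ

0≤χ : ∀ b → 0ℚ ≤ χ b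
0≤χ true = 0≤1
0≤χ false = ≤-refl

χ≤1 : ∀ b → χ b ≤ 1ℚ
χ≤1 true = ≤-refl
χ≤1 false = 0≤1

-- Finite sums

∑ : (Fin n → ℚ) → ℚ
∑ {zero}  f = 0ℚ
∑ {suc n} f = f 0F + ∑ (f ∘ Fin.suc)

∑-cong : {f g : Fin n → ℚ} → (∀ i → f i ≡ g i) → ∑ f ≡ ∑ g
∑-cong {zero}  h = refl
∑-cong {suc n} h = cong₂ _+_ (h 0F) (∑-cong (h ∘ Fin.suc))

∑-mono : {f g : Fin n → ℚ} → (∀ i → f i ≤ g i) → ∑ f ≤ ∑ g
∑-mono {zero}  h = ≤-refl
∑-mono {suc n} h = +-mono-≤ (h 0F) (∑-mono (h ∘ Fin.suc))

∑-+ : (f g : Fin n → ℚ) → ∑ (λ i → f i + g i) ≡ ∑ f + ∑ g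
∑-+ {zero}  f g = refl
∑-+ {suc n} f g = trans (cong ((f 0F + g 0F) +_) (∑-+ (f ∘ Fin.suc) (g ∘ Fin.suc)))
  (solve 4 (λ a b c d → (a :+ b) :+ (c :+ d) := (a :+ c) :+ (b :+ d)) refl
    (f 0F) (g 0F) (∑ (f ∘ Fin.suc)) (∑ (g ∘ Fin.suc)))

∑-*ˡ : ∀ c (f : Fin n → ℚ) → ∑ (λ i → c * f i) ≡ c * ∑ f
∑-*ˡ {zero}  c f = sym (*-zeroʳ c)
∑-*ˡ {suc n} c f = trans (cong (c * f 0F +_) (∑-*ˡ c (f ∘ Fin.suc)))
  (sym (*-distribˡ-+ c (f 0F) (∑ (f ∘ Fin.suc))))

∑-*ʳ : ∀ (f : Fin n → ℚ) c → ∑ (λ i → f i * c) ≡ ∑ f * c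
∑-*ʳ f c = trans (∑-cong (λ i → *-comm (f i) c)) (trans (∑-*ˡ c f) (*-comm c (∑ f)))

∑-const : ∀ n c → ∑ {n} (λ _ → c) ≡ ι n * c
∑-const zero c = sym (trans (cong (_* c) ι-0) (*-zeroˡ c))
∑-const (suc n) c = trans (cong (c +_) (∑-const n c))
  (trans (solve 2 (λ c n → c :+ n :* c := (con 1ℚ :+ n) :* c) refl c (ι n))
         (cong (_* c) (sym (ι-suc n))))

∑-zero : ∀ n → ∑ {n} (λ _ → 0ℚ) ≡ 0ℚ
∑-zero n = trans (∑-const n 0ℚ) (*-zeroʳ (ι n))

∑-swap : (f : Fin n → Fin m → ℚ) → ∑ (λ i → ∑ (λ j → f i j)) ≡ ∑ (λ j → ∑ (λ i → f i j))
∑-swap {zero} {m} f = sym (∑-zero m)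
∑-swap {suc n} {m} f = trans (cong (∑ (f 0F) +_) (∑-swap (f ∘ Fin.suc)))
  (sym (∑-+ (f 0F) (λ j → ∑ (λ i → f (Fin.suc i) j))))

∑-nonneg : {f : Fin n → ℚ} → (∀ i → 0ℚ ≤ f i) → 0ℚ ≤ ∑ f
∑-nonneg {n} {f} h = subst (_≤ ∑ f) (∑-zero n) (∑-mono h)

∑-term : {f : Fin n → ℚ} → (∀ i → 0ℚ ≤ f i) → ∀ i → f i ≤ ∑ f
∑-term {suc n} {f} h 0F = ≤-by _ (∑-nonneg (h ∘ Fin.suc)) refl
∑-term {suc n} {f} h (Fin.suc i) = ≤-trans (∑-term (h ∘ Fin.suc) i)
  (≤-by (f 0F) (h 0F) (+-comm (f 0F) (∑ (f ∘ Fin.suc))))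

∬ : (Fin n → Fin m → ℚ) → ℚ
∬ f = ∑ (λ i → ∑ (f i))

∬-cong : {f g : Fin n → Fin m → ℚ} → (∀ i j → f i j ≡ g i j) → ∬ f ≡ ∬ g
∬-cong h = ∑-cong (λ i → ∑-cong (h i))

∬-mono : {f g : Fin n → Fin m → ℚ} → (∀ i j → f i j ≤ g i j) → ∬ f ≤ ∬ g
∬-mono h = ∑-mono (λ i → ∑-mono (h i))

∬-+ : (f g : Fin n → Fin m → ℚ) → ∬ (λ i j → f i j + g i j) ≡ ∬ f + ∬ g
∬-+ f g = trans (∑-cong (λ i → ∑-+ (f i) (g i))) (∑-+ (∑ ∘ f) (∑ ∘ g))

∬-*ˡ : ∀ c (f : Fin n → Fin m → ℚ) → ∬ (λ i j → c * f i j) ≡ c * ∬ f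
∬-*ˡ c f = trans (∑-cong (λ i → ∑-*ˡ c (f i))) (∑-*ˡ c (∑ ∘ f))

∬-neg : (f : Fin n → Fin m → ℚ) → ∬ (λ i j → - f i j) ≡ - ∬ f
∬-neg f = trans (∬-cong (λ i j → neg≡ (f i j))) (trans (∬-*ˡ (- 1ℚ) f) (sym (neg≡ (∬ f))))
  where
  neg≡ : ∀ x → - x ≡ (- 1ℚ) * x
  neg≡ = solve 1 (λ x → :- x := con (- 1ℚ) :* x) refl

∬-- : (f g : Fin n → Fin m → ℚ) → ∬ (λ i j → f i j - g i j) ≡ ∬ f - ∬ g
∬-- f g = trans (∬-+ f (λ i j → - g i j)) (cong (∬ f +_) (∬-neg g))

∬-const : ∀ n m c → ∬ {n} {m} (λ _ _ → c) ≡ ι n * (ι m * c)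
∬-const n m c = trans (∑-cong {n} (λ _ → ∑-const m c)) (∑-const n (ι m * c))

∬-nonneg : {f : Fin n → Fin m → ℚ} → (∀ i j → 0ℚ ≤ f i j) → 0ℚ ≤ ∬ f
∬-nonneg h = ∑-nonneg (λ i → ∑-nonneg (h i))

ι-sumF : (f : Fin n → ℕ) → ι (sumF f) ≡ ∑ (λ i → ι (f i))
ι-sumF {zero}  f = ι-0
ι-sumF {suc n} f = trans (ι-+ (f 0F) (sumF (f ∘ Fin.suc))) (cong (ι (f 0F) +_) (ι-sumF (f ∘ Fin.suc)))

ι-count : (f : Fin n → Bool) → ι (count f) ≡ ∑ (λ i → χ (f i))
ι-count f = trans (ι-sumF (λ i → if f i then 1 else 0)) (∑-cong (λ i → ι-if (f i)))
  where
  ι-if : ∀ b → ι (if b then 1 else 0) ≡ χ b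
  ι-if true = ι-1
  ι-if false = ι-0

-- Averaging over the classes of a labelling

Measurable : (Fin n → Fin k) → (Fin n → Fin n → ℚ) → Set
Measurable P φ = ∀ {u u' v v'} → P u ≡ P u' → P v ≡ P v' → φ u v ≡ φ u' v'

same : Fin k → Fin k → ℚ
same i j = χ ⌊ i Fin.≟ j ⌋

-- The kernel is symmetric and vanishes unless the labels agree, so under it a factor may be carried
-- from one label to the other.
same-swap : ∀ (i j : Fin k) → (i ≡ j → x ≡ y) → same i j * x ≡ same j i * y
same-swap {x = x} {y} i j h with i Fin.≟ j | j Fin.≟ i
... | yes p | yes q = cong (1ℚ *_) (h p)
... | no p | no q = trans (*-zeroˡ x) (sym (*-zeroˡ y))
... | yes p | no q = ⊥-elim (q (sym p))
... | no p | yes q = ⊥-elim (p (sym q))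

same-refl : ∀ (i : Fin k) → same i i ≡ 1ℚ
same-refl i with i Fin.≟ i
... | yes _ = refl
... | no q = ⊥-elim (q refl)

module Average {n k : ℕ} (P : Fin n → Fin k) where

  mass : Fin k → ℚ
  mass j = ∑ (λ u → same j (P u))

  0<mass : ∀ u → 0ℚ < mass (P u)
  0<mass u = <-≤-trans 0<1 (subst (_≤ mass (P u)) (same-refl (P u))
    (∑-term (λ v → 0≤χ ⌊ P u Fin.≟ P v ⌋) u))

  avg : (Fin n → ℚ) → Fin k → ℚ
  avg f j = inv (mass j) * ∑ (λ u → same j (P u) * f u)

  avg-cong : {f g : Fin n → ℚ} → (∀ i → f i ≡ g i) → ∀ j → avg f j ≡ avg g j
  avg-cong h j = cong (inv (mass j) *_) (∑-cong (λ u → cong (same j (P u) *_) (h u)))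

  avg-mono : {f g : Fin n → ℚ} → (∀ i → f i ≤ g i) → ∀ v → avg f (P v) ≤ avg g (P v)
  avg-mono h v = *-monoʳ (<⇒≤ (0<inv (0<mass v))) (∑-mono (λ u → *-monoʳ (0≤χ ⌊ P v Fin.≟ P u ⌋) (h u)))

  avg-const : ∀ c v → avg (λ _ → c) (P v) ≡ c
  avg-const c v = trans (cong (inv (mass (P v)) *_) (∑-*ʳ (λ u → same (P v) (P u)) c))
    (trans (solve 3 (λ i m c → i :* (m :* c) := (m :* i) :* c) refl (inv (mass (P v))) (mass (P v)) c)
      (trans (cong (_* c) (*-inv (0<mass v))) (*-identityˡ c)))

  -- Averaging is self-adjoint. As a double sum with kernel `same`, the left side lets the factor
  -- `c u` move to `v`; after exchanging the sums the inner sum is the mass of the class and cancels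
  -- its inverse.
  avg-adj : (f φ : Fin n → ℚ) → (∀ {u v} → P u ≡ P v → φ u ≡ φ v) →
    ∑ (λ u → avg f (P u) * φ u) ≡ ∑ (λ u → f u * φ u)
  avg-adj f φ meas = begin
    ∑ (λ u → avg f (P u) * φ u)
      ≡⟨ ∑-cong (λ u → trans (r1 (inv (mass (P u))) _ (φ u)) (sym (∑-*ʳ (λ v → same (P u) (P v) * f v) _))) ⟩
    ∑ (λ u → ∑ (λ v → same (P u) (P v) * f v * c u))
      ≡⟨ ∬-cong (λ u v → step u v) ⟩
    ∑ (λ u → ∑ (λ v → same (P v) (P u) * (f v * c v)))
      ≡⟨ ∑-swap (λ u v → same (P v) (P u) * (f v * c v)) ⟩
    ∑ (λ v → ∑ (λ u → same (P v) (P u) * (f v * c v)))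
      ≡⟨ ∑-cong (λ v → trans (∑-*ʳ (λ u → same (P v) (P u)) (f v * c v)) (cancel v)) ⟩
    ∑ (λ u → f u * φ u) ∎
    where
    open ≡-Reasoning
    c : Fin n → ℚ
    c u = inv (mass (P u)) * φ u
    r1 : ∀ i s t → i * s * t ≡ s * (i * t)
    r1 = solve 3 (λ i s t → i :* s :* t := s :* (i :* t)) refl
    step : ∀ u v → same (P u) (P v) * f v * c u ≡ same (P v) (P u) * (f v * c v)
    step u v = trans (solve 3 (λ a b c → a :* b :* c := a :* (b :* c)) refl (same (P u) (P v)) (f v) (c u))
      (same-swap (P u) (P v) (λ e → cong (f v *_) (cong₂ _*_ (cong (λ j → inv (mass j)) e) (meas e))))
    cancel : ∀ v → mass (P v) * (f v * c v) ≡ f v * φ v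
    cancel v = trans (solve 4 (λ m f i φ → m :* (f :* (i :* φ)) := (m :* i) :* (f :* φ)) refl
              (mass (P v)) (f v) (inv (mass (P v))) (φ v))
      (trans (cong (_* (f v * φ v)) (*-inv (0<mass v))) (*-identityˡ _))

  block : (Fin n → Fin n → ℚ) → Fin k → Fin k → ℚ
  block g i j = avg (λ u → avg (g u) j) i

  E : (Fin n → Fin n → ℚ) → Fin n → Fin n → ℚ
  E g u v = block g (P u) (P v)

  E-measurable : ∀ g → Measurable P (E g)
  E-measurable g p q = cong₂ (block g) p q

  E-mono : ∀ {g h : Fin n → Fin n → ℚ} → (∀ u v → g u v ≤ h u v) → ∀ u v → E g u v ≤ E h u v
  E-mono h u v = avg-mono (λ u' → avg-mono (h u') v) u

  E-const : ∀ c u v → E (λ _ _ → c) u v ≡ c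
  E-const c u v = trans (avg-cong (λ _ → avg-const c v) (P u)) (avg-const c u)

  E-nonneg : ∀ {g : Fin n → Fin n → ℚ} → (∀ u v → 0ℚ ≤ g u v) → ∀ u v → 0ℚ ≤ E g u v
  E-nonneg {g} h u v = subst (_≤ E g u v) (E-const 0ℚ u v) (E-mono h u v)

  E≤1 : ∀ {g : Fin n → Fin n → ℚ} → (∀ u v → g u v ≤ 1ℚ) → ∀ u v → E g u v ≤ 1ℚ
  E≤1 {g} h u v = subst (E g u v ≤_) (E-const 1ℚ u v) (E-mono h u v)

  E-adj : ∀ g φ → Measurable P φ → ∬ (λ u v → E g u v * φ u v) ≡ ∬ (λ u v → g u v * φ u v)
  E-adj g φ meas = begin
    ∬ (λ u v → E g u v * φ u v) ≡⟨ ∑-swap (λ u v → E g u v * φ u v) ⟩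
    ∑ (λ v → ∑ (λ u → E g u v * φ u v))
      ≡⟨ ∑-cong (λ v → avg-adj (λ u → avg (g u) (P v)) (λ u → φ u v) (λ e → meas e refl)) ⟩
    ∑ (λ v → ∑ (λ u → avg (g u) (P v) * φ u v)) ≡⟨ ∑-swap (λ v u → avg (g u) (P v) * φ u v) ⟩
    ∑ (λ u → ∑ (λ v → avg (g u) (P v) * φ u v))
      ≡⟨ ∑-cong (λ u → avg-adj (g u) (φ u) (λ e → meas refl e)) ⟩
    ∬ (λ u v → g u v * φ u v) ∎
    where open ≡-Reasoning

  ∬-E : ∀ g → ∬ (E g) ≡ ∬ g
  ∬-E g = trans (∬-cong (λ u v → sym (*-identityʳ (E g u v))))
    (trans (E-adj g (λ _ _ → 1ℚ) (λ _ _ → refl)) (∬-cong (λ u v → *-identityʳ (g u v))))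

Measurable-refine : ∀ {P : Fin n → Fin k} {Q : Fin n → Fin l} {φ} → Refines Q P → Measurable P φ → Measurable Q φ
Measurable-refine r meas p q = meas (r _ _ p) (r _ _ q)

-- Against a `P`-measurable function both expectations integrate like `g` itself. This kills the
-- linear term when the energies of `P` and `Q` are compared.
E-adj-diff : ∀ {P : Fin n → Fin k} {Q : Fin n → Fin l} → Refines Q P → ∀ g φ → Measurable P φ →
  ∬ (λ u v → φ u v * (Average.E Q g u v - Average.E P g u v)) ≡ 0ℚ
E-adj-diff {P = P} {Q} r g φ meas = begin
  ∬ (λ u v → φ u v * (dQ u v - dP u v))
    ≡⟨ ∬-cong (λ u v → solve 3 (λ f y x → f :* (y :- x) := y :* f :- x :* f) refl (φ u v) (dQ u v) (dP u v)) ⟩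
  ∬ (λ u v → dQ u v * φ u v - dP u v * φ u v)
    ≡⟨ ∬-- (λ u v → dQ u v * φ u v) (λ u v → dP u v * φ u v) ⟩
  ∬ (λ u v → dQ u v * φ u v) - ∬ (λ u v → dP u v * φ u v)
    ≡⟨ cong₂ _-_ (Average.E-adj Q g φ (Measurable-refine {P = P} {Q} {φ} r meas)) (Average.E-adj P g φ meas) ⟩
  ∬ (λ u v → g u v * φ u v) - ∬ (λ u v → g u v * φ u v)
    ≡⟨ +-inverseʳ (∬ (λ u v → g u v * φ u v)) ⟩
  0ℚ ∎
  where
  open ≡-Reasoning
  dP = Average.E P g
  dQ = Average.E Q g

-- A convex potential with second derivative of order 1/x on [2⁻ᴶ,1]

hf pw : ℕ → ℚ
hf zero = 1ℚ
hf (suc j) = ½ * hf j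
pw zero = 1ℚ
pw (suc j) = (1ℚ + 1ℚ) * pw j

0<hf : ∀ j → 0ℚ < hf j
0<hf zero = 0<1
0<hf (suc j) = 0<* (positive⁻¹ ½) (0<hf j)

0<pw : ∀ j → 0ℚ < pw j
0<pw zero = 0<1
0<pw (suc j) = 0<* (positive⁻¹ (1ℚ + 1ℚ)) (0<pw j)

pw*hf : ∀ j → pw j * hf j ≡ 1ℚ
pw*hf zero = refl
pw*hf (suc j) = trans (solve 2 (λ a b → (con 1ℚ :+ con 1ℚ) :* a :* (con ½ :* b) := a :* b) refl (pw j) (hf j)) (pw*hf j)

pos : ℚ → ℚ → ℚ
pos a x = (a - x) ⊔ 0ℚ

0≤pos : ∀ a x → 0ℚ ≤ pos a x
0≤pos a x = p≤q⊔p (a - x) 0ℚ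

diff≤pos : ∀ a x → a - x ≤ pos a x
diff≤pos a x = p≤p⊔q (a - x) 0ℚ

pos-≥ : ∀ {a x} → x ≤ a → pos a x ≡ a - x
pos-≥ h = p≥q⇒p⊔q≡p (0≤diff h)

pos-≤ : ∀ {a x} → a ≤ x → pos a x ≡ 0ℚ
pos-≤ {a} {x} h = p≤q⇒p⊔q≡q (subst (a - x ≤_) (+-inverseʳ x) (+-monoˡ-≤ (- x) h))

-- `term j` is 2ʲ(2⁻ʲ - x)₊², with second derivative 2ʲ⁺¹ below 2⁻ʲ and 0 above; `dterm j` is minus
-- its derivative. For 2⁻ᴶ ≤ x < 1 the second derivatives add up to order 1/x, as for x log x.
term dterm : ℕ → ℚ → ℚ
term j x = pw j * (pos (hf j) x * pos (hf j) x)
dterm j x = pw j * (pos (hf j) x + pos (hf j) x)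

Φ Ψ : ℕ → ℚ → ℚ
Φ zero x = term zero x
Φ (suc J) x = Φ J x + term (suc J) x
Ψ zero x = dterm zero x
Ψ (suc J) x = Ψ J x + dterm (suc J) x

-- gap J is the error of the tangent of Φ J at x, since Ψ J = -(Φ J)'.
gapₜ gap : ℕ → ℚ → ℚ → ℚ
gapₜ j x y = term j y - term j x + dterm j x * (y - x)
gap J x y = Φ J y - Φ J x + Ψ J x * (y - x)

gap-suc : ∀ J x y → gap (suc J) x y ≡ gap J x y + gapₜ (suc J) x y
gap-suc J x y = solve 7 (λ a b c d e f z → (a :+ b) :- (c :+ d) :+ (e :+ f) :* z :=
    (a :- c :+ e :* z) :+ (b :- d :+ f :* z)) refl
  (Φ J y) (term (suc J) y) (Φ J x) (term (suc J) x) (Ψ J x) (dterm (suc J) x) (y - x)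

gapₜ-factor : ∀ j x y → gapₜ j x y ≡
  pw j * (pos (hf j) y * pos (hf j) y - pos (hf j) x * pos (hf j) x + (pos (hf j) x + pos (hf j) x) * (y - x))
gapₜ-factor j x y = solve 4 (λ p a b z → p :* (b :* b) :- p :* (a :* a) :+ p :* (a :+ a) :* z :=
    p :* (b :* b :- a :* a :+ (a :+ a) :* z)) refl (pw j) (pos (hf j) x) (pos (hf j) y) (y - x)

-- Convexity of the squared positive part. With A and B the positive parts at x and y, for x ≤ a the
-- expression equals (A - B)² + 2A(B - (a - y)), and B ≥ a - y.
pos-tangent : ∀ a x y → 0ℚ ≤ pos a y * pos a y - pos a x * pos a x + (pos a x + pos a x) * (y - x)
pos-tangent a x y with ≤-total x a
... | inj₂ a≤x rewrite pos-≤ a≤x = ≤-trans (0≤sq (pos a y)) (≤-reflexive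
        (solve 2 (λ b z → b :* b := b :* b :- con 0ℚ :* con 0ℚ :+ (con 0ℚ :+ con 0ℚ) :* z) refl (pos a y) (y - x)))
... | inj₁ x≤a = ≤-trans (0≤+ (0≤sq (A - B)) (0≤* (0≤+ (0≤pos a x) (0≤pos a x)) (0≤diff (diff≤pos a y))))
        (≤-reflexive eq)
  where
  A = pos a x
  B = pos a y
  eq : (A - B) * (A - B) + (A + A) * (B - (a - y)) ≡ B * B - A * A + (A + A) * (y - x)
  eq rewrite pos-≥ x≤a = solve 4 (λ a x y b → ((a :- x) :- b) :* ((a :- x) :- b) :+ ((a :- x) :+ (a :- x)) :* (b :- (a :- y))
       := b :* b :- (a :- x) :* (a :- x) :+ ((a :- x) :+ (a :- x)) :* (y :- x)) refl a x y B

0≤gapₜ : ∀ j x y → 0ℚ ≤ gapₜ j x y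
0≤gapₜ j x y = subst (0ℚ ≤_) (sym (gapₜ-factor j x y)) (0≤* (<⇒≤ (0<pw j)) (pos-tangent (hf j) x y))

gapₜ-quadratic : ∀ j → x ≤ hf j → y ≤ x → gapₜ j x y ≡ pw j * ((x - y) * (x - y))
gapₜ-quadratic {x} {y} j x≤a y≤x = trans (gapₜ-factor j x y) (cong (pw j *_) eq)
  where
  eq : pos (hf j) y * pos (hf j) y - pos (hf j) x * pos (hf j) x + (pos (hf j) x + pos (hf j) x) * (y - x) ≡ (x - y) * (x - y)
  eq rewrite pos-≥ x≤a | pos-≥ (≤-trans y≤x x≤a) =
    solve 3 (λ a x y → (a :- y) :* (a :- y) :- (a :- x) :* (a :- x) :+ ((a :- x) :+ (a :- x)) :* (y :- x) := (x :- y) :* (x :- y)) refl (hf j) x y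

0≤gap : ∀ J x y → 0ℚ ≤ gap J x y
0≤gap zero x y = 0≤gapₜ zero x y
0≤gap (suc J) x y = subst (0ℚ ≤_) (sym (gap-suc J x y)) (0≤+ (0≤gap J x y) (0≤gapₜ (suc J) x y))

gapₜ≤gap : ∀ {j J} x y → j ℕ.≤ J → gapₜ j x y ≤ gap J x y
gapₜ≤gap {zero} {zero} x y z≤n = ≤-refl
gapₜ≤gap {j} {suc J} x y j≤J with ℕP.m≤n⇒m<n∨m≡n j≤J
... | inj₁ (s≤s j≤J') = ≤-trans (gapₜ≤gap x y j≤J') (≤-by (gapₜ (suc J) x y) (0≤gapₜ (suc J) x y) (gap-suc J x y))
... | inj₂ refl = ≤-by (gap J x y) (0≤gap J x y) (trans (gap-suc J x y) (+-comm (gap J x y) (gapₜ (suc J) x y)))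

-- The finest scale with x ≤ 2⁻ʲ: its quadratic is active at x and everywhere below, with curvature
-- comparable to 1/x. If x is far below the last scale, J is taken, and `gap-≥` pays for this with
-- p.
dyadic-scale : ∀ J → x ≤ 1ℚ → ∃ λ j → j ℕ.≤ J × x ≤ hf j × (hf j ≤ x + x ⊎ j ≡ J)
dyadic-scale zero x≤1 = zero , z≤n , x≤1 , inj₂ refl
dyadic-scale {x} (suc J) x≤1 with ≤-dec⊎ x (hf (suc J))
... | inj₁ h = suc J , ℕP.≤-refl , h , inj₂ refl
... | inj₂ h with dyadic-scale J x≤1
...   | j , j≤J , a , inj₁ b = j , ℕP.m≤n⇒m≤1+n j≤J , a , inj₁ b
...   | j , j≤J , a , inj₂ refl = j , ℕP.m≤n⇒m≤1+n j≤J , a , inj₁ (≤-trans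
          (≤-reflexive (solve 1 (λ h → h := con ½ :* h :+ con ½ :* h) refl (hf J))) (+-mono-≤ (<⇒≤ h) (<⇒≤ h)))

-- The quadratic at the scale j of x alone gives a gap of at least 2ʲ(x - y)², and 2τ(x - y) ≤ 2ʲ(x
-- - y)² + τ²2⁻ʲ, where 2⁻ʲ is at most 2x or, at the last scale, 2p. With the slope τ free, the
-- inequality can be summed over all entries without square roots. Decreases of density suffice,
-- since the densities compared later have equal integrals.
gap-≥ : ∀ J {p τ} → 0ℚ ≤ x → x ≤ 1ℚ → 0ℚ ≤ p → 0ℚ ≤ τ → hf J ≤ p + p →
  (τ + τ) * pos x y ≤ gap J x y + τ * τ * ((x + p) + (x + p))
gap-≥ {x} {y} J {p} {τ} 0≤x x≤1 0≤p 0≤τ hJ with ≤-total x y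
... | inj₁ x≤y rewrite pos-≤ x≤y = subst (_≤ gap J x y + τ * τ * ((x + p) + (x + p))) (sym (*-zeroʳ (τ + τ)))
       (0≤+ (0≤gap J x y) (0≤* (0≤sq τ) (0≤+ (0≤+ 0≤x 0≤p) (0≤+ 0≤x 0≤p))))
... | inj₂ y≤x with dyadic-scale J x≤1
...   | j , j≤J , x≤a , s rewrite pos-≥ y≤x = begin
  (τ + τ) * (x - y)
    ≤⟨ ≤-by (pw j * ((d - τ * hf j) * (d - τ * hf j))) (0≤* (<⇒≤ (0<pw j)) (0≤sq (d - τ * hf j))) eq ⟩
  pw j * (d * d) + τ * τ * hf j
    ≤⟨ +-mono-≤ (≤-trans (≤-reflexive (sym (gapₜ-quadratic j x≤a y≤x))) (gapₜ≤gap x y j≤J))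
         (*-monoʳ (0≤sq τ) (bound s)) ⟩
  gap J x y + τ * τ * ((x + p) + (x + p)) ∎
  where
  open ≤-Reasoning
  d = x - y
  eq : pw j * (d * d) + τ * τ * hf j ≡ (τ + τ) * d + pw j * ((d - τ * hf j) * (d - τ * hf j))
  eq = trans (solve 4 (λ w h d t → w :* (d :* d) :+ t :* t :* h :=
           (t :+ t) :* d :* (w :* h) :+ w :* ((d :- t :* h) :* (d :- t :* h)) :+ t :* t :* h :* (con 1ℚ :- w :* h)) refl (pw j) (hf j) d τ)
       (trans (cong (λ q → (τ + τ) * d * q + pw j * ((d - τ * hf j) * (d - τ * hf j)) + τ * τ * hf j * (1ℚ - q)) (pw*hf j))
         (solve 3 (λ a b c → a :* con 1ℚ :+ b :+ c :* (con 1ℚ :- con 1ℚ) := a :+ b) refl ((τ + τ) * d) (pw j * ((d - τ * hf j) * (d - τ * hf j))) (τ * τ * hf j)))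
  bound : hf j ≤ x + x ⊎ j ≡ J → hf j ≤ (x + p) + (x + p)
  bound (inj₁ h) = ≤-trans h (≤-by (p + p) (0≤+ 0≤p 0≤p) (solve 2 (λ x p → (x :+ p) :+ (x :+ p) := (x :+ x) :+ (p :+ p)) refl x p))
  bound (inj₂ refl) = ≤-trans hJ (≤-by (x + x) (0≤+ 0≤x 0≤x) (solve 2 (λ x p → (x :+ p) :+ (x :+ p) := (p :+ p) :+ (x :+ x)) refl x p))

-- For y ≥ 0 a term is at most 2⁻ʲ, and (a - x)₊² ≥ a² - 2ax. As the densities x have mean p, each
-- scale adds at most 2p to the range of the mean energy.
term-range : ∀ j → 0ℚ ≤ x → 0ℚ ≤ y → term j y ≤ term j x + (x + x)
term-range {x} {y} j 0≤x 0≤y = begin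
  pw j * (B * B) ≤⟨ *-monoʳ 0≤w (≤-trans (*-mono (0≤pos a y) (<⇒≤ (0<hf j)) B≤a B≤a) key) ⟩
  pw j * (A * A + a * (x + x)) ≡⟨ trans (*-distribˡ-+ (pw j) _ _) (cong (pw j * (A * A) +_)
       (trans (sym (*-assoc (pw j) a _)) (trans (cong (_* (x + x)) (pw*hf j)) (*-identityˡ _)))) ⟩
  term j x + (x + x) ∎
  where
  open ≤-Reasoning
  a = hf j
  A = pos a x
  B = pos a y
  0≤w = <⇒≤ (0<pw j)
  B≤a : B ≤ a
  B≤a with ≤-total y a
  ... | inj₁ y≤a = ≤-trans (≤-reflexive (pos-≥ y≤a)) (≤-by y 0≤y (solve 2 (λ a y → a := (a :- y) :+ y) refl a y))
  ... | inj₂ a≤y = ≤-trans (≤-reflexive (pos-≤ a≤y)) (<⇒≤ (0<hf j))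
  key : a * a ≤ A * A + a * (x + x)
  key with ≤-total x a
  ... | inj₁ x≤a rewrite pos-≥ x≤a = ≤-by (x * x) (0≤sq x)
          (solve 2 (λ a x → (a :- x) :* (a :- x) :+ a :* (x :+ x) := a :* a :+ x :* x) refl a x)
  ... | inj₂ a≤x = ≤-trans (*-monoʳ (<⇒≤ (0<hf j)) a≤x)
          (≤-by (A * A + a * x) (0≤+ (0≤sq A) (0≤* (<⇒≤ (0<hf j)) 0≤x))
            (solve 3 (λ a A x → A :* A :+ a :* (x :+ x) := a :* x :+ (A :* A :+ a :* x)) refl a A x))

-- Scale 0 is treated apart: (1 - y)² lies below the chord 1 - y, and (1 - x)² above its tangent at
-- p. Integrated, the difference is p(1 - p) per entry, which stays within log(1/p) even for p near
-- 1.
Φ-range : ∀ J p → 0ℚ ≤ x → x ≤ 1ℚ → 0ℚ ≤ y → y ≤ 1ℚ →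
  Φ J y ≤ Φ J x + ((1ℚ - y) - (1ℚ - p) * ((1ℚ - p) - ((x - p) + (x - p)))) + ι J * (x + x)
Φ-range {x} {y} zero p 0≤x x≤1 0≤y y≤1 rewrite pos-≥ x≤1 | pos-≥ y≤1 | ι-0 =
  ≤-by ((x - p) * (x - p) + y * (1ℚ - y)) (0≤+ (0≤sq (x - p)) (0≤* 0≤y (0≤diff y≤1)))
   (solve 3 (λ x y p → con 1ℚ :* ((con 1ℚ :- x) :* (con 1ℚ :- x)) :+ ((con 1ℚ :- y) :- (con 1ℚ :- p) :* ((con 1ℚ :- p) :- ((x :- p) :+ (x :- p)))) :+ con 0ℚ :* (x :+ x)
      := con 1ℚ :* ((con 1ℚ :- y) :* (con 1ℚ :- y)) :+ ((x :- p) :* (x :- p) :+ y :* (con 1ℚ :- y))) refl x y p)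
Φ-range {x} {y} (suc J) p 0≤x x≤1 0≤y y≤1 = ≤-trans
  (+-mono-≤ (Φ-range J p 0≤x x≤1 0≤y y≤1) (term-range (suc J) 0≤x 0≤y))
  (≤-reflexive (trans (solve 5 (λ a b c j x → (a :+ c :+ j :* (x :+ x)) :+ (b :+ (x :+ x)) := (a :+ b) :+ c :+ (con 1ℚ :+ j) :* (x :+ x)) refl
     (Φ J x) (term (suc J) x) _ (ι J) x)
     (cong (λ t → Φ J x + term (suc J) x + ((1ℚ - y) - (1ℚ - p) * ((1ℚ - p) - ((x - p) + (x - p)))) + t * (x + x)) (sym (ι-suc J)))))

-- Energy of a labelling: growth under refinement, and range

∬-lin : ∀ a b (f g : Fin n → Fin m → ℚ) → ∬ (λ i j → a * f i j + b * g i j) ≡ a * ∬ f + b * ∬ g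
∬-lin a b f g = trans (∬-+ (λ i j → a * f i j) (λ i j → b * g i j)) (cong₂ _+_ (∬-*ˡ a f) (∬-*ˡ b g))

E-orth : ∀ (Q : Fin n → Fin k) g φ → Measurable Q φ → ∬ (λ u v → φ u v * (g u v - Average.E Q g u v)) ≡ 0ℚ
E-orth Q g φ meas = trans
  (∬-cong (λ u v → solve 3 (λ f y x → f :* (y :- x) := y :* f :- x :* f) refl (φ u v) (g u v) (Average.E Q g u v)))
  (trans (∬-- (λ u v → g u v * φ u v) (λ u v → Average.E Q g u v * φ u v))
    (trans (cong (λ t → ∬ (λ u v → g u v * φ u v) - t) (Average.E-adj Q g φ meas)) (+-inverseʳ (∬ (λ u v → g u v * φ u v)))))

module Energy {n k l : ℕ} (g : Fin n → Fin n → ℚ) (0≤g : ∀ u v → 0ℚ ≤ g u v) (g≤1 : ∀ u v → g u v ≤ 1ℚ)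
  (P : Fin n → Fin k) (Q : Fin n → Fin l) (Q≼P : Refines Q P) where

  private
    dP = Average.E P g
    dQ = Average.E Q g
    one : Fin n → Fin n → ℚ
    one _ _ = 1ℚ
    S = ∬ g
    N = ∬ one

  energy : ∀ {j} → ℕ → (Fin n → Fin j) → ℚ
  energy J R = ∬ (λ u v → Φ J (Average.E R g u v))

  -- This is `gap-≥` integrated. The tangent term has integral 0 because `Ψ J (dP u v)` is constant
  -- on the blocks of `P`, and the integral of 2(dP + p) is 4S.
  energy-gain : ∀ J {p τ} → 0ℚ ≤ p → 0ℚ ≤ τ → hf J ≤ p + p → p * N ≡ S →
    energy J P + (τ + τ) * ∬ (λ u v → pos (dP u v) (dQ u v)) ≤ energy J Q + τ * τ * ((S + S) + (S + S))
  energy-gain J {p} {τ} 0≤p 0≤τ hJ pN = begin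
    energy J P + (τ + τ) * ∬ (λ u v → pos (dP u v) (dQ u v))
      ≡⟨ sym (trans (∬-+ ΦP _) (cong (energy J P +_) (∬-*ˡ (τ + τ) (λ u v → pos (dP u v) (dQ u v))))) ⟩
    ∬ (λ u v → ΦP u v + (τ + τ) * pos (dP u v) (dQ u v))
      ≤⟨ ∬-mono pointwise ⟩
    ∬ (λ u v → ΦQ u v + (Ψ J (dP u v) * (dQ u v - dP u v) + τ * τ * ((dP u v + p) + (dP u v + p))))
      ≡⟨ trans (∬-+ ΦQ _) (cong (energy J Q +_) (trans (∬-+ (λ u v → Ψ J (dP u v) * (dQ u v - dP u v)) _)
           (trans (cong₂ _+_ (E-adj-diff Q≼P g (λ u v → Ψ J (dP u v)) (λ a b → cong (Ψ J) (Average.E-measurable P g a b)))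
              (∬-*ˡ (τ * τ) (λ u v → (dP u v + p) + (dP u v + p))))
             (trans (+-identityˡ _) (cong (τ * τ *_) sumP))))) ⟩
    energy J Q + τ * τ * ((S + S) + (S + S)) ∎
    where
    open ≤-Reasoning
    ΦP ΦQ : Fin n → Fin n → ℚ
    ΦP u v = Φ J (dP u v)
    ΦQ u v = Φ J (dQ u v)
    pointwise : ∀ u v → ΦP u v + (τ + τ) * pos (dP u v) (dQ u v) ≤
      ΦQ u v + (Ψ J (dP u v) * (dQ u v - dP u v) + τ * τ * ((dP u v + p) + (dP u v + p)))
    pointwise u v = ≤-trans (+-monoʳ-≤ (ΦP u v)
        (gap-≥ {x = dP u v} {y = dQ u v} J (Average.E-nonneg P 0≤g u v) (Average.E≤1 P g≤1 u v) 0≤p 0≤τ hJ))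
      (≤-reflexive (solve 4 (λ a b c d → a :+ ((b :- a :+ c) :+ d) := b :+ (c :+ d)) refl
        (ΦP u v) (ΦQ u v) (Ψ J (dP u v) * (dQ u v - dP u v)) (τ * τ * ((dP u v + p) + (dP u v + p)))))
    shift : ∬ (λ u v → dP u v + p) ≡ S + S
    shift = trans (∬-+ dP (λ _ _ → p)) (cong₂ _+_ (Average.∬-E P g)
      (trans (∬-cong {f = λ _ _ → p} {g = λ u v → p * one u v} (λ u v → sym (*-identityʳ p))) (trans (∬-*ˡ p one) pN)))
    sumP : ∬ (λ u v → (dP u v + p) + (dP u v + p)) ≡ (S + S) + (S + S)
    sumP = trans (∬-+ (λ u v → dP u v + p) (λ u v → dP u v + p)) (cong₂ _+_ shift shift)

  energy-range : ∀ J {p} → p * N ≡ S → energy J Q ≤ energy J P + (p * (N - S) + ι J * (S + S))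
  energy-range J {p} pN = begin
    energy J Q ≤⟨ ∬-mono (λ u v → Φ-range J p (Average.E-nonneg P 0≤g u v) (Average.E≤1 P g≤1 u v)
                    (Average.E-nonneg Q 0≤g u v) (Average.E≤1 Q g≤1 u v)) ⟩
    ∬ (λ u v → Φ J (dP u v) + A u v + ι J * (dP u v + dP u v))
      ≡⟨ trans (∬-+ (λ u v → Φ J (dP u v) + A u v) _)
          (cong₂ _+_ (trans (∬-+ (λ u v → Φ J (dP u v)) A) (cong (energy J P +_) sumA))
             (trans (∬-*ˡ (ι J) (λ u v → dP u v + dP u v)) (cong (ι J *_) (trans (∬-+ dP dP) (cong₂ _+_ ∬dP ∬dP))))) ⟩
    energy J P + p * (N - S) + ι J * (S + S)
      ≡⟨ +-assoc (energy J P) _ _ ⟩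
    energy J P + (p * (N - S) + ι J * (S + S)) ∎
    where
    open ≤-Reasoning
    q = 1ℚ - p
    A A' : Fin n → Fin n → ℚ
    A u v = (1ℚ - dQ u v) - q * (q - ((dP u v - p) + (dP u v - p)))
    A' u v = (1ℚ - q * (q + (p + p))) * one u v + (q + q) * dP u v
    ∬dP = Average.∬-E P g
    ∬dQ = Average.∬-E Q g
    sumA : ∬ A ≡ p * (N - S)
    sumA = trans (∬-cong (λ u v → solve 4 (λ x y p q → (con 1ℚ :- y) :- q :* (q :- ((x :- p) :+ (x :- p))) :=
              ((con 1ℚ :- q :* (q :+ (p :+ p))) :* con 1ℚ :+ (q :+ q) :* x) :- y) refl (dP u v) (dQ u v) p q))
      (trans (∬-- A' dQ) (trans (cong₂ _-_ (trans (∬-lin (1ℚ - q * (q + (p + p))) (q + q) one dP) (cong (λ t → (1ℚ - q * (q + (p + p))) * N + (q + q) * t) (trans ∬dP (sym pN))))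
           (trans ∬dQ (sym pN)))
        (trans (solve 2 (λ p N → ((con 1ℚ :- (con 1ℚ :- p) :* ((con 1ℚ :- p) :+ (p :+ p))) :* N :+ ((con 1ℚ :- p) :+ (con 1ℚ :- p)) :* (p :* N)) :- p :* N
             := p :* (N :- p :* N)) refl p N)
          (cong (λ t → p * (N - t)) pN))))

-- Adjusting the densities of a graph on the classes of a finer labelling

fraction : ℚ → ℚ → ℚ
fraction x y = x * inv y

-- If y is 0, so is x, and the default value of `inv` makes the identity hold; blocks without edges
-- thus need no case of their own.
fraction-* : 0ℚ ≤ x → x ≤ y → fraction x y * y ≡ x
fraction-* {x} {y} 0≤x x≤y with ≤-dec⊎ y 0ℚ
... | inj₂ 0<y = trans (solve 3 (λ x y i → x :* i :* y := x :* (y :* i)) refl x y (inv y))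
                  (trans (cong (x *_) (*-inv 0<y)) (*-identityʳ x))
... | inj₁ y≤0 with ≤-antisym 0≤x (≤-trans x≤y y≤0) | ≤-antisym (≤-trans 0≤x x≤y) y≤0
...   | refl | refl = refl

0≤fraction : 0ℚ ≤ x → x ≤ y → 0ℚ ≤ fraction x y
0≤fraction {x} {y} 0≤x x≤y with ≤-dec⊎ y 0ℚ
... | inj₂ 0<y = 0≤* 0≤x (<⇒≤ (0<inv 0<y))
... | inj₁ y≤0 with ≤-antisym 0≤x (≤-trans x≤y y≤0)
...   | refl = ≤-reflexive (sym (*-zeroˡ (inv y)))

fraction≤1 : 0ℚ ≤ x → x ≤ y → fraction x y ≤ 1ℚ
fraction≤1 {x} {y} 0≤x x≤y with ≤-dec⊎ y 0ℚ
... | inj₂ 0<y = *-cancel 0<y (subst₂ _≤_ (sym (trans (*-comm y _) (fraction-* 0≤x x≤y))) (sym (*-identityʳ y)) x≤y)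
... | inj₁ y≤0 with ≤-antisym 0≤x (≤-trans x≤y y≤0)
...   | refl = ≤-trans (≤-reflexive (*-zeroˡ (inv y))) 0≤1

rate sgn : ℚ → ℚ → ℚ
rate x y with x ≤? y
... | yes _ = fraction x y
... | no _ = fraction (1ℚ - x) (1ℚ - y)
sgn x y with x ≤? y
... | yes _ = 1ℚ
... | no _ = - 1ℚ

-- If e is 0 or 1, then adjust x y e is (x/y)e for x ≤ y, and 1 - ((1-x)/(1-y))(1-e) otherwise:
-- it moves the density y to x by rescaling either the edges or the non-edges.
adjust : ℚ → ℚ → ℚ → ℚ
adjust x y e = x + rate x y * (e - y)

*≤1 : 0ℚ ≤ y → x ≤ 1ℚ → y ≤ 1ℚ → x * y ≤ 1ℚ
*≤1 {y} {x} 0≤y x≤1 y≤1 = ≤-trans (*-monoˡ 0≤y x≤1) (≤-trans (≤-reflexive (*-identityˡ y)) y≤1)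

module _ (0≤x : 0ℚ ≤ x) (x≤1 : x ≤ 1ℚ) (0≤y : 0ℚ ≤ y) (y≤1 : y ≤ 1ℚ) where

  private
    lower : x ≤ y → ∀ e → x + fraction x y * (e - y) ≡ fraction x y * e
    lower x≤y e = trans (cong (_+ fraction x y * (e - y)) (sym (fraction-* 0≤x x≤y)))
      (solve 3 (λ f y e → f :* y :+ f :* (e :- y) := f :* e) refl (fraction x y) y e)
    upper : y ≤ x → ∀ e → x + fraction (1ℚ - x) (1ℚ - y) * (e - y) ≡ 1ℚ - fraction (1ℚ - x) (1ℚ - y) * (1ℚ - e)
    upper y≤x e = trans (solve 4 (λ x f e y → x :+ f :* (e :- y) := con 1ℚ :- (con 1ℚ :- x) :+ f :* (con 1ℚ :- y) :- f :* (con 1ℚ :- e)) refl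
        x f e y)
      (trans (cong (λ t → 1ℚ - (1ℚ - x) + t - f * (1ℚ - e)) (fraction-* (0≤diff x≤1) (≤-by (x - y) (0≤diff y≤x) (solve 2 (λ x y → con 1ℚ :- y := con 1ℚ :- x :+ (x :- y)) refl x y))))
        (solve 3 (λ x f e → con 1ℚ :- (con 1ℚ :- x) :+ (con 1ℚ :- x) :- f :* (con 1ℚ :- e) := con 1ℚ :- f :* (con 1ℚ :- e)) refl x f e))
      where f = fraction (1ℚ - x) (1ℚ - y)
    flip-≤ : y ≤ x → 1ℚ - x ≤ 1ℚ - y
    flip-≤ y≤x = +-monoʳ-≤ 1ℚ (neg-antimono-≤ y≤x)

  private
    Unit : ℚ → Set
    Unit t = 0ℚ ≤ t × t ≤ 1ℚ
    complement : ∀ {t} → Unit t → Unit (1ℚ - t)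
    complement {t} (a , c) = 0≤diff c , ≤-by t a (solve 1 (λ z → con 1ℚ := con 1ℚ :- z :+ z) refl t)

  adjust-bounds : ∀ b → 0ℚ ≤ adjust x y (χ b) × adjust x y (χ b) ≤ 1ℚ
  adjust-bounds b with x ≤? y
  ... | yes x≤y = subst Unit (sym (lower x≤y (χ b)))
        (0≤* (0≤fraction 0≤x x≤y) (0≤χ b) , *≤1 (0≤χ b) (fraction≤1 0≤x x≤y) (χ≤1 b))
  ... | no x≰y = subst Unit (sym (upper (<⇒≤ (≰⇒> x≰y)) (χ b))) (complement
        (0≤* (0≤fraction (0≤diff x≤1) le) (proj₁ χ̄) , *≤1 (proj₁ χ̄) (fraction≤1 (0≤diff x≤1) le) (proj₂ χ̄)))
    where
    le = flip-≤ (<⇒≤ (≰⇒> x≰y))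
    χ̄ = complement (0≤χ b , χ≤1 b)

  private
    AdjustSign : Bool → ℚ → ℚ → Set
    AdjustSign b s t = (t - χ b) * (1ℚ - (χ b + χ b)) ≡ s * (χ b - t)

  -- Within a block all entries move the same way: edges are lowered if x ≤ y, non-edges are raised
  -- otherwise. So the distance from the 0/1 value is a sign that depends only on the block, times
  -- the displacement, and integrates to the change of density.
  adjust-sign : ∀ b → (adjust x y (χ b) - χ b) * (1ℚ - (χ b + χ b)) ≡ sgn x y * (χ b - adjust x y (χ b))
  adjust-sign b with x ≤? y
  ... | yes x≤y = subst (AdjustSign b 1ℚ) (sym (lower x≤y (χ b))) (go b (fraction x y))
    where
    go : ∀ b f → AdjustSign b 1ℚ (f * χ b)
    go true = solve 1 (λ f → (f :* con 1ℚ :- con 1ℚ) :* (con 1ℚ :- (con 1ℚ :+ con 1ℚ)) := con 1ℚ :* (con 1ℚ :- f :* con 1ℚ)) refl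
    go false = solve 1 (λ f → (f :* con 0ℚ :- con 0ℚ) :* (con 1ℚ :- (con 0ℚ :+ con 0ℚ)) := con 1ℚ :* (con 0ℚ :- f :* con 0ℚ)) refl
  ... | no x≰y = subst (AdjustSign b (- 1ℚ)) (sym (upper (<⇒≤ (≰⇒> x≰y)) (χ b))) (go b (fraction (1ℚ - x) (1ℚ - y)))
    where
    go : ∀ b f → AdjustSign b (- 1ℚ) (1ℚ - f * (1ℚ - χ b))
    go true = solve 1 (λ f → (con 1ℚ :- f :* (con 1ℚ :- con 1ℚ) :- con 1ℚ) :* (con 1ℚ :- (con 1ℚ :+ con 1ℚ)) := con (- 1ℚ) :* (con 1ℚ :- (con 1ℚ :- f :* (con 1ℚ :- con 1ℚ)))) refl
    go false = solve 1 (λ f → (con 1ℚ :- f :* (con 1ℚ :- con 0ℚ) :- con 0ℚ) :* (con 1ℚ :- (con 0ℚ :+ con 0ℚ)) := con (- 1ℚ) :* (con 0ℚ :- (con 1ℚ :- f :* (con 1ℚ :- con 0ℚ)))) refl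

-- The left side is |y - x|. The summand y - x on the right integrates to 0 when x and y are
-- averages of the same function.
sgn-diff : ∀ x y → sgn x y * (y - x) ≡ (pos x y + pos x y) + (y - x)
sgn-diff x y with x ≤? y
... | yes x≤y rewrite pos-≤ x≤y = solve 1 (λ z → con 1ℚ :* z := (con 0ℚ :+ con 0ℚ) :+ z) refl (y - x)
... | no x≰y rewrite pos-≥ (<⇒≤ (≰⇒> x≰y)) = solve 2 (λ x y → con (- 1ℚ) :* (y :- x) := ((x :- y) :+ (x :- y)) :+ (y :- x)) refl x y

module Adjust {n k : ℕ} (A : Fin n → Fin n → Bool) (P : Fin n → Fin k) where

  g dP flipₛ : Fin n → Fin n → ℚ
  g u v = χ (A u v)
  dP = Average.E P g
  -- On [0,1]-valued W the distance ∬|W - g| is the linear functional ∬(W - g)·flipₛ.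
  flipₛ u v = 1ℚ - (g u v + g u v)

  flipₛ-sq : ∀ u v → flipₛ u v * flipₛ u v ≤ 1ℚ
  flipₛ-sq u v with A u v
  ... | true = ≤-refl
  ... | false = ≤-refl

  -- A possible target of the descent: it has the averages of `dP` on the blocks of `R` (`orth`) and
  -- lies within 2κ of `g` (`near`).
  record Balanced {l} (R : Fin n → Fin l) (κ : ℚ) (W : Fin n → Fin n → ℚ) : Set where
    field
      0≤W : ∀ u v → 0ℚ ≤ W u v
      W≤1 : ∀ u v → W u v ≤ 1ℚ
      orth : ∀ φ → Measurable R φ → ∬ (λ u v → (W u v - dP u v) * φ u v) ≡ 0ℚ
      near : ∬ (λ u v → (W u v - g u v) * flipₛ u v) ≤ κ + κ

  -- Rescaling the blocks of `R` to the densities of `P` costs the integral of |dR - dP|. This is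
  -- twice the integral of the positive part of dP - dR, since `dR` and `dP` have the same integral;
  -- hence 2κ.
  balanced : ∀ {l} (R : Fin n → Fin l) → Refines R P → ∀ {κ} →
    ∬ (λ u v → pos (dP u v) (Average.E R g u v)) ≤ κ → Σ _ (Balanced R κ)
  balanced R R≼P {κ} hκ = W , record
    { 0≤W = λ u v → proj₁ (bounds u v)
    ; W≤1 = λ u v → proj₂ (bounds u v)
    ; orth = orth
    ; near = ≤-trans (≤-reflexive near) (+-mono-≤ hκ hκ) }
    where
    dR = Average.E R g
    W r σ : Fin n → Fin n → ℚ
    W u v = adjust (dP u v) (dR u v) (g u v)
    r u v = rate (dP u v) (dR u v)
    σ u v = sgn (dP u v) (dR u v)
    P-meas = Average.E-measurable P g
    R-meas = Average.E-measurable R g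
    dP-meas : Measurable R dP
    dP-meas = Measurable-refine {P = P} {R} {dP} R≼P P-meas
    ge0 : ∀ {l} (R : Fin n → Fin l) u v → 0ℚ ≤ Average.E R g u v
    ge0 R = Average.E-nonneg R (λ u v → 0≤χ (A u v))
    le1 : ∀ {l} (R : Fin n → Fin l) u v → Average.E R g u v ≤ 1ℚ
    le1 R = Average.E≤1 R (λ u v → χ≤1 (A u v))
    bounds = λ u v → adjust-bounds (ge0 P u v) (le1 P u v) (ge0 R u v) (le1 R u v) (A u v)
    orth : ∀ φ → Measurable R φ → ∬ (λ u v → (W u v - dP u v) * φ u v) ≡ 0ℚ
    orth φ meas = trans (∬-cong (λ u v → solve 5 (λ x r e y f → (x :+ r :* (e :- y) :- x) :* f := r :* f :* (e :- y)) refl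
        (dP u v) (r u v) (g u v) (dR u v) (φ u v)))
      (E-orth R g (λ u v → r u v * φ u v) (λ a b → cong₂ _*_ (cong₂ rate (dP-meas a b) (R-meas a b)) (meas a b)))
    loss : ℚ
    loss = ∬ (λ u v → pos (dP u v) (dR u v))
    near : ∬ (λ u v → (W u v - g u v) * flipₛ u v) ≡
      loss + loss
    near = begin
      ∬ (λ u v → (W u v - g u v) * flipₛ u v)
        ≡⟨ ∬-cong (λ u v → adjust-sign (ge0 P u v) (le1 P u v) (ge0 R u v) (le1 R u v) (A u v)) ⟩
      ∬ (λ u v → σ u v * (g u v - W u v))
        ≡⟨ ∬-cong (λ u v → solve 5 (λ s e x r y → s :* (e :- (x :+ r :* (e :- y))) := s :* (con 1ℚ :- r) :* (e :- y) :+ s :* (y :- x)) refl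
             (σ u v) (g u v) (dP u v) (r u v) (dR u v)) ⟩
      ∬ (λ u v → σ u v * (1ℚ - r u v) * (g u v - dR u v) + σ u v * (dR u v - dP u v))
        ≡⟨ trans (∬-+ (λ u v → σ u v * (1ℚ - r u v) * (g u v - dR u v)) _)
             (cong₂ _+_ (E-orth R g (λ u v → σ u v * (1ℚ - r u v))
                (λ a b → cong₂ _*_ (cong₂ sgn (dP-meas a b) (R-meas a b)) (cong (λ t → 1ℚ - t) (cong₂ rate (dP-meas a b) (R-meas a b)))))
              (∬-cong (λ u v → sgn-diff (dP u v) (dR u v)))) ⟩
      0ℚ + ∬ (λ u v → (pos (dP u v) (dR u v) + pos (dP u v) (dR u v)) + (dR u v - dP u v))
        ≡⟨ trans (+-identityˡ _) (trans (∬-+ (λ u v → pos (dP u v) (dR u v) + pos (dP u v) (dR u v)) _)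
             (cong₂ _+_ (∬-+ (λ u v → pos (dP u v) (dR u v)) _)
               (trans (∬-- dR dP) (trans (cong₂ _-_ (Average.∬-E R g) (Average.∬-E P g)) (+-inverseʳ (∬ g)))))) ⟩
      loss + loss + 0ℚ
        ≡⟨ +-identityʳ _ ⟩
      loss + loss ∎
      where open ≡-Reasoning

-- Projected descent in [0,1]-valued functions

clip : ℚ → ℚ
clip z = (z ⊔ 0ℚ) ⊓ 1ℚ

0≤clip : ∀ z → 0ℚ ≤ clip z
0≤clip z = ⊓-glb (p≤q⊔p z 0ℚ) 0≤1

clip≤1 : ∀ z → clip z ≤ 1ℚ
clip≤1 z = p⊓q≤q (z ⊔ 0ℚ) 1ℚ

clip-contract : ∀ z → 0ℚ ≤ w → w ≤ 1ℚ → (clip z - w) * (clip z - w) ≤ (z - w) * (z - w)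
clip-contract {w} z 0≤w w≤1 with ≤-total z 0ℚ
... | inj₁ z≤0 rewrite p≤q⇒p⊔q≡q z≤0 | p≤q⇒p⊓q≡p 0≤1 = ≤-by (z * z + ((- z) * w + (- z) * w))
       (0≤+ (0≤sq z) (0≤+ (0≤* (neg-antimono-≤ z≤0) 0≤w) (0≤* (neg-antimono-≤ z≤0) 0≤w)))
       (solve 2 (λ z w → (z :- w) :* (z :- w) := (con 0ℚ :- w) :* (con 0ℚ :- w) :+ (z :* z :+ ((:- z) :* w :+ (:- z) :* w))) refl z w)
... | inj₂ 0≤z rewrite p≥q⇒p⊔q≡p 0≤z with ≤-total z 1ℚ
...   | inj₁ z≤1 rewrite p≤q⇒p⊓q≡p z≤1 = ≤-refl
...   | inj₂ 1≤z rewrite p≥q⇒p⊓q≡q 1≤z = ≤-by ((z - 1ℚ) * (z - 1ℚ) + ((z - 1ℚ) * (1ℚ - w) + (z - 1ℚ) * (1ℚ - w)))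
       (0≤+ (0≤sq (z - 1ℚ)) (0≤+ (0≤* (0≤diff 1≤z) (0≤diff w≤1)) (0≤* (0≤diff 1≤z) (0≤diff w≤1))))
       (solve 2 (λ z w → (z :- w) :* (z :- w) := (con 1ℚ :- w) :* (con 1ℚ :- w) :+ ((z :- con 1ℚ) :* (z :- con 1ℚ) :+ ((z :- con 1ℚ) :* (con 1ℚ :- w) :+ (z :- con 1ℚ) :* (con 1ℚ :- w)))) refl z w)

-- Before clipping, the cross term gains at least 2c·cN and the quadratic term costs at most c²N.
-- Clipping is the projection to [0,1], where W* lies, so it does not increase the distance.
descent : ∀ c (W W* φ : Fin n → Fin m → ℚ) → 0ℚ ≤ c → (∀ u v → 0ℚ ≤ W* u v) → (∀ u v → W* u v ≤ 1ℚ) →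
  (∀ u v → φ u v * φ u v ≤ 1ℚ) → c * ∬ {n} {m} (λ _ _ → 1ℚ) ≤ ∬ (λ u v → (W u v - W* u v) * φ u v) →
  ∬ (λ u v → (clip (W u v - c * φ u v) - W* u v) * (clip (W u v - c * φ u v) - W* u v)) + c * c * ∬ {n} {m} (λ _ _ → 1ℚ)
    ≤ ∬ (λ u v → (W u v - W* u v) * (W u v - W* u v))
descent {n} {m} c W W* φ 0≤c 0≤W* W*≤1 φ²≤1 corr = begin
  ∬ (λ u v → (clip (W u v - c * φ u v) - W* u v) * (clip (W u v - c * φ u v) - W* u v)) + c * c * N
    ≤⟨ +-monoˡ-≤ (c * c * N) (∬-mono pointwise) ⟩
  ∬ (λ u v → D u v * D u v + (- (c + c) * (D u v * φ u v) + c * c * 1ℚ)) + c * c * N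
    ≡⟨ cong (_+ c * c * N) (trans (∬-+ (λ u v → D u v * D u v) _)
         (cong (∬ (λ u v → D u v * D u v) +_) (∬-lin (- (c + c)) (c * c) (λ u v → D u v * φ u v) (λ _ _ → 1ℚ)))) ⟩
  ∬ (λ u v → D u v * D u v) + (- (c + c) * K + c * c * N) + c * c * N
    ≤⟨ ≤-by ((c + c) * (K - c * N)) (0≤* (0≤+ 0≤c 0≤c) (0≤diff corr))
         (solve 4 (λ d c K N → d := d :+ (:- (c :+ c) :* K :+ c :* c :* N) :+ c :* c :* N :+ (c :+ c) :* (K :- c :* N)) refl (∬ (λ u v → D u v * D u v)) c K N) ⟩
  ∬ (λ u v → D u v * D u v) ∎
  where
  open ≤-Reasoning
  N = ∬ {n} {m} (λ _ _ → 1ℚ)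
  D : Fin n → Fin m → ℚ
  D u v = W u v - W* u v
  K = ∬ (λ u v → D u v * φ u v)
  pointwise : ∀ u v → (clip (W u v - c * φ u v) - W* u v) * (clip (W u v - c * φ u v) - W* u v) ≤
    D u v * D u v + (- (c + c) * (D u v * φ u v) + c * c * 1ℚ)
  pointwise u v = ≤-trans (clip-contract (W u v - c * φ u v) (0≤W* u v) (W*≤1 u v))
    (≤-by (c * c * (1ℚ - φ u v * φ u v)) (0≤* (0≤sq c) (0≤diff (φ²≤1 u v)))
      (solve 4 (λ W w c f → (W :- w) :* (W :- w) :+ (:- (c :+ c) :* ((W :- w) :* f) :+ c :* c :* con 1ℚ) :=
         (W :- c :* f :- w) :* (W :- c :* f :- w) :+ c :* c :* (con 1ℚ :- f :* f)) refl (W u v) (W* u v) c (φ u v)))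

-- Sizes of vertex sets

size-cong : {X Y : VSet n} → (∀ v → X v ≡ Y v) → size X ≡ size Y
size-cong {zero}  h = refl
size-cong {suc n} h = cong₂ ℕ._+_ (cong (λ b → if b then 1 else 0) (h 0F)) (size-cong (h ∘ Fin.suc))

size-mono : {X Y : VSet n} → X ⊆ Y → size X ℕ.≤ size Y
size-mono {zero} h = z≤n
size-mono {suc n} {X} {Y} h = ℕP.+-mono-≤ (head (X 0F) (Y 0F) (h 0F)) (size-mono (h ∘ Fin.suc))
  where
  head : ∀ a b → (a ≡ true → b ≡ true) → (if a then 1 else 0) ℕ.≤ (if b then 1 else 0)
  head false b h = z≤n
  head true b h rewrite h refl = ℕP.≤-refl

size-split : (S X : VSet n) → size (λ v → S v ∧ X v) ℕ.+ size (λ v → S v ∧ not (X v)) ≡ size S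
size-split {zero} S X = refl
size-split {suc n} S X with S 0F | X 0F | size-split (S ∘ Fin.suc) (X ∘ Fin.suc)
... | true | true | h = cong suc h
... | true | false | h = trans (ℕP.+-suc _ _) (cong suc h)
... | false | _ | h = h

size-full : ∀ n → size {n} (λ _ → true) ≡ n
size-full zero = refl
size-full (suc n) = cong suc (size-full n)

size-empty : ∀ n → size {n} (λ _ → false) ≡ 0
size-empty zero = refl
size-empty (suc n) = size-empty n

subset-of-size : ∀ t (S : VSet n) → t ℕ.≤ size S → Σ (VSet n) λ T → T ⊆ S × size T ≡ t
subset-of-size {n} zero S _ = (λ _ → false) , (λ _ ()) , size-empty n
subset-of-size {suc n} (suc t) S h with S 0F in eq
... | false with subset-of-size (suc t) (S ∘ Fin.suc) h
...   | T , T⊆S , |T| = (λ { 0F → false ; (Fin.suc i) → T i }) , (λ { 0F () ; (Fin.suc i) → T⊆S i }) , |T|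
subset-of-size {suc n} (suc t) S (s≤s h) | true with subset-of-size t (S ∘ Fin.suc) h
...   | T , T⊆S , |T| = (λ { 0F → true ; (Fin.suc i) → T i }) , (λ { 0F _ → eq ; (Fin.suc i) → T⊆S i }) , cong suc |T|

∧-true : ∀ {a b} → a ∧ b ≡ true → a ≡ true × b ≡ true
∧-true {true} {true} _ = refl , refl

-- Taking elements of X first leaves at most one mixed cell when S is cut up: once a cell has
-- exhausted X, the remaining vertices avoid it.
subset-preferring : ∀ t (S X : VSet n) → t ℕ.≤ size S →
  Σ (VSet n) λ T → T ⊆ S × size T ≡ t × (T ⊆ X ⊎ (λ v → S v ∧ X v) ⊆ T)
subset-preferring t S X h with ℕP.≤-total t (size (λ v → S v ∧ X v))
... | inj₁ t≤ with subset-of-size t (λ v → S v ∧ X v) t≤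
...   | T , T⊆ , |T| = T , (λ v e → proj₁ (∧-true (T⊆ v e))) , |T| , inj₁ (λ v e → proj₂ (∧-true {S v} (T⊆ v e)))
subset-preferring {n} t S X h | inj₂ ≤t with subset-of-size (t ℕ.∸ size (λ v → S v ∧ X v)) (λ v → S v ∧ not (X v))
    (ℕP.≤-trans (ℕP.∸-monoˡ-≤ (size (λ v → S v ∧ X v)) (ℕP.≤-trans h (ℕP.≤-reflexive (sym (size-split S X)))))
      (ℕP.≤-reflexive (ℕP.m+n∸m≡n (size (λ v → S v ∧ X v)) _)))
...   | T' , T'⊆ , |T'| = T , T⊆S , |T| , inj₂ (λ v e → cong (_∨ T' v) e)
  where
  T : VSet n
  T v = (S v ∧ X v) ∨ T' v
  T⊆S : T ⊆ S
  T⊆S v e with S v in s | X v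
  ... | true | _ = refl
  ... | false | _ = trans (sym s) (proj₁ (∧-true (T'⊆ v e)))
  T∩X : ∀ v → T v ∧ X v ≡ S v ∧ X v
  T∩X v with S v | X v | T' v | T'⊆ v
  ... | true | true | _ | _ = refl
  ... | false | _ | false | _ = refl
  ... | false | _ | true | q = ⊥-elim (case q refl of λ ())
  ... | true | false | false | _ = refl
  ... | true | false | true | _ = refl
  T∖X : ∀ v → T v ∧ not (X v) ≡ T' v
  T∖X v with S v | X v | T' v | T'⊆ v
  ... | true | true | false | _ = refl
  ... | true | true | true | q = ⊥-elim (case q refl of λ ())
  ... | false | _ | false | _ = refl
  ... | false | _ | true | q = ⊥-elim (case q refl of λ ())
  ... | true | false | false | _ = refl
  ... | true | false | true | _ = refl
  |T| : size T ≡ t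
  |T| = trans (sym (size-split T X)) (trans (cong₂ ℕ._+_ (size-cong T∩X) (trans (size-cong T∖X) |T'|)) (ℕP.m+[n∸m]≡n ≤t))

cell : VSet n → (Fin n → Fin k) → Fin k → VSet n
cell S c i v = S v ∧ ⌊ c v Fin.≟ i ⌋

-- `hit` marks the cells that are counted as part of X. The error is that of a single cell, however
-- many cells there are.
record Chunks {n} (S X : VSet n) (b t : ℕ) : Set where
  field
    label : Fin n → Fin b
    hit   : Fin b → Bool
    lower : ∀ i → t ℕ.≤ size (cell S label i)
    upper : ∀ i → size (cell S label i) ℕ.≤ suc t
    error : size (λ v → S v ∧ (X v xor hit (label v))) ℕ.≤ suc t

-- The remainder r is the number of cells of size t + 1. It may equal the number of cells: a class
-- of size m + 1, with m one less than a multiple of that number, has to be split with the same t as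
-- a class of size m.
chunks : ∀ b t r (S X : VSet n) → r ℕ.≤ suc b → size S ≡ suc b ℕ.* t ℕ.+ r → Chunks S X (suc b) t
chunks {n} zero t r S X r≤1 |S| = record
  { label = λ _ → 0F
  ; hit = λ _ → false
  ; lower = λ { 0F → ℕP.≤-trans (ℕP.≤-trans (ℕP.m≤m+n t r) (ℕP.≤-reflexive (sym |S|'))) (ℕP.≤-reflexive (size-cong whole)) }
  ; upper = λ { 0F → ℕP.≤-trans (ℕP.≤-reflexive (sym (size-cong whole))) S≤ }
  ; error = ℕP.≤-trans (size-mono (λ v e → proj₁ (∧-true {S v} e))) S≤ }
  where
  |S|' : size S ≡ t ℕ.+ r
  |S|' = trans |S| (cong (ℕ._+ r) (ℕP.+-identityʳ t))
  whole : ∀ v → S v ≡ S v ∧ true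
  whole v with S v
  ... | true = refl
  ... | false = refl
  S≤ : size S ℕ.≤ suc t
  S≤ = ℕP.≤-trans (ℕP.≤-reflexive |S|') (ℕP.≤-trans (ℕP.+-monoʳ-≤ t r≤1) (ℕP.≤-reflexive (ℕP.+-comm t 1)))
chunks {n} (suc b) t r S X r≤ |S| = go r r≤ |S|
  where
  extend : ∀ τ r' → t ℕ.≤ τ → τ ℕ.≤ suc t → r' ℕ.≤ suc b → size S ≡ τ ℕ.+ (suc b ℕ.* t ℕ.+ r') → Chunks S X (suc (suc b)) t
  extend τ r' t≤τ τ≤ r'≤ eq with subset-preferring τ S X (ℕP.≤-trans (ℕP.m≤m+n τ _) (ℕP.≤-reflexive (sym eq)))
  ... | T , T⊆S , |T| , pref = record
    { label = label'
    ; hit = hit' pref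
    ; lower = λ { 0F → ℕP.≤-trans t≤τ (ℕP.≤-reflexive (sym |cell₀|)) ; (Fin.suc i) → ℕP.≤-trans (rec.lower i) (ℕP.≤-reflexive (sym (|cell| i))) }
    ; upper = λ { 0F → ℕP.≤-trans (ℕP.≤-reflexive |cell₀|) τ≤ ; (Fin.suc i) → ℕP.≤-trans (ℕP.≤-reflexive (|cell| i)) (rec.upper i) }
    ; error = error' pref }
    where
    S' : VSet n
    S' v = S v ∧ not (T v)
    S∩T : ∀ v → S v ∧ T v ≡ T v
    S∩T v with S v in s | T v | T⊆S v
    ... | true | true | _ = refl
    ... | true | false | _ = refl
    ... | false | false | _ = refl
    ... | false | true | q = trans (sym s) (trans s (q refl))
    |S'| : size S' ≡ suc b ℕ.* t ℕ.+ r'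
    |S'| = ℕP.+-cancelˡ-≡ τ _ _ (trans (cong (ℕ._+ size S') (sym (trans (size-cong S∩T) |T|))) (trans (size-split S T) eq))
    module rec = Chunks (chunks b t r' S' X r'≤ |S'|)
    label' : Fin n → Fin (suc (suc b))
    label' v = if T v then 0F else Fin.suc (rec.label v)
    hit' : T ⊆ X ⊎ (λ v → S v ∧ X v) ⊆ T → Fin (suc (suc b)) → Bool
    hit' (inj₁ _) 0F = true
    hit' (inj₁ _) (Fin.suc i) = rec.hit i
    -- This cell contains all that is left of X and may be mixed. Declaring every cell a miss puts
    -- all errors inside it.
    hit' (inj₂ _) _ = false
    |cell₀| : size (cell S label' 0F) ≡ τ
    |cell₀| = trans (size-cong eq₀) |T|
      where
      eq₀ : ∀ v → cell S label' 0F v ≡ T v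
      eq₀ v with T v | S∩T v
      ... | true | q = q
      ... | false | q = q
    |cell| : ∀ i → size (cell S label' (Fin.suc i)) ≡ size (cell S' rec.label i)
    |cell| i = size-cong eq₁
      where
      eq₁ : ∀ v → cell S label' (Fin.suc i) v ≡ cell S' rec.label i v
      eq₁ v with T v | S v
      ... | true | true = refl
      ... | true | false = refl
      ... | false | false = refl
      ... | false | true with rec.label v Fin.≟ i
      ...   | yes _ = refl
      ...   | no _ = refl
    error' : ∀ q → size (λ v → S v ∧ (X v xor hit' q (label' v))) ℕ.≤ suc t
    error' (inj₁ T⊆X) = ℕP.≤-trans (ℕP.≤-reflexive (size-cong eq₂)) rec.error
      where
      eq₂ : ∀ v → S v ∧ (X v xor hit' (inj₁ T⊆X) (label' v)) ≡ S' v ∧ (X v xor rec.hit (rec.label v))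
      eq₂ v with T v | S v | X v | T⊆X v
      ... | true | true | true | _ = refl
      ... | true | true | false | q = case q refl of λ ()
      ... | true | false | _ | _ = refl
      ... | false | true | _ | _ = refl
      ... | false | false | _ | _ = refl
    error' (inj₂ X⊆T) = ℕP.≤-trans (size-mono sub) (ℕP.≤-trans (ℕP.≤-reflexive |T|) τ≤)
      where
      sub : ∀ v → S v ∧ (X v xor false) ≡ true → T v ≡ true
      sub v e with S v | X v | X⊆T v
      ... | true | true | q = q refl
  go : ∀ r → r ℕ.≤ suc (suc b) → size S ≡ suc (suc b) ℕ.* t ℕ.+ r → Chunks S X (suc (suc b)) t
  go zero _ eq = extend t 0 ℕP.≤-refl (ℕP.n≤1+n t) z≤n (trans eq (ℕP.+-assoc t (suc b ℕ.* t) 0))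
  go (suc r') (s≤s h) eq = extend (suc t) r' (ℕP.n≤1+n t) ℕP.≤-refl h
    (trans eq (trans (ℕP.+-suc (suc (suc b) ℕ.* t) r') (cong suc (ℕP.+-assoc t (suc b ℕ.* t) r'))))

-- Equitable labellings and their equitable refinements

Equi : ℕ → (Fin n → Fin k) → Set
Equi m P = ∀ j → m ℕ.≤ size (part P j) × size (part P j) ℕ.≤ suc m

∑-same : ∀ (j : Fin k) → ∑ (λ i → same j i) ≡ 1ℚ
∑-same {suc k} 0F = cong (1ℚ +_) (∑-zero k)
∑-same {suc k} (Fin.suc j) = trans (+-identityˡ _) (trans (∑-cong shift) (∑-same j))
  where
  shift : ∀ i → same (Fin.suc j) (Fin.suc i) ≡ same j i
  shift i with j Fin.≟ i
  ... | yes _ = refl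
  ... | no _ = refl

χ-∧ : ∀ a b → χ (a ∧ b) ≡ χ a * χ b
χ-∧ true b = sym (*-identityˡ (χ b))
χ-∧ false b = sym (*-zeroˡ (χ b))

∑-parts : (P : Fin n → Fin k) (Z : VSet n) → ∑ (λ i → ι (size (λ v → part P i v ∧ Z v))) ≡ ι (size Z)
∑-parts P Z = begin
  ∑ (λ i → ι (size (λ v → part P i v ∧ Z v)))
    ≡⟨ ∑-cong (λ i → trans (ι-count (λ v → part P i v ∧ Z v)) (∑-cong (λ v → χ-∧ (part P i v) (Z v)))) ⟩
  ∑ (λ i → ∑ (λ v → same (P v) i * χ (Z v))) ≡⟨ ∑-swap (λ i v → same (P v) i * χ (Z v)) ⟩
  ∑ (λ v → ∑ (λ i → same (P v) i * χ (Z v)))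
    ≡⟨ ∑-cong (λ v → trans (∑-*ʳ (same (P v)) (χ (Z v))) (trans (cong (_* χ (Z v)) (∑-same (P v))) (*-identityˡ _))) ⟩
  ∑ (λ v → χ (Z v)) ≡⟨ sym (ι-count Z) ⟩
  ι (size Z) ∎
  where open ≡-Reasoning

parts-≤ : (P : Fin n → Fin k) (Z : VSet n) → ∀ c → (∀ i → size (λ v → part P i v ∧ Z v) ℕ.≤ c) → size Z ℕ.≤ k ℕ.* c
parts-≤ {k = k} P Z c h = ι-reflect-≤ (subst₂ _≤_ (∑-parts P Z) (trans (∑-const k (ι c)) (sym (ι-* k c)))
  (∑-mono (λ i → ι-mono (h i))))

∧-identityʳ' : ∀ b → b ∧ true ≡ b
∧-identityʳ' true = refl
∧-identityʳ' false = refl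

≤-parts : (P : Fin n → Fin k) → ∀ c → (∀ i → c ℕ.≤ size (part P i)) → k ℕ.* c ℕ.≤ n
≤-parts {n} {k} P c h = ι-reflect-≤ (subst₂ _≤_ (trans (∑-const k (ι c)) (sym (ι-* k c)))
  (trans (∑-parts P (λ _ → true)) (cong ι (size-full n)))
  (∑-mono (λ i → ι-mono (ℕP.≤-trans (h i) (ℕP.≤-reflexive (size-cong (λ v → sym (∧-identityʳ' (part P i v)))))))))

Equi-n≤ : ∀ {P : Fin n → Fin k} → Equi m P → n ℕ.≤ k ℕ.* suc m
Equi-n≤ {n} {k} {m} {P} eq = subst (ℕ._≤ k ℕ.* suc m) (size-full n) (parts-≤ P (λ _ → true) (suc m)
  (λ i → ℕP.≤-trans (ℕP.≤-reflexive (size-cong (λ v → ∧-identityʳ' (part P i v)))) (proj₂ (eq i))))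

record Refinement {n k} (R : Fin n → Fin k) (b : ℕ) (X : VSet n) : Set where
  field
    {t}     : ℕ
    R'      : Fin n → Fin (k ℕ.* b)
    equi    : Equi (suc t) R'
    refines : Refines R' R
    hit     : Fin (k ℕ.* b) → Bool
    error   : b ℕ.* size (λ v → X v xor hit (R' v)) ℕ.≤ 2 ℕ.* n

-- With t the integral part of m/b, classes of both sizes m and m + 1 split into cells of sizes t
-- and t + 1. The lower bound on n forces m ≥ b, so t ≥ 1. A class has at most t + 1 ≤ 2t errors,
-- and b times the total is at most 2kbt ≤ 2km ≤ 2n.
refine : ∀ b {R : Fin n → Fin k} (X : VSet n) → Equi m R → 2 ℕ.* (k ℕ.* suc b) ℕ.≤ n → Refinement R (suc b) X
refine {n} {k} {m} b' {R} X eq big = record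
  { R' = R'
  ; equi = λ j → let i = proj₁ (Fin.remQuot {k} b j) in subst (λ s → s ℕ.≤ size (part R' j) × size (part R' j) ℕ.≤ suc s) (sym (suc-pred-t i)) (equi' j)
  ; refines = λ u v e → proj₁ (FinP.combine-injective (R u) (C.label (R u) u) (R v) (C.label (R v) v) e)
  ; hit = hit'
  ; error = err }
  where
  b t : ℕ
  b = suc b'
  t = m ℕ./ b
  comm : ∀ x y z → x ℕ.* (y ℕ.* z) ≡ y ℕ.* (x ℕ.* z)
  comm x y z = trans (sym (ℕP.*-assoc x y z)) (trans (cong (ℕ._* z) (ℕP.*-comm x y)) (ℕP.*-assoc y x z))
  b≤m : Fin k → b ℕ.≤ m
  b≤m i = ℕP.≤-pred (ℕP.≤-trans (ℕP.≤-trans (ℕP.+-monoʳ-≤ 1 (ℕP.m≤n+m b b'))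
         (ℕP.≤-reflexive (cong (b ℕ.+_) (sym (ℕP.+-identityʳ b)))))
         (ℕP.*-cancelˡ-≤ k {{FinP.nonZeroIndex i}} (ℕP.≤-trans (ℕP.≤-reflexive (comm k 2 b)) (ℕP.≤-trans big (Equi-n≤ eq)))))
  0<t : Fin k → 1 ℕ.≤ t
  0<t i = ℕP.≤-trans (ℕP.≤-reflexive (sym (n/n≡1 b))) (/-monoˡ-≤ b (b≤m i))
  suc-pred-t : Fin k → suc (ℕ.pred t) ≡ t
  suc-pred-t i = ℕP.suc-pred t {{ℕ.>-nonZero (0<t i)}}
  m≡ : m ≡ b ℕ.* t ℕ.+ m ℕ.% b
  m≡ = trans (m≡m%n+[m/n]*n m b) (trans (ℕP.+-comm (m ℕ.% b) _) (cong (ℕ._+ m ℕ.% b) (ℕP.*-comm t b)))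
  pieces : ∀ i → Chunks (part R i) X b t
  pieces i with ℕP.m≤n⇒m<n∨m≡n (proj₁ (eq i))
  ... | inj₂ m≡s = chunks b' t (m ℕ.% b) (part R i) X (ℕP.<⇒≤ (m%n<n m b)) (trans (sym m≡s) m≡)
  ... | inj₁ m<s = chunks b' t (suc (m ℕ.% b)) (part R i) X (m%n<n m b)
        (trans (ℕP.≤-antisym (proj₂ (eq i)) m<s) (trans (cong suc m≡) (sym (ℕP.+-suc (b ℕ.* t) (m ℕ.% b)))))
  module C i = Chunks (pieces i)
  R' : Fin n → Fin (k ℕ.* b)
  R' v = Fin.combine (R v) (C.label (R v) v)
  hit₂ : Fin k × Fin b → Bool
  hit₂ (i , l) = C.hit i l
  hit' : Fin (k ℕ.* b) → Bool
  hit' j = hit₂ (Fin.remQuot b j)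
  hit-R' : ∀ v → hit' (R' v) ≡ C.hit (R v) (C.label (R v) v)
  hit-R' v = cong hit₂ (FinP.remQuot-combine (R v) (C.label (R v) v))
  part-R' : ∀ i l v → part R' (Fin.combine i l) v ≡ cell (part R i) (C.label i) l v
  part-R' i l v with R v Fin.≟ i
  part-R' i l v | no R≢i with R' v Fin.≟ Fin.combine i l
  ... | no _ = refl
  ... | yes e = ⊥-elim (R≢i (proj₁ (FinP.combine-injective (R v) _ i l e)))
  part-R' i l v | yes refl with R' v Fin.≟ Fin.combine (R v) l | C.label (R v) v Fin.≟ l
  ... | yes _ | yes _ = refl
  ... | no _ | no _ = refl
  ... | yes e | no q = ⊥-elim (q (proj₂ (FinP.combine-injective (R v) _ (R v) l e)))
  ... | no q | yes e = ⊥-elim (q (cong (Fin.combine (R v)) e))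
  equi' : Equi t R'
  equi' j = subst (λ j → t ℕ.≤ size (part R' j) × size (part R' j) ℕ.≤ suc t) (FinP.combine-remQuot {k} b j)
      (ℕP.≤-trans (C.lower i q) (ℕP.≤-reflexive (sym (size-cong (part-R' i q)))) ,
       ℕP.≤-trans (ℕP.≤-reflexive (size-cong (part-R' i q))) (C.upper i q))
    where
    i = proj₁ (Fin.remQuot {k} b j)
    q = proj₂ (Fin.remQuot {k} b j)
  local-error : ∀ i → size (λ v → part R i v ∧ (X v xor hit' (R' v))) ℕ.≤ 2 ℕ.* t
  local-error i = ℕP.≤-trans (ℕP.≤-reflexive (size-cong same-error)) (ℕP.≤-trans (C.error i)
      (ℕP.≤-trans (ℕP.+-monoˡ-≤ t (0<t i)) (ℕP.≤-reflexive (cong (t ℕ.+_) (sym (ℕP.+-identityʳ t))))))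
    where
    same-error : ∀ v → part R i v ∧ (X v xor hit' (R' v)) ≡ part R i v ∧ (X v xor C.hit i (C.label i v))
    same-error v with R v Fin.≟ i
    ... | no _ = refl
    ... | yes refl = cong (X v xor_) (hit-R' v)
  err : b ℕ.* size (λ v → X v xor hit' (R' v)) ℕ.≤ 2 ℕ.* n
  err = begin
    b ℕ.* size (λ v → X v xor hit' (R' v)) ≤⟨ ℕP.*-monoʳ-≤ b (parts-≤ R (λ v → X v xor hit' (R' v)) (2 ℕ.* t) local-error) ⟩
    b ℕ.* (k ℕ.* (2 ℕ.* t)) ≡⟨ trans (cong (b ℕ.*_) (comm k 2 t)) (trans (comm b 2 (k ℕ.* t)) (cong (2 ℕ.*_) (comm b k t))) ⟩
    2 ℕ.* (k ℕ.* (b ℕ.* t)) ≤⟨ ℕP.*-monoʳ-≤ 2 (ℕP.*-monoʳ-≤ k (ℕP.≤-trans (ℕP.≤-reflexive (ℕP.*-comm b t)) (m/n*n≤m m b))) ⟩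
    2 ℕ.* (k ℕ.* m) ≤⟨ ℕP.*-monoʳ-≤ 2 (≤-parts R m (λ i → proj₁ (eq i))) ⟩
    2 ℕ.* n ∎
    where open ℕP.≤-Reasoning

-- Rounding a [0,1]-valued matrix to a 0/1 matrix

sq-≤1 : 0ℚ ≤ w → w ≤ 1ℚ → ∀ b → (χ b - w) * (χ b - w) ≤ 1ℚ
sq-≤1 {w} 0≤w w≤1 true = ≤-by (w * (1ℚ - w) + w) (0≤+ (0≤* 0≤w (0≤diff w≤1)) 0≤w)
  (solve 1 (λ w → con 1ℚ := (con 1ℚ :- w) :* (con 1ℚ :- w) :+ (w :* (con 1ℚ :- w) :+ w)) refl w)
sq-≤1 {w} 0≤w w≤1 false = ≤-by (w * (1ℚ - w) + (1ℚ - w)) (0≤+ (0≤* 0≤w (0≤diff w≤1)) (0≤diff w≤1))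
  (solve 1 (λ w → con 1ℚ := (con 0ℚ :- w) :* (con 0ℚ :- w) :+ (w :* (con 1ℚ :- w) :+ (con 1ℚ :- w))) refl w)

sq*sq≤1 : ∀ x y → x * x ≤ 1ℚ → y * y ≤ 1ℚ → (x * y) * (x * y) ≤ 1ℚ
sq*sq≤1 x y hx hy = ≤-trans (≤-reflexive (solve 2 (λ x y → (x :* y) :* (x :* y) := (x :* x) :* (y :* y)) refl x y))
  (≤-trans (*-monoˡ (0≤sq y) hx) (≤-trans (≤-reflexive (*-identityˡ (y * y))) hy))

-- Each entry is rounded in the direction that does not increase the cross term.
opposing-bit : 0ℚ ≤ w → w ≤ 1ℚ → ∀ s → Σ Bool λ b → (χ b - w) * s ≤ 0ℚ
opposing-bit {w} 0≤w w≤1 s with ≤-total 0ℚ s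
... | inj₁ 0≤s = false , diff≤ (subst (0ℚ ≤_) (solve 2 (λ w s → w :* s := con 0ℚ :- (con 0ℚ :- w) :* s) refl w s) (0≤* 0≤w 0≤s))
... | inj₂ s≤0 = true , diff≤ (subst (0ℚ ≤_) (solve 2 (λ w s → (con 1ℚ :- w) :* (:- s) := con 0ℚ :- (con 1ℚ :- w) :* s) refl w s)
      (0≤* (0≤diff w≤1) (neg-antimono-≤ s≤0)))

-- The bit of each entry opposes the current cross term, so the entry adds to each of the m squares,
-- in total, only its own square, at most 1. Independent random rounding gives the same bound on
-- average.
round-row : (z : Fin m → Fin n → ℚ) → (∀ j k → z j k * z j k ≤ 1ℚ) → (w : Fin n → ℚ) → (∀ k → 0ℚ ≤ w k) → (∀ k → w k ≤ 1ℚ) →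
  (c : Fin m → ℚ) → Σ (Fin n → Bool) λ h →
  ∑ (λ j → (c j + ∑ (λ k → (χ (h k) - w k) * z j k)) * (c j + ∑ (λ k → (χ (h k) - w k) * z j k))) ≤ ∑ (λ j → c j * c j) + ι n * ι m
round-row {m} {zero} z z≤1 w 0≤w w≤1 c rewrite ι-0 = (λ ()) , ≤-reflexive (trans
  (∑-cong (λ j → cong₂ _*_ (+-identityʳ (c j)) (+-identityʳ (c j))))
  (solve 2 (λ s m → s := s :+ con 0ℚ :* m) refl (∑ (λ j → c j * c j)) (ι m)))
round-row {m} {suc n} z z≤1 w 0≤w w≤1 c with opposing-bit (0≤w 0F) (w≤1 0F) (∑ (λ j → c j * z j 0F))
... | b , opp with round-row (λ j → z j ∘ Fin.suc) (λ j → z≤1 j ∘ Fin.suc) (w ∘ Fin.suc) (0≤w ∘ Fin.suc) (w≤1 ∘ Fin.suc)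
                     (λ j → c j + (χ b - w 0F) * z j 0F)
...   | h , ih = h' , (begin
  ∑ (λ j → (c j + (a * z₀ j + r j)) * (c j + (a * z₀ j + r j)))
    ≡⟨ ∑-cong (λ j → cong (λ t → t * t) (sym (+-assoc (c j) (a * z₀ j) (r j)))) ⟩
  ∑ (λ j → (c' j + r j) * (c' j + r j))
    ≤⟨ ih ⟩
  ∑ (λ j → c' j * c' j) + ι n * ι m
    ≤⟨ +-monoˡ-≤ (ι n * ι m) (∑-mono expand) ⟩
  ∑ (λ j → c j * c j + ((a + a) * (c j * z₀ j) + 1ℚ)) + ι n * ι m
    ≡⟨ cong (_+ ι n * ι m) (trans (∑-+ (λ j → c j * c j) _) (cong (C +_) (trans (∑-+ (λ j → (a + a) * (c j * z₀ j)) _)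
         (cong₂ _+_ (∑-*ˡ (a + a) (λ j → c j * z₀ j)) (trans (∑-const m 1ℚ) (*-identityʳ (ι m))))))) ⟩
  C + ((a + a) * s + ι m) + ι n * ι m
    ≤⟨ +-monoˡ-≤ (ι n * ι m) (+-monoʳ-≤ C (+-monoˡ-≤ (ι m) cross)) ⟩
  C + (0ℚ + ι m) + ι n * ι m
    ≡⟨ solve 3 (λ C n m → C :+ (con 0ℚ :+ m) :+ n :* m := C :+ (con 1ℚ :+ n) :* m) refl C (ι n) (ι m) ⟩
  C + (1ℚ + ι n) * ι m
    ≡⟨ cong (λ t → C + t * ι m) (sym (ι-suc n)) ⟩
  C + ι (suc n) * ι m ∎)
  where
  open ≤-Reasoning
  a = χ b - w 0F
  C = ∑ (λ j → c j * c j)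
  z₀ : Fin m → ℚ
  z₀ j = z j 0F
  s = ∑ (λ j → c j * z₀ j)
  c' r : Fin m → ℚ
  c' j = c j + a * z₀ j
  r j = ∑ (λ k → (χ (h k) - w (Fin.suc k)) * z j (Fin.suc k))
  h' : Fin (suc n) → Bool
  h' 0F = b
  h' (Fin.suc k) = h k
  cross : (a + a) * s ≤ 0ℚ
  cross = ≤-trans (≤-reflexive (*-distribʳ-+ s a a)) (+-mono-≤ opp opp)
  expand : ∀ j → c' j * c' j ≤ c j * c j + ((a + a) * (c j * z₀ j) + 1ℚ)
  expand j = ≤-trans (≤-reflexive (solve 3 (λ c a z → (c :+ a :* z) :* (c :+ a :* z) := c :* c :+ ((a :+ a) :* (c :* z) :+ (a :* z) :* (a :* z))) refl (c j) a (z₀ j)))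
    (+-monoʳ-≤ (c j * c j) (+-monoʳ-≤ ((a + a) * (c j * z₀ j)) (sq*sq≤1 a (z₀ j) (sq-≤1 (0≤w 0F) (w≤1 0F) b) (z≤1 j 0F))))

⟨_,_⟩ : (Fin n → ℚ) → (Fin n → ℚ) → ℚ
⟨ f , g ⟩ = ∑ (λ k → f k * g k)

-- The sum of the squared inner products of distinct rows; it controls M on all rectangles.
offdiag : (Fin m → Fin n → ℚ) → ℚ
offdiag {zero} M = 0ℚ
offdiag {suc m} M = ∑ (λ j → ⟨ M 0F , M (Fin.suc j) ⟩ * ⟨ M 0F , M (Fin.suc j) ⟩) + offdiag (M ∘ Fin.suc)

-- Rows are rounded from the last to the first. A new row is made almost orthogonal to the error
-- rows already fixed, and also to one extra row `s 0F`, whose coefficient starts at the sum over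
-- the fixed rows. The extra row controls the number of edits along with the rectangles.
round-matrix : (W s : Fin m → Fin n → ℚ) → (∀ i k → 0ℚ ≤ W i k) → (∀ i k → W i k ≤ 1ℚ) → (∀ i k → s i k * s i k ≤ 1ℚ) →
  Σ (Fin m → Fin n → Bool) λ H → let M = λ i k → χ (H i k) - W i k; e = ∬ (λ i k → M i k * s i k) in
  offdiag M + e * e ≤ ι n * (ι m * ι m)
round-matrix {zero} {n} W s 0≤W W≤1 s≤1 rewrite ι-0 = (λ ()) , ≤-reflexive (sym (trans (cong (ι n *_) (*-zeroˡ 0ℚ)) (*-zeroʳ (ι n))))
round-matrix {suc m} {n} W s 0≤W W≤1 s≤1 with round-matrix (W ∘ Fin.suc) (s ∘ Fin.suc) (0≤W ∘ Fin.suc) (W≤1 ∘ Fin.suc) (s≤1 ∘ Fin.suc)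
... | H , ih with round-row rows z≤1 (W 0F) (0≤W 0F) (W≤1 0F) c
  where
  rows : Fin (suc m) → Fin n → ℚ
  rows 0F = s 0F
  rows (Fin.suc j) k = χ (H j k) - W (Fin.suc j) k
  z≤1 : ∀ j k → rows j k * rows j k ≤ 1ℚ
  z≤1 0F k = s≤1 0F k
  z≤1 (Fin.suc j) k = sq-≤1 (0≤W (Fin.suc j) k) (W≤1 (Fin.suc j) k) (H j k)
  c : Fin (suc m) → ℚ
  c 0F = ∬ (λ i k → (χ (H i k) - W (Fin.suc i) k) * s (Fin.suc i) k)
  c (Fin.suc j) = 0ℚ
...   | h , row = H' , (begin
  D + O + (p + e) * (p + e)
    ≡⟨ solve 4 (λ D O p e → D :+ O :+ (p :+ e) :* (p :+ e) := ((e :+ p) :* (e :+ p) :+ D) :+ O) refl D O p e ⟩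
  ((e + p) * (e + p) + D) + O
    ≡⟨ cong (λ t → (e + p) * (e + p) + t + O) (∑-cong {m} (λ j → cong (λ t → t * t) (sym (+-identityˡ ⟨ M₀ , M j ⟩)))) ⟩
  ((e + p) * (e + p) + ∑ (λ j → (0ℚ + ⟨ M₀ , M j ⟩) * (0ℚ + ⟨ M₀ , M j ⟩))) + O
    ≤⟨ +-monoˡ-≤ O row ⟩
  (e * e + ∑ {m} (λ _ → 0ℚ * 0ℚ)) + ι n * ι (suc m) + O
    ≡⟨ cong (λ t → (e * e + t) + ι n * ι (suc m) + O) (∑-zero m) ⟩
  (e * e + 0ℚ) + ι n * ι (suc m) + O
    ≡⟨ solve 4 (λ e n m O → (e :* e :+ con 0ℚ) :+ n :* m :+ O := (O :+ e :* e) :+ n :* m) refl e (ι n) (ι (suc m)) O ⟩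
  (O + e * e) + ι n * ι (suc m)
    ≤⟨ +-mono-≤ ih (≤-reflexive (cong (ι n *_) (ι-suc m))) ⟩
  ι n * (ι m * ι m) + ι n * (1ℚ + ι m)
    ≤⟨ ≤-by (ι n * ι m) (0≤* (0≤ι n) (0≤ι m))
        (solve 2 (λ n m → n :* ((con 1ℚ :+ m) :* (con 1ℚ :+ m)) := n :* (m :* m) :+ n :* (con 1ℚ :+ m) :+ n :* m) refl (ι n) (ι m)) ⟩
  ι n * ((1ℚ + ι m) * (1ℚ + ι m))
    ≡⟨ cong (λ t → ι n * (t * t)) (sym (ι-suc m)) ⟩
  ι n * (ι (suc m) * ι (suc m)) ∎)
  where
  open ≤-Reasoning
  H' : Fin (suc m) → Fin n → Bool
  H' 0F = h
  H' (Fin.suc j) = H j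
  M : Fin m → Fin n → ℚ
  M j k = χ (H j k) - W (Fin.suc j) k
  M₀ : Fin n → ℚ
  M₀ k = χ (h k) - W 0F k
  D = ∑ (λ j → ⟨ M₀ , M j ⟩ * ⟨ M₀ , M j ⟩)
  O = offdiag M
  p = ⟨ M₀ , s 0F ⟩
  e = ∬ (λ i k → M i k * s (Fin.suc i) k)

-- From almost orthogonal rows to small rectangle sums

combination : (Fin m → ℚ) → (Fin m → Fin n → ℚ) → Fin n → ℚ
combination x M k = ∑ (λ i → x i * M i k)

⟨,⟩-combination : ∀ f (x : Fin m → ℚ) (M : Fin m → Fin n → ℚ) → ⟨ f , combination x M ⟩ ≡ ∑ (λ j → x j * ⟨ f , M j ⟩)
⟨,⟩-combination f x M = trans (∑-cong (λ k → sym (∑-*ˡ (f k) (λ i → x i * M i k))))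
  (trans (∑-swap (λ k i → f k * (x i * M i k)))
    (∑-cong (λ i → trans (∑-cong (λ k → solve 3 (λ a b c → a :* (b :* c) := b :* (a :* c)) refl (f k) (x i) (M i k))) (∑-*ˡ (x i) (λ k → f k * M i k)))))

am-gm : ∀ τ a s → s * s ≤ 1ℚ → (τ + τ) * (s * a) ≤ τ * τ + a * a
am-gm τ a s hs = ≤-by ((τ - s * a) * (τ - s * a) + a * a * (1ℚ - s * s)) (0≤+ (0≤sq (τ - s * a)) (0≤* (0≤sq a) (0≤diff hs)))
  (solve 3 (λ τ a s → τ :* τ :+ a :* a := (τ :+ τ) :* (s :* a) :+ ((τ :- s :* a) :* (τ :- s :* a) :+ a :* a :* (con 1ℚ :- s :* s))) refl τ a s)

-- Diagonal terms contribute at most n per row. Off the diagonal, 2τ|a| ≤ τ² + a² for every inner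
-- product a takes the place of Cauchy-Schwarz; τ is chosen in `rounding`.
combination-norm : ∀ τ → 0ℚ ≤ τ → (x : Fin m → ℚ) → (∀ i → x i * x i ≤ 1ℚ) → (M : Fin m → Fin n → ℚ) → (∀ i k → M i k * M i k ≤ 1ℚ) →
  τ * ⟨ combination x M , combination x M ⟩ ≤ τ * (ι m * ι n) + ι m * ι m * (τ * τ) + offdiag M
combination-norm {zero} {n} τ 0≤τ x x≤1 M M≤1 rewrite ι-0 = ≤-reflexive (trans (cong (τ *_) (trans (∑-cong {n} (λ _ → *-zeroˡ 0ℚ)) (∑-zero n)))
  (solve 2 (λ τ n → τ :* con 0ℚ := τ :* (con 0ℚ :* n) :+ con 0ℚ :* con 0ℚ :* (τ :* τ) :+ con 0ℚ) refl τ (ι n)))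
combination-norm {suc m} {n} τ 0≤τ x x≤1 M M≤1 = begin
  τ * ∑ (λ k → (x₀ * M₀ k + S k) * (x₀ * M₀ k + S k))
    ≤⟨ *-monoʳ 0≤τ (∑-mono expand) ⟩
  τ * ∑ (λ k → 1ℚ + ((x₀ + x₀) * (M₀ k * S k) + S k * S k))
    ≡⟨ cong (τ *_) (trans (∑-+ {n} (λ _ → 1ℚ) _) (cong₂ _+_ (trans (∑-const n 1ℚ) (*-identityʳ (ι n)))
         (trans (∑-+ (λ k → (x₀ + x₀) * (M₀ k * S k)) _) (cong (_+ ⟨ S , S ⟩) (trans (∑-*ˡ (x₀ + x₀) (λ k → M₀ k * S k))
            (cong ((x₀ + x₀) *_) (⟨,⟩-combination M₀ (x ∘ Fin.suc) (M ∘ Fin.suc)))))))) ⟩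
  τ * (ι n + ((x₀ + x₀) * ∑ (λ j → x (Fin.suc j) * a j) + ⟨ S , S ⟩))
    ≡⟨ solve 5 (λ τ n x q s → τ :* (n :+ ((x :+ x) :* q :+ s)) := τ :* n :+ (((τ :+ τ) :* x) :* q :+ τ :* s)) refl τ (ι n) x₀ _ _ ⟩
  τ * ι n + (((τ + τ) * x₀) * ∑ (λ j → x (Fin.suc j) * a j) + τ * ⟨ S , S ⟩)
    ≤⟨ +-monoʳ-≤ (τ * ι n) (+-mono-≤ cross (combination-norm τ 0≤τ (x ∘ Fin.suc) (x≤1 ∘ Fin.suc) (M ∘ Fin.suc) (M≤1 ∘ Fin.suc))) ⟩
  τ * ι n + ((ι m * (τ * τ) + A) + (τ * (ι m * ι n) + ι m * ι m * (τ * τ) + O))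
    ≤⟨ ≤-by ((ι m + 1ℚ) * (τ * τ)) (0≤* (0≤+ (0≤ι m) 0≤1) (0≤sq τ))
        (solve 5 (λ τ n m A O → τ :* ((con 1ℚ :+ m) :* n) :+ (con 1ℚ :+ m) :* (con 1ℚ :+ m) :* (τ :* τ) :+ (A :+ O) :=
           τ :* n :+ ((m :* (τ :* τ) :+ A) :+ (τ :* (m :* n) :+ m :* m :* (τ :* τ) :+ O)) :+ (m :+ con 1ℚ) :* (τ :* τ)) refl τ (ι n) (ι m) A O) ⟩
  τ * ((1ℚ + ι m) * ι n) + (1ℚ + ι m) * (1ℚ + ι m) * (τ * τ) + (A + O)
    ≡⟨ cong (λ t → τ * (t * ι n) + t * t * (τ * τ) + (A + O)) (sym (ι-suc m)) ⟩
  τ * (ι (suc m) * ι n) + ι (suc m) * ι (suc m) * (τ * τ) + offdiag M ∎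
  where
  open ≤-Reasoning
  x₀ = x 0F
  M₀ S : Fin n → ℚ
  M₀ = M 0F
  S = combination (x ∘ Fin.suc) (M ∘ Fin.suc)
  a : Fin m → ℚ
  a j = ⟨ M₀ , M (Fin.suc j) ⟩
  A = ∑ (λ j → a j * a j)
  O = offdiag (M ∘ Fin.suc)
  expand : ∀ k → (x₀ * M₀ k + S k) * (x₀ * M₀ k + S k) ≤ 1ℚ + ((x₀ + x₀) * (M₀ k * S k) + S k * S k)
  expand k = ≤-trans (≤-reflexive (solve 3 (λ x m s → (x :* m :+ s) :* (x :* m :+ s) := (x :* m) :* (x :* m) :+ ((x :+ x) :* (m :* s) :+ s :* s)) refl x₀ (M₀ k) (S k)))
    (+-monoˡ-≤ ((x₀ + x₀) * (M₀ k * S k) + S k * S k) (sq*sq≤1 x₀ (M₀ k) (x≤1 0F) (M≤1 0F k)))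
  cross : ((τ + τ) * x₀) * ∑ (λ j → x (Fin.suc j) * a j) ≤ ι m * (τ * τ) + A
  cross = begin
    ((τ + τ) * x₀) * ∑ (λ j → x (Fin.suc j) * a j) ≡⟨ sym (∑-*ˡ ((τ + τ) * x₀) (λ j → x (Fin.suc j) * a j)) ⟩
    ∑ (λ j → ((τ + τ) * x₀) * (x (Fin.suc j) * a j))
      ≤⟨ ∑-mono (λ j → ≤-trans (≤-reflexive (solve 4 (λ τ x y a → ((τ :+ τ) :* x) :* (y :* a) := (τ :+ τ) :* ((x :* y) :* a)) refl τ x₀ (x (Fin.suc j)) (a j)))
            (am-gm τ (a j) (x₀ * x (Fin.suc j)) (sq*sq≤1 x₀ (x (Fin.suc j)) (x≤1 0F) (x≤1 (Fin.suc j))))) ⟩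
    ∑ (λ j → τ * τ + a j * a j) ≡⟨ trans (∑-+ {m} (λ _ → τ * τ) _) (cong (_+ A) (∑-const m (τ * τ))) ⟩
    ι m * (τ * τ) + A ∎

sq-cancel-≤ : 0ℚ ≤ y → x * x ≤ y * y → x ≤ y
sq-cancel-≤ {y} {x} 0≤y h with ≤-dec⊎ x y
... | inj₁ x≤y = x≤y
... | inj₂ y<x = ⊥-elim (<-irrefl refl (<-≤-trans (≤-<-trans (*-monoʳ 0≤y (<⇒≤ y<x)) (*-monoˡ-<-pos x {{ℚ.positive (≤-<-trans 0≤y y<x)}} y<x)) h))

0≤offdiag : (M : Fin m → Fin n → ℚ) → 0ℚ ≤ offdiag M
0≤offdiag {zero} M = ≤-refl
0≤offdiag {suc m} M = 0≤+ (∑-nonneg (λ j → 0≤sq ⟨ M 0F , M (Fin.suc j) ⟩)) (0≤offdiag (M ∘ Fin.suc))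

record Rounding {n} (M : ℕ) (W s : Fin n → Fin n → ℚ) : Set where
  field
    H   : Fin n → Fin n → Bool
    cut : ∀ (x y : Fin n → ℚ) → (∀ i → x i * x i ≤ 1ℚ) → (∀ i → y i * y i ≤ 1ℚ) →
          ι M * ∬ (λ i k → (χ (H i k) - W i k) * (x i * y k)) ≤ ι n * ι n
    sum : ι M * ∬ (λ i k → (χ (H i k) - W i k) * s i k) ≤ ι n * ι n

-- The squared norm of a combination of error rows with coefficients in [-1,1] is at most n³/M², and
-- Cauchy-Schwarz over the n columns turns this into n²/M. The condition 6M⁴ ≤ n pays for the terms
-- of order M⁴n² in the norm.
rounding : ∀ M → 1 ℕ.≤ M → 6 ℕ.* (M ℕ.* M ℕ.* (M ℕ.* M)) ℕ.≤ n → (W s : Fin n → Fin n → ℚ) →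
  (∀ i k → 0ℚ ≤ W i k) → (∀ i k → W i k ≤ 1ℚ) → (∀ i k → s i k * s i k ≤ 1ℚ) → Rounding M W s
rounding {n} M 1≤M 6M⁴≤n W s 0≤W W≤1 s≤1 with round-matrix W s 0≤W W≤1 s≤1
... | H , hyp = record { H = H ; cut = cut ; sum = sum }
  where
  μ ν ν³ e O : ℚ
  D : Fin n → Fin n → ℚ
  μ = ι M
  ν = ι n
  ν³ = ν * (ν * ν)
  D i k = χ (H i k) - W i k
  e = ∬ (λ i k → D i k * s i k)
  O = offdiag D
  D≤1 : ∀ i k → D i k * D i k ≤ 1ℚ
  D≤1 i k = sq-≤1 (0≤W i k) (W≤1 i k) (H i k)
  1≤μ : 1ℚ ≤ μ
  1≤μ = subst (_≤ μ) ι-1 (ι-mono 1≤M)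
  0≤μ = ≤-trans 0≤1 1≤μ
  0≤ν = 0≤ι n
  6μ⁴≤ν : ℕ→ℚ 6 * (μ * μ * (μ * μ)) ≤ ν
  6μ⁴≤ν = subst (_≤ ν) (trans (ι-* 6 (M ℕ.* M ℕ.* (M ℕ.* M))) (cong₂ _*_ (ι≡ 6) (trans (ι-* (M ℕ.* M) (M ℕ.* M)) (cong₂ _*_ (ι-* M M) (ι-* M M))))) (ι-mono 6M⁴≤n)
  μ²≤μ⁴ : μ * μ ≤ μ * μ * (μ * μ)
  μ²≤μ⁴ = ≤-trans (≤-reflexive (sym (*-identityʳ (μ * μ)))) (*-monoʳ (0≤sq μ) (*-mono 0≤1 0≤μ 1≤μ 1≤μ))
  0≤μ⁴ = 0≤sq (μ * μ)
  sum : μ * e ≤ ν * ν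
  sum = sq-cancel-≤ (0≤sq ν) (begin
    (μ * e) * (μ * e) ≡⟨ solve 2 (λ μ e → (μ :* e) :* (μ :* e) := (μ :* μ) :* (e :* e)) refl μ e ⟩
    (μ * μ) * (e * e) ≤⟨ *-mono (0≤sq μ) (0≤* 0≤ν (0≤sq ν)) (≤-trans μ²≤μ⁴ (≤-trans (≤-by (ℕ→ℚ 5 * (μ * μ * (μ * μ))) (0≤* (<⇒≤ (positive⁻¹ (ℕ→ℚ 5))) 0≤μ⁴)
                             (solve 1 (λ t → con (ℕ→ℚ 6) :* t := t :+ con (ℕ→ℚ 5) :* t) refl (μ * μ * (μ * μ)))) 6μ⁴≤ν))
                             (≤-trans (≤-by O (0≤offdiag D) (+-comm O (e * e))) hyp) ⟩
    ν * ν³ ≡⟨ solve 1 (λ ν → ν :* (ν :* (ν :* ν)) := (ν :* ν) :* (ν :* ν)) refl ν ⟩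
    (ν * ν) * (ν * ν) ∎)
    where open ≤-Reasoning
  module _ (x y : Fin n → ℚ) (x≤1 : ∀ i → x i * x i ≤ 1ℚ) (y≤1 : ∀ i → y i * y i ≤ 1ℚ) where
    S : Fin n → ℚ
    S = combination x D
    q T : ℚ
    q = ⟨ S , S ⟩
    T = ∬ (λ i k → D i k * (x i * y k))
    T≡ : T ≡ ∑ (λ k → y k * S k)
    T≡ = trans (∑-swap (λ i k → D i k * (x i * y k)))
      (∑-cong (λ k → trans (∑-cong (λ i → solve 3 (λ d x y → d :* (x :* y) := y :* (x :* d)) refl (D i k) (x i) (y k))) (∑-*ˡ (y k) (λ i → x i * D i k))))
    -- With this τ the norm estimate reads 3μ²q ≤ 12μ⁴ν² + ν³ ≤ 3ν³.
    τ = ℕ→ℚ 3 * (μ * μ)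
    norm : μ * μ * q ≤ ν³
    norm = *-cancel {ℕ→ℚ 3} (positive⁻¹ (ℕ→ℚ 3)) (begin
      ℕ→ℚ 3 * (μ * μ * q) ≡⟨ sym (*-assoc (ℕ→ℚ 3) (μ * μ) q) ⟩
      τ * q ≤⟨ combination-norm τ (0≤* (<⇒≤ (positive⁻¹ (ℕ→ℚ 3))) (0≤sq μ)) x x≤1 D D≤1 ⟩
      τ * (ν * ν) + ν * ν * (τ * τ) + O
        ≤⟨ +-mono-≤ first O≤ν³ ⟩
      ν * ν * (ℕ→ℚ 12 * (μ * μ * (μ * μ))) + ν³
        ≤⟨ +-monoˡ-≤ ν³ (*-monoʳ (0≤sq ν) (≤-trans (≤-reflexive (solve 1 (λ t → con (ℕ→ℚ 12) :* t := con (ℕ→ℚ 6) :* t :+ con (ℕ→ℚ 6) :* t) refl (μ * μ * (μ * μ)))) (+-mono-≤ 6μ⁴≤ν 6μ⁴≤ν))) ⟩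
      ν * ν * (ν + ν) + ν³ ≡⟨ solve 1 (λ ν → ν :* ν :* (ν :+ ν) :+ ν :* (ν :* ν) := con (ℕ→ℚ 3) :* (ν :* (ν :* ν))) refl ν ⟩
      ℕ→ℚ 3 * ν³ ∎)
      where
      open ≤-Reasoning
      first : τ * (ν * ν) + ν * ν * (τ * τ) ≤ ν * ν * (ℕ→ℚ 12 * (μ * μ * (μ * μ)))
      first = ≤-by (ℕ→ℚ 3 * (ν * ν * (μ * μ * (μ * μ) - μ * μ)))
        (0≤* (<⇒≤ (positive⁻¹ (ℕ→ℚ 3))) (0≤* (0≤sq ν) (0≤diff μ²≤μ⁴)))
        (solve 2 (λ ν m → ν :* ν :* (con (ℕ→ℚ 12) :* (m :* m)) := con (ℕ→ℚ 3) :* m :* (ν :* ν) :+ ν :* ν :* (con (ℕ→ℚ 3) :* m :* (con (ℕ→ℚ 3) :* m)) :+ con (ℕ→ℚ 3) :* (ν :* ν :* (m :* m :- m))) refl ν (μ * μ))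
      O≤ν³ : O ≤ ν³
      O≤ν³ = ≤-trans (≤-by {x = O} (e * e) (0≤sq e) refl) hyp
    doubled : (ν + ν) * (μ * T) ≤ (ν + ν) * (ν * ν)
    doubled = begin
      (ν + ν) * (μ * T) ≡⟨ cong (λ t → (ν + ν) * (μ * t)) T≡ ⟩
      (ν + ν) * (μ * ∑ (λ k → y k * S k)) ≡⟨ trans (sym (*-assoc (ν + ν) μ _)) (sym (∑-*ˡ ((ν + ν) * μ) (λ k → y k * S k))) ⟩
      ∑ (λ k → (ν + ν) * μ * (y k * S k))
        ≤⟨ ∑-mono (λ k → ≤-trans (≤-reflexive (solve 4 (λ ν μ y s → (ν :+ ν) :* μ :* (y :* s) := (ν :+ ν) :* (y :* (μ :* s))) refl ν μ (y k) (S k))) (am-gm ν (μ * S k) (y k) (y≤1 k))) ⟩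
      ∑ (λ k → ν * ν + (μ * S k) * (μ * S k))
        ≡⟨ trans (∑-+ {n} (λ _ → ν * ν) _) (cong₂ _+_ (∑-const n (ν * ν)) (trans (∑-cong (λ k → solve 2 (λ μ s → (μ :* s) :* (μ :* s) := μ :* μ :* (s :* s)) refl μ (S k))) (∑-*ˡ (μ * μ) (λ k → S k * S k)))) ⟩
      ν³ + μ * μ * q ≤⟨ +-monoʳ-≤ ν³ norm ⟩
      ν³ + ν³ ≡⟨ sym (*-distribʳ-+ (ν * ν) ν ν) ⟩
      (ν + ν) * (ν * ν) ∎
      where open ≤-Reasoning
    0<ν : 0ℚ < ν
    0<ν = <-≤-trans (0<* {ℕ→ℚ 6} {μ * μ * (μ * μ)} (positive⁻¹ (ℕ→ℚ 6)) (0<* {μ * μ} {μ * μ} 0<μ² 0<μ²)) 6μ⁴≤ν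
      where
      0<μ = <-≤-trans 0<1 1≤μ
      0<μ² = 0<* {μ} {μ} 0<μ 0<μ
    cut : μ * T ≤ ν * ν
    cut = *-cancel {ν + ν} {μ * T} {ν * ν} (<-≤-trans 0<ν (≤-by ν 0≤ν refl)) doubled

-- Violated cuts

sg : Bool → ℚ
sg true = 1ℚ
sg false = - 1ℚ

cutφ : Bool → VSet n → VSet n → Fin n → Fin n → ℚ
cutφ σ X Y u v = sg σ * (χ (X u) * χ (Y v))

cutφ-cong : ∀ σ {X Y : VSet n} {u u' v v'} → X u ≡ X u' → Y v ≡ Y v' → cutφ σ X Y u v ≡ cutφ σ X Y u' v'
cutφ-cong σ p q rewrite p | q = refl

sg-sq : ∀ σ → sg σ * sg σ ≤ 1ℚ
sg-sq true = ≤-refl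
sg-sq false = ≤-refl

χ-sq : ∀ b → χ b * χ b ≤ 1ℚ
χ-sq true = ≤-refl
χ-sq false = 0≤1

cutφ-sq : ∀ σ (X Y : VSet n) u v → cutφ σ X Y u v * cutφ σ X Y u v ≤ 1ℚ
cutφ-sq σ X Y u v = sq*sq≤1 (sg σ) (χ (X u) * χ (Y v)) (sg-sq σ) (sq*sq≤1 (χ (X u)) (χ (Y v)) (χ-sq (X u)) (χ-sq (Y v)))

Within1 : ℚ → Set
Within1 d = d ≤ 1ℚ × - d ≤ 1ℚ

within1-diff : 0ℚ ≤ x → x ≤ 1ℚ → 0ℚ ≤ y → y ≤ 1ℚ → Within1 (x - y)
within1-diff {x} {y} 0≤x x≤1 0≤y y≤1 =
  ≤-by ((1ℚ - x) + y) (0≤+ (0≤diff x≤1) 0≤y) (solve 2 (λ x y → con 1ℚ := (x :- y) :+ ((con 1ℚ :- x) :+ y)) refl x y) ,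
  ≤-by ((1ℚ - y) + x) (0≤+ (0≤diff y≤1) 0≤x) (solve 2 (λ x y → con 1ℚ := (:- (x :- y)) :+ ((con 1ℚ :- y) :+ x)) refl x y)

within1-χ : ∀ {d} b → Within1 d → Within1 (d * χ b)
within1-χ {d} true h = subst Within1 (sym (*-identityʳ d)) h
within1-χ {d} false h = subst Within1 (sym (*-zeroʳ d)) (0≤1 , 0≤1)

χ-diff : ∀ {d} a b → Within1 d → d * (χ a - χ b) ≤ χ (a xor b)
χ-diff {d} true true _ = ≤-reflexive (*-zeroʳ d)
χ-diff {d} true false h = ≤-trans (≤-reflexive (*-identityʳ d)) (proj₁ h)
χ-diff {d} false true h = ≤-trans (≤-reflexive (solve 1 (λ d → d :* (con 0ℚ :- con 1ℚ) := :- d) refl d)) (proj₂ h)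
χ-diff {d} false false _ = ≤-reflexive (*-zeroʳ d)

-- The difference of the products telescopes through X' × Y, changing one side at a time.
cutφ-diff : ∀ {d} σ (X Y X' Y' : VSet n) u v → Within1 d →
  d * (cutφ σ X Y u v - cutφ σ X' Y' u v) ≤ χ (X u xor X' u) + χ (Y v xor Y' v)
cutφ-diff {d = d} true X Y X' Y' u v h = ≤-trans
  (≤-reflexive (solve 5 (λ d a b a' b' → d :* (con 1ℚ :* (a :* b) :- con 1ℚ :* (a' :* b')) := d :* b :* (a :- a') :+ d :* a' :* (b :- b')) refl
     d (χ (X u)) (χ (Y v)) (χ (X' u)) (χ (Y' v))))
  (+-mono-≤ (χ-diff (X u) (X' u) (within1-χ (Y v) h)) (χ-diff (Y v) (Y' v) (within1-χ (X' u) h)))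
cutφ-diff {d = d} false X Y X' Y' u v h = ≤-trans
  (≤-reflexive (solve 5 (λ d a b a' b' → d :* (con (- 1ℚ) :* (a :* b) :- con (- 1ℚ) :* (a' :* b')) := (:- d) :* b :* (a :- a') :+ (:- d) :* a' :* (b :- b')) refl
     d (χ (X u)) (χ (Y v)) (χ (X' u)) (χ (Y' v))))
  (+-mono-≤ (χ-diff (X u) (X' u) (within1-χ (Y v) h')) (χ-diff (Y v) (Y' v) (within1-χ (X' u) h')))
  where
  h' : Within1 (- d)
  h' = proj₂ h , ≤-trans (≤-reflexive (solve 1 (λ d → :- (:- d) := d) refl d)) (proj₁ h)

∬-row : (f : Fin n → ℚ) → ∬ {n} {m} (λ u v → f u) ≡ ι m * ∑ f
∬-row {m = m} f = trans (∑-cong (λ u → ∑-const m (f u))) (∑-*ˡ (ι m) f)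

∬-col : (f : Fin m → ℚ) → ∬ {n} {m} (λ u v → f v) ≡ ι n * ∑ f
∬-col {n = n} f = ∑-const n (∑ f)

-- An exhaustive search over pairs of subsets decides the alternative; `σ` covers deviations of both
-- signs.
violated-cut? : (D : Fin n → Fin n → ℚ) (t : ℚ) →
  (Σ Bool λ σ → Σ (VSet n) λ X → Σ (VSet n) λ Y → t < ∬ (λ u v → D u v * cutφ σ X Y u v)) ⊎
  (∀ σ X Y → ∬ (λ u v → D u v * cutφ σ X Y u v) ≤ t)
violated-cut? {n} D t with search true | search false
  where
  set : Subset n → VSet n
  set p u = Vec.lookup p u
  search : ∀ σ → Dec (∃ λ p → ∃ λ q → t < ∬ (λ u v → D u v * cutφ σ (set p) (set q) u v))
  search σ = anySubset? (λ p → anySubset? (λ q → t <? ∬ (λ u v → D u v * cutφ σ (set p) (set q) u v)))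
... | yes (p , q , h) | _ = inj₁ (true , Vec.lookup p , Vec.lookup q , h)
... | no _ | yes (p , q , h) = inj₁ (false , Vec.lookup p , Vec.lookup q , h)
... | no a | no b = inj₂ λ { true X Y → ≮⇒≥ (a ∘ witness true X Y) ; false X Y → ≮⇒≥ (b ∘ witness false X Y) }
  where
  witness : ∀ σ X Y → t < ∬ (λ u v → D u v * cutφ σ X Y u v) →
    ∃ λ p → ∃ λ q → t < ∬ (λ u v → D u v * cutφ σ (Vec.lookup p) (Vec.lookup q) u v)
  witness σ X Y h = Vec.tabulate X , Vec.tabulate Y , subst (t <_) (∬-cong λ u v → cong (D u v *_)
    (cong₂ (λ a b → cutφ σ (λ _ → a) (λ _ → b) u v) (sym (lookup∘tabulate X u)) (sym (lookup∘tabulate Y v)))) h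

-- Approximation or separation

-- The step length is c, the accuracy on rectangles 2c. The condition on b says 2/b = c/2, so that
-- replacing both sides of a rectangle by unions of classes changes an integral by at most cN. The
-- threshold θ exceeds by cN the distance 2κ at which targets may lie from `g`.
module Loop {n k : ℕ} (A : Fin n → Fin n → Bool) (P : Fin n → Fin k) (b' K : ℕ) (2K≤n : 2 ℕ.* K ℕ.≤ n)
  (θ κ c : ℚ) (0≤c : 0ℚ ≤ c) (cb : c * ι (suc b') ≡ ℕ→ℚ 4) (cN≤θ : c * ∬ {n} {n} (λ _ _ → 1ℚ) + (κ + κ) ≤ θ) where

  open Adjust A P

  N : ℚ
  N = ∬ {n} {n} (λ _ _ → 1ℚ)

  N≡ : N ≡ ι n * ι n
  N≡ = trans (∬-const n n 1ℚ) (cong (ι n *_) (*-identityʳ (ι n)))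

  b : ℕ
  b = suc b'

  record Approximation : Set where
    field
      W    : Fin n → Fin n → ℚ
      0≤W  : ∀ u v → 0ℚ ≤ W u v
      W≤1  : ∀ u v → W u v ≤ 1ℚ
      cut  : ∀ σ X Y → ∬ (λ u v → (W u v - dP u v) * cutφ σ X Y u v) ≤ (c + c) * N
      near : ∬ (λ u v → (W u v - g u v) * flipₛ u v) ≤ θ

  record Separation : Set where
    field
      {order t} : ℕ
      Q         : Fin n → Fin order
      equi      : Equi (suc t) Q
      refines   : Refines Q P
      -- The order must not drop, because every later stage relies on it being at least the initial
      -- `K₀`.
      base≤     : k ℕ.≤ order
      order≤    : order ℕ.≤ K
      separated : κ < ∬ (λ u v → pos (dP u v) (Average.E Q g u v))

  sq-dist : (W W* : Fin n → Fin n → ℚ) → ℚ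
  sq-dist W W* = ∬ (λ u v → (W u v - W* u v) * (W u v - W* u v))

  split-gap : ∀ (W W* d φ : Fin n → Fin n → ℚ) →
    ∬ (λ u v → (W u v - W* u v) * φ u v) ≡ ∬ (λ u v → (W u v - d u v) * φ u v) - ∬ (λ u v → (W* u v - d u v) * φ u v)
  split-gap W W* d φ = trans (∬-cong (λ u v → solve 4 (λ W w d f → (W :- w) :* f := (W :- d) :* f :- (w :- d) :* f) refl (W u v) (W* u v) (d u v) (φ u v)))
    (∬-- (λ u v → (W u v - d u v) * φ u v) (λ u v → (W* u v - d u v) * φ u v))

  approx-error : ∀ (X X' : VSet n) → b ℕ.* size (λ v → X v xor X' v) ℕ.≤ 2 ℕ.* n →
    ι n * ∑ (λ v → χ (X v xor X' v)) ≤ ½ * (c * N)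
  approx-error X X' h = begin
    ν * ∑ (λ v → χ (X v xor X' v)) ≡⟨ cong (ν *_) (sym (ι-count (λ v → X v xor X' v))) ⟩
    ν * s ≤⟨ *-monoʳ (0≤ι n) s≤ ⟩
    ν * (½ * (c * ν)) ≡⟨ solve 3 (λ ν h c → ν :* (h :* (c :* ν)) := h :* (c :* (ν :* ν))) refl ν ½ c ⟩
    ½ * (c * (ν * ν)) ≡⟨ cong (λ t → ½ * (c * t)) (sym N≡) ⟩
    ½ * (c * N) ∎
    where
    open ≤-Reasoning
    ν = ι n
    s = ι (size (λ v → X v xor X' v))
    s≤ : s ≤ ½ * (c * ν)
    s≤ = *-cancel {ℕ→ℚ 4} (positive⁻¹ (ℕ→ℚ 4)) (begin
      ℕ→ℚ 4 * s ≡⟨ trans (cong (_* s) (sym cb)) (*-assoc c (ι b) s) ⟩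
      c * (ι b * s) ≤⟨ *-monoʳ 0≤c (≤-trans (≤-reflexive (sym (ι-* b (size (λ v → X v xor X' v))))) (≤-trans (ι-mono h) (≤-reflexive (trans (ι-* 2 n) (cong (_* ν) (ι≡ 2)))))) ⟩
      c * (ℕ→ℚ 2 * ν) ≡⟨ solve 2 (λ c ν → c :* (con (ℕ→ℚ 2) :* ν) := con (ℕ→ℚ 4) :* (con ½ :* (c :* ν))) refl c ν ⟩
      ℕ→ℚ 4 * (½ * (c * ν)) ∎)

  module _ {l} (R : Fin n → Fin l) (W : Fin n → Fin n → ℚ) where

    -- Which W* will be available is known only at the end, so progress is measured against every W* balanced for R.
    Invariant : ℕ → Set
    Invariant T = ∀ W* → Balanced R κ W* → sq-dist W W* < ι T * (c * c * N)

  balanced-coarser : ∀ {l l'} {R : Fin n → Fin l} {R' : Fin n → Fin l'} {W*} → Refines R' R → Balanced R' κ W* → Balanced R κ W*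
  balanced-coarser {R = R} {R'} r B = record
    { 0≤W = B.0≤W ; W≤1 = B.W≤1 ; near = B.near
    ; orth = λ φ meas → B.orth φ (Measurable-refine {P = R} {R'} {φ} r meas) }
    where module B = Balanced B

  step : (W φ : Fin n → Fin n → ℚ) → Fin n → Fin n → ℚ
  step W φ u v = clip (W u v - c * φ u v)

  step-decrease : ∀ T W W* φ → (∀ u v → 0ℚ ≤ W* u v) → (∀ u v → W* u v ≤ 1ℚ) → (∀ u v → φ u v * φ u v ≤ 1ℚ) →
    c * N ≤ ∬ (λ u v → (W u v - W* u v) * φ u v) →
    sq-dist W W* < ι (suc T) * (c * c * N) → sq-dist (step W φ) W* < ι T * (c * c * N)
  step-decrease T W W* φ 0≤W* W*≤1 φ≤1 corr h = subst₂ _<_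
    (solve 2 (λ a b → (a :+ b) :- b := a) refl (sq-dist (step W φ) W*) (c * c * N))
    (trans (cong (λ t → t * (c * c * N) - c * c * N) (ι-suc T)) (solve 2 (λ t b → (con 1ℚ :+ t) :* b :- b := t :* b) refl (ι T) (c * c * N)))
    (+-monoˡ-< (- (c * c * N)) (≤-<-trans (descent c W W* φ 0≤c 0≤W* W*≤1 φ≤1 corr) h))

  flip-gain : ∀ {l} {R : Fin n → Fin l} {W W*} → Balanced R κ W* → θ < ∬ (λ u v → (W u v - g u v) * flipₛ u v) →
    c * N ≤ ∬ (λ u v → (W u v - W* u v) * flipₛ u v)
  flip-gain {W = W} {W*} B far = begin
    c * N ≡⟨ solve 2 (λ a k → a := (a :+ k) :- k) refl (c * N) (κ + κ) ⟩
    (c * N + (κ + κ)) - (κ + κ)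
      ≤⟨ +-mono-≤ (≤-trans cN≤θ (<⇒≤ far)) (neg-antimono-≤ (Balanced.near B)) ⟩
    ∬ (λ u v → (W u v - g u v) * flipₛ u v) - ∬ (λ u v → (W* u v - g u v) * flipₛ u v)
      ≡⟨ sym (split-gap W W* g flipₛ) ⟩
    ∬ (λ u v → (W u v - W* u v) * flipₛ u v) ∎
    where open ≤-Reasoning

  -- Here `R` is the labelling after refinement: a target balanced for it is orthogonal to X' × Y',
  -- and passing to X × Y costs at most cN/2 for each side. Of the deviation 2cN of W, a correlation
  -- of cN with W - W* remains.
  cut-gain : ∀ {l} {R : Fin n → Fin l} {W W*} σ (X Y X' Y' : VSet n) → Measurable R (cutφ σ X' Y') →
    b ℕ.* size (λ v → X v xor X' v) ℕ.≤ 2 ℕ.* n → b ℕ.* size (λ v → Y v xor Y' v) ℕ.≤ 2 ℕ.* n →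
    Balanced R κ W* → (c + c) * N < ∬ (λ u v → (W u v - dP u v) * cutφ σ X Y u v) →
    c * N ≤ ∬ (λ u v → (W u v - W* u v) * cutφ σ X Y u v)
  cut-gain {W = W} {W*} σ X Y X' Y' φ'-meas errX errY B violated = begin
      c * N ≡⟨ solve 1 (λ a → a := (a :+ a) :- a) refl (c * N) ⟩
      (c * N + c * N) - c * N ≤⟨ +-mono-≤ (≤-trans (≤-reflexive (sym (*-distribʳ-+ N c c))) (<⇒≤ violated)) (neg-antimono-≤ small) ⟩
      ∬ (λ u v → (W u v - dP u v) * φ u v) - ∬ (λ u v → (W* u v - dP u v) * φ u v)
        ≡⟨ sym (split-gap W W* dP φ) ⟩
      ∬ (λ u v → (W u v - W* u v) * φ u v) ∎
    where
    open ≤-Reasoning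
    φ = cutφ σ X Y
    φ' = cutφ σ X' Y'
    d : Fin n → Fin n → ℚ
    d u v = W* u v - dP u v
    within : ∀ u v → Within1 (d u v)
    within u v = within1-diff (Balanced.0≤W B u v) (Balanced.W≤1 B u v)
      (Average.E-nonneg P (λ u v → 0≤χ (A u v)) u v) (Average.E≤1 P (λ u v → χ≤1 (A u v)) u v)
    small : ∬ (λ u v → d u v * φ u v) ≤ c * N
    small = begin
      ∬ (λ u v → d u v * φ u v)
        ≡⟨ trans (∬-cong (λ u v → solve 3 (λ d f g → d :* f := d :* (f :- g) :+ d :* g) refl (d u v) (φ u v) (φ' u v)))
             (trans (∬-+ (λ u v → d u v * (φ u v - φ' u v)) _) (trans (cong (∬ (λ u v → d u v * (φ u v - φ' u v)) +_) (Balanced.orth B φ' φ'-meas)) (+-identityʳ _))) ⟩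
      ∬ (λ u v → d u v * (φ u v - φ' u v))
        ≤⟨ ∬-mono (λ u v → cutφ-diff σ X Y X' Y' u v (within u v)) ⟩
      ∬ (λ u v → χ (X u xor X' u) + χ (Y v xor Y' v))
        ≡⟨ trans (∬-+ {n} {n} (λ u v → χ (X u xor X' u)) (λ u v → χ (Y v xor Y' v))) (cong₂ _+_ (∬-row {n} {n} (λ u → χ (X u xor X' u))) (∬-col {n = n} (λ v → χ (Y v xor Y' v)))) ⟩
      ι n * ∑ (λ v → χ (X v xor X' v)) + ι n * ∑ (λ v → χ (Y v xor Y' v))
        ≤⟨ +-mono-≤ (approx-error X X' errX) (approx-error Y Y' errY) ⟩
      ½ * (c * N) + ½ * (c * N) ≡⟨ solve 1 (λ a → con ½ :* a :+ con ½ :* a := a) refl (c * N) ⟩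
      c * N ∎

  record CutRefinement {l} (R : Fin n → Fin l) (X Y : VSet n) : Set where
    field
      {t}     : ℕ
      R'      : Fin n → Fin (l ℕ.* b ℕ.* b)
      equi    : Equi (suc t) R'
      refines : Refines R' R
      X' Y'   : VSet n
      meas    : ∀ σ → Measurable R' (cutφ σ X' Y')
      errX    : b ℕ.* size (λ v → X v xor X' v) ℕ.≤ 2 ℕ.* n
      errY    : b ℕ.* size (λ v → Y v xor Y' v) ℕ.≤ 2 ℕ.* n

  compose : ∀ {l} {R : Fin n → Fin l} {X Y} (r : Refinement R b X) → Refinement (Refinement.R' r) b Y → CutRefinement R X Y
  compose {X = X} {Y} r r' = record
    { R' = r₂.R' ; equi = r₂.equi ; refines = λ u v e → r₁.refines u v (r₂.refines u v e)
    ; X' = X' ; Y' = Y'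
    ; meas = λ σ p q → cutφ-cong σ {X'} {Y'} (cong r₁.hit (r₂.refines _ _ p)) (cong r₂.hit q)
    ; errX = r₁.error ; errY = r₂.error }
    where
    module r₁ = Refinement r
    module r₂ = Refinement r'
    X' Y' : VSet n
    X' u = r₁.hit (r₁.R' u)
    Y' v = r₂.hit (r₂.R' v)

  cut-refinement : ∀ {l t} {R : Fin n → Fin l} X Y → Equi t R → l ℕ.* b ℕ.* b ℕ.≤ K → CutRefinement R X Y
  cut-refinement {l} {R = R} X Y eqR lbb≤K = compose r
    (refine b' Y (Refinement.equi r) (ℕP.≤-trans (ℕP.*-monoʳ-≤ 2 lbb≤K) 2K≤n))
    where
    r : Refinement R b X
    r = refine b' X eqR (ℕP.≤-trans (ℕP.*-monoʳ-≤ 2 (ℕP.≤-trans (ℕP.m≤m*n (l ℕ.* b) b) lbb≤K)) 2K≤n)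

  -- T is the number of moves left. Each may multiply the order by b² and lowers the bound on the
  -- squared distance by c²N.
  record State (T : ℕ) : Set where
    field
      {order t} : ℕ
      R         : Fin n → Fin order
      equi      : Equi (suc t) R
      refines   : Refines R P
      base≤     : k ℕ.≤ order
      order≤    : order ℕ.* (b ℕ.* b) ℕ.^ T ℕ.≤ K
      W         : Fin n → Fin n → ℚ
      0≤W       : ∀ u v → 0ℚ ≤ W u v
      W≤1       : ∀ u v → W u v ≤ 1ℚ
      invariant : Invariant R W T

  -- At T = 0 the invariant would make a squared distance negative, so `R` admits no target. By
  -- `balanced`, the densities on `R` have then lost more than κ.
  finish : State 0 → Separation
  finish st = [ (λ close → ⊥-elim (no-balanced (balanced R refines close))) ,
                (λ sep → record { Q = R ; equi = equi ; refines = refines ; base≤ = base≤ ; order≤ = subst (ℕ._≤ K) (ℕP.*-identityʳ order) order≤ ; separated = sep }) ]′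
      (≤-dec⊎ (∬ (λ u v → pos (dP u v) (Average.E R g u v))) κ)
    where
    open State st
    no-balanced : Σ _ (Balanced R κ) → ⊥
    no-balanced (W* , B) = <-irrefl refl (<-≤-trans (≤-<-trans (∬-nonneg (λ u v → 0≤sq (W u v - W* u v))) (invariant W* B))
      (≤-reflexive (trans (cong (_* (c * c * N)) ι-0) (*-zeroˡ (c * c * N)))))

  flip-step : ∀ {T} (st : State (suc T)) → θ < ∬ (λ u v → (State.W st u v - g u v) * flipₛ u v) → State T
  flip-step {T} st far = record
    { R = R ; equi = equi ; refines = refines ; base≤ = base≤
    ; order≤ = ℕP.≤-trans (ℕP.*-monoʳ-≤ order (ℕP.m≤n*m ((b ℕ.* b) ℕ.^ T) (b ℕ.* b))) order≤
    ; W = step W flipₛ ; 0≤W = λ u v → 0≤clip (W u v - c * flipₛ u v) ; W≤1 = λ u v → clip≤1 (W u v - c * flipₛ u v)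
    ; invariant = λ W* B → step-decrease T W W* flipₛ (Balanced.0≤W B) (Balanced.W≤1 B) flipₛ-sq (flip-gain {W = W} B far) (invariant W* B) }
    where open State st

  cut-step : ∀ {T} (st : State (suc T)) σ X Y →
    (c + c) * N < ∬ (λ u v → (State.W st u v - dP u v) * cutφ σ X Y u v) → State T
  cut-step {T} st σ X Y violated = record
    { R = C.R' ; equi = C.equi ; refines = λ u v e → refines u v (C.refines u v e)
    ; base≤ = ℕP.≤-trans base≤ (ℕP.≤-trans (ℕP.m≤m*n order b) (ℕP.m≤m*n (order ℕ.* b) b))
    ; order≤ = subst (ℕ._≤ K) (sym order≡) order≤
    ; W = step W φ ; 0≤W = λ u v → 0≤clip (W u v - c * φ u v) ; W≤1 = λ u v → clip≤1 (W u v - c * φ u v)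
    ; invariant = λ W* B → step-decrease T W W* φ (Balanced.0≤W B) (Balanced.W≤1 B) (cutφ-sq σ X Y)
        (cut-gain {W = W} σ X Y C.X' C.Y' (C.meas σ) C.errX C.errY B violated) (invariant W* (balanced-coarser {R = R} {C.R'} C.refines B)) }
    where
    open State st
    φ = cutφ σ X Y
    order≡ : (order ℕ.* b ℕ.* b) ℕ.* (b ℕ.* b) ℕ.^ T ≡ order ℕ.* (b ℕ.* b) ℕ.^ suc T
    order≡ = trans (cong (ℕ._* (b ℕ.* b) ℕ.^ T) (ℕP.*-assoc order b b)) (ℕP.*-assoc order (b ℕ.* b) ((b ℕ.* b) ℕ.^ T))
    module C = CutRefinement (cut-refinement X Y equi
      (ℕP.≤-trans (ℕP.m≤m*n (order ℕ.* b ℕ.* b) ((b ℕ.* b) ℕ.^ T) {{ℕP.m^n≢0 (b ℕ.* b) T}}) (ℕP.≤-trans (ℕP.≤-reflexive order≡) order≤)))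

  loop : ∀ T → State T → Approximation ⊎ Separation
  loop zero st = inj₂ (finish st)
  loop (suc T) st = [ (λ near → [ (λ { (σ , X , Y , violated) → loop T (cut-step st σ X Y violated) }) ,
                                  (λ cut → inj₁ (record { W = W ; 0≤W = 0≤W ; W≤1 = W≤1 ; cut = cut ; near = near })) ]′
                        (violated-cut? (λ u v → W u v - dP u v) ((c + c) * N))) ,
                      (λ far → loop T (flip-step st far)) ]′
      (≤-dec⊎ (∬ (λ u v → (W u v - g u v) * flipₛ u v)) θ)
    where open State st

  approximate-or-separate : ∀ T {t} → Equi (suc t) P → k ℕ.* (b ℕ.* b) ℕ.^ T ℕ.≤ K → N < ι T * (c * c * N) → Approximation ⊎ Separation
  approximate-or-separate T eqP k≤K N< = loop T (record
    { R = P ; equi = eqP ; refines = λ u v e → e ; base≤ = ℕP.≤-refl ; order≤ = k≤K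
    ; W = g ; 0≤W = λ u v → 0≤χ (A u v) ; W≤1 = λ u v → χ≤1 (A u v)
    ; invariant = λ W* B → ≤-<-trans (∬-mono (λ u v → sq-≤1 (Balanced.0≤W B u v) (Balanced.W≤1 B u v) (A u v))) N< })

-- Regularity of pairs

ratio-* : ∀ e m → 0 ℕ.< m → ratio e m * ι m ≡ ι e
ratio-* e (suc m) _ = trans (cong (ratio e (suc m) *_) (ι≡ (suc m))) (trans (toℚᵘ-injective (ℚᵘP.≃-trans
    (toℚᵘ-homo-* (ratio e (suc m)) (ℕ→ℚ (suc m)))
    (ℚᵘP.≃-trans (ℚᵘP.*-cong (toℚᵘ-fromℚᵘ (ℚᵘ.mkℚᵘ (ℤ.+ e) m)) (/1-toℚᵘ (ℤ.+ suc m)))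
      (ℚᵘP.≃-trans (ℚᵘ.*≡* (trans (ℤP.*-identityʳ _) (cong (λ t → ℤ.+ e ℤ.* ℤ.+ suc t) (sym (ℕP.*-identityʳ m))))) (ℚᵘP.≃-sym (/1-toℚᵘ (ℤ.+ e))))))) (sym (ι≡ e)))

halve-≤ : x + x ≤ y + y → x ≤ y
halve-≤ {x} {y} h with ≤-dec⊎ x y
... | inj₁ a = a
... | inj₂ a = ⊥-elim (<-irrefl refl (<-≤-trans (+-mono-< a a) h))

-- |a - d| ≤ ε/2, with both sides doubled. A pair and its subpairs are compared with a common
-- reference d.
record Half-close (ε a d : ℚ) : Set where
  constructor both
  field
    above : (a - d) + (a - d) ≤ ε
    below : (d - a) + (d - a) ≤ ε
open Half-close

half-close-triangle : ∀ {ε a b d} → Half-close ε a d → Half-close ε b d → ∣ a - b ∣ ≤ ε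
half-close-triangle {ε} {a} {b} {d} (both p q) (both r s) = abs-≤
  (halve-≤ (≤-trans (≤-reflexive (solve 3 (λ a b d → (a :- b) :+ (a :- b) := ((a :- d) :+ (a :- d)) :+ ((d :- b) :+ (d :- b))) refl a b d)) (+-mono-≤ p s)))
  (halve-≤ (≤-trans (≤-reflexive (solve 3 (λ a b d → (:- (a :- b)) :+ (:- (a :- b)) := ((d :- a) :+ (d :- a)) :+ ((b :- d) :+ (b :- d))) refl a b d)) (+-mono-≤ q r)))

half-close-scale : ∀ {ε a d s} → 0ℚ < s → Half-close (ε * s) (a * s) (d * s) → Half-close ε a d
half-close-scale {ε} {a} {d} {s} 0<s (both p q) = both (cancel a d p) (cancel d a q)
  where
  cancel : ∀ a d → (a * s - d * s) + (a * s - d * s) ≤ ε * s → (a - d) + (a - d) ≤ ε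
  cancel a d h = *-cancel 0<s (≤-trans (≤-reflexive (solve 3 (λ a d s → s :* ((a :- d) :+ (a :- d)) := (a :* s :- d :* s) :+ (a :* s :- d :* s)) refl a d s))
    (≤-trans h (≤-reflexive (*-comm ε s))))

size-pos : ∀ {ε} (X : VSet n) → 0ℚ < ε → 0 ℕ.< m → ε * ι m ≤ ι (size X) → 0 ℕ.< size X
size-pos {ε = ε} X 0<ε 0<m h = ℕP.≰⇒> λ s≤0 → <-irrefl refl (<-≤-trans (0<* 0<ε (0<ι 0<m))
  (≤-trans h (≤-trans (ι-mono s≤0) (≤-reflexive ι-0))))

-- The edge count may err by ε/2 times the smallest admissible rectangle, ε|X| × ε|Y|; dividing by
-- the actual sizes leaves at most ε/2. The reference d is arbitrary, since the pair itself is
-- compared with it too.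
regular-pair : ∀ (H : Graph n) {ε} (X Y : VSet n) d → 0ℚ < ε → ε ≤ 1ℚ → 0 ℕ.< size X → 0 ℕ.< size Y →
  (∀ X' Y' → X' ⊆ X → Y' ⊆ Y →
    Half-close (ε * (ε * ι (size X) * (ε * ι (size Y)))) (ι (eXY H X' Y')) (d * (ι (size X') * ι (size Y')))) →
  IsRegularPair H ε X Y
regular-pair {n} H {ε} X Y d 0<ε ε≤1 0<X 0<Y close X' Y' X'⊆X Y'⊆Y hX hY =
  half-close-triangle (dens-close X Y (λ _ e → e) (λ _ e → e) (self X) (self Y))
    (dens-close X' Y' X'⊆X Y'⊆Y (subst (λ t → ε * t ≤ ι (size X')) (sym (ι≡ (size X))) (subst (ε * ℕ→ℚ (size X) ≤_) (sym (ι≡ (size X'))) hX))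
                                (subst (λ t → ε * t ≤ ι (size Y')) (sym (ι≡ (size Y))) (subst (ε * ℕ→ℚ (size Y) ≤_) (sym (ι≡ (size Y'))) hY)))
  where
  self : ∀ (Z : VSet n) → ε * ι (size Z) ≤ ι (size Z)
  self Z = ≤-trans (*-monoˡ (0≤ι (size Z)) ε≤1) (≤-reflexive (*-identityˡ (ι (size Z))))
  dens-close : ∀ X' Y' → X' ⊆ X → Y' ⊆ Y → ε * ι (size X) ≤ ι (size X') → ε * ι (size Y) ≤ ι (size Y') → Half-close ε (dens H X' Y') d
  dens-close X' Y' sX sY hX hY = half-close-scale {s = s} (0<* (0<ι 0<X') (0<ι 0<Y'))
    (subst (λ t → Half-close (ε * s) t (d * s)) e≡ (both (≤-trans (above c) bound) (≤-trans (below c) bound)))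
    where
    s = ι (size X') * ι (size Y')
    c = close X' Y' sX sY
    0<X' = size-pos X' 0<ε 0<X hX
    0<Y' = size-pos Y' 0<ε 0<Y hY
    e≡ : ι (eXY H X' Y') ≡ dens H X' Y' * s
    e≡ = trans (sym (ratio-* (eXY H X' Y') (size X' ℕ.* size Y') (ℕP.*-mono-< 0<X' 0<Y')))
           (cong (dens H X' Y' *_) (ι-* (size X') (size Y')))
    0≤ε = <⇒≤ 0<ε
    bound : ε * (ε * ι (size X) * (ε * ι (size Y))) ≤ ε * s
    bound = *-monoʳ 0≤ε (*-mono (0≤* 0≤ε (0≤ι (size X))) (0≤ι (size Y')) hX hY)

ι-∬ : ∀ (F : Fin n → Fin n → Bool) → ι (sumF (λ u → count (F u))) ≡ ∬ (λ u v → χ (F u v))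
ι-∬ F = trans (ι-sumF (λ u → count (F u))) (∑-cong (λ u → ι-count (F u)))

eXY-∬ : ∀ (H : Graph n) X Y → ι (eXY H X Y) ≡ ∬ (λ u v → χ (adj H u v) * (χ (X u) * χ (Y v)))
eXY-∬ H X Y = trans (ι-∬ (λ u v → X u ∧ Y v ∧ adj H u v)) (∬-cong (λ u v → split (X u) (Y v) (adj H u v)))
  where
  split : ∀ a b c → χ (a ∧ b ∧ c) ≡ χ c * (χ a * χ b)
  split a b c = trans (χ-∧ a (b ∧ c)) (trans (cong (χ a *_) (χ-∧ b c)) (solve 3 (λ a b c → a :* (b :* c) := c :* (a :* b)) refl (χ a) (χ b) (χ c)))

eXY-sym : ∀ (H : Graph n) X Y → eXY H X Y ≡ eXY H Y X
eXY-sym H X Y = ℕP.≤-antisym (ι-reflect-≤ (≤-reflexive eq)) (ι-reflect-≤ (≤-reflexive (sym eq)))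
  where
  eq : ι (eXY H X Y) ≡ ι (eXY H Y X)
  eq = trans (eXY-∬ H X Y) (trans (∑-swap (λ u v → χ (adj H u v) * (χ (X u) * χ (Y v))))
    (trans (∬-cong (λ v u → cong₂ (λ a b → χ a * b) (Graph.sym H u v) (*-comm (χ (X u)) (χ (Y v))))) (sym (eXY-∬ H Y X))))

regular-sym : ∀ {H : Graph n} {ε X Y} → IsRegularPair H ε X Y → IsRegularPair H ε Y X
regular-sym {H = H} {ε} {X} {Y} reg Y' X' Y'⊆Y X'⊆X hY hX =
  subst₂ (λ a b → ∣ a - b ∣ ≤ ε) (dens-sym X Y) (dens-sym X' Y') (reg X' Y' X'⊆X Y'⊆Y hX hY)
  where
  dens-sym : ∀ X Y → dens H X Y ≡ dens H Y X
  dens-sym X Y = cong₂ ratio (eXY-sym H X Y) (ℕP.*-comm (size X) (size Y))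

-- Comparing labels as Booleans

lt : Fin n → Fin n → Bool
lt i j = toℕ i ℕ.<ᵇ toℕ j

lt⇒< : ∀ {i j : Fin n} → lt i j ≡ true → toℕ i ℕ.< toℕ j
lt⇒< {i = i} {j} e = ℕP.<ᵇ⇒< (toℕ i) (toℕ j) (Equivalence.from T-≡ e)

<⇒lt : ∀ {i j : Fin n} → toℕ i ℕ.< toℕ j → lt i j ≡ true
<⇒lt h = Equivalence.to T-≡ (ℕP.<⇒<ᵇ h)

lt-false : ∀ {i j : Fin n} → toℕ j ℕ.≤ toℕ i → lt i j ≡ false
lt-false {i = i} {j} h with lt i j in eq
... | false = refl
... | true = ⊥-elim (ℕP.<⇒≱ (lt⇒< {i = i} {j} eq) h)

data Compared (i j : Fin n) : Set where
  less    : lt i j ≡ true → lt j i ≡ false → Compared i j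
  equal   : i ≡ j → lt i j ≡ false → lt j i ≡ false → Compared i j
  greater : lt j i ≡ true → lt i j ≡ false → Compared i j

compare : (i j : Fin n) → Compared i j
compare i j with ℕP.<-cmp (toℕ i) (toℕ j)
... | Relation.Binary.tri< a _ _ = less (<⇒lt {i = i} {j} a) (lt-false {i = j} {i} (ℕP.<⇒≤ a))
... | Relation.Binary.tri≈ _ e _ = equal (FinP.toℕ-injective e) (lt-false {i = i} {j} (ℕP.≤-reflexive (sym e))) (lt-false {i = j} {i} (ℕP.≤-reflexive e))
... | Relation.Binary.tri> _ _ a = greater (<⇒lt {i = j} {i} a) (lt-false {i = i} {j} (ℕP.<⇒≤ a))

∬-ordered : (a : Fin n → Fin n → ℚ) →
  ∬ (λ u v → χ (lt u v) * (a u v + a v u)) ≡ ∬ (λ u v → (χ (lt u v) + χ (lt v u)) * a u v)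
∬-ordered a = trans (trans (∬-cong (λ u v → *-distribˡ-+ (χ (lt u v)) (a u v) (a v u))) (∬-+ (λ u v → χ (lt u v) * a u v) (λ u v → χ (lt u v) * a v u)))
  (trans (cong (∬ (λ u v → χ (lt u v) * a u v) +_) (∑-swap (λ u v → χ (lt u v) * a v u)))
    (trans (sym (∬-+ (λ u v → χ (lt u v) * a u v) (λ u v → χ (lt v u) * a u v)))
      (∬-cong (λ u v → sym (*-distribʳ-+ (a u v) (χ (lt u v)) (χ (lt v u)))))))

lt-once : ∀ (u v : Fin n) → χ (lt u v) + χ (lt v u) ≤ 1ℚ
lt-once u v with compare u v
... | less p q rewrite p | q = ≤-refl
... | greater p q rewrite p | q = ≤-refl
... | equal _ p q rewrite p | q = 0≤1

∬-adj : (G : Graph n) → ∬ (λ u v → χ (adj G u v)) ≡ ι (edges G) + ι (edges G)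
∬-adj {n} G = begin
  ∬ g ≡⟨ ∬-cong off-diagonal ⟩
  ∬ (λ u v → (χ (lt u v) + χ (lt v u)) * g u v) ≡⟨ sym (∬-ordered g) ⟩
  ∬ (λ u v → χ (lt u v) * (g u v + g v u))
    ≡⟨ ∬-cong (λ u v → trans (cong (λ t → χ (lt u v) * (g u v + t)) (cong χ (Graph.sym G v u))) (*-distribˡ-+ (χ (lt u v)) (g u v) (g u v))) ⟩
  ∬ (λ u v → χ (lt u v) * g u v + χ (lt u v) * g u v) ≡⟨ ∬-+ (λ u v → χ (lt u v) * g u v) (λ u v → χ (lt u v) * g u v) ⟩
  ∬ (λ u v → χ (lt u v) * g u v) + ∬ (λ u v → χ (lt u v) * g u v) ≡⟨ cong₂ _+_ (sym E≡) (sym E≡) ⟩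
  ι (edges G) + ι (edges G) ∎
  where
  open ≡-Reasoning
  g : Fin n → Fin n → ℚ
  g u v = χ (adj G u v)
  E≡ : ι (edges G) ≡ ∬ (λ u v → χ (lt u v) * g u v)
  E≡ = trans (ι-∬ (λ u v → lt u v ∧ adj G u v)) (∬-cong (λ u v → χ-∧ (lt u v) (adj G u v)))
  off-diagonal : ∀ u v → g u v ≡ (χ (lt u v) + χ (lt v u)) * g u v
  off-diagonal u v with compare u v
  ... | less p q rewrite p | q = sym (*-identityˡ (g u v))
  ... | greater p q rewrite p | q = sym (*-identityˡ (g u v))
  ... | equal refl p _ rewrite p | Graph.irrefl G u = refl

-- Changing a graph between the classes of a labelling

-- A rounded matrix is not symmetric in general. Only its entries from a class to a later class are
-- used, and mirrored; inside classes G is kept, as regularity concerns distinct classes only.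
glue : Graph n → (Fin n → Fin k) → (Fin n → Fin n → Bool) → Graph n
glue {n} G P B = record { adj = H ; sym = H-sym ; irrefl = H-irrefl }
  where
  H : Fin n → Fin n → Bool
  H u v = if lt (P u) (P v) then B u v else if lt (P v) (P u) then B v u else adj G u v
  H-sym : ∀ u v → H u v ≡ H v u
  H-sym u v with compare (P u) (P v)
  ... | less p q rewrite p | q = refl
  ... | greater p q rewrite p | q = refl
  ... | equal _ p q rewrite p | q = Graph.sym G u v
  H-irrefl : ∀ u → H u u ≡ false
  H-irrefl u rewrite lt-false {i = P u} {P u} ℕP.≤-refl = Graph.irrefl G u

-- A changed pair u < v is charged to one of the entries (u,v) and (v,u) of `B`, so no entry is
-- charged twice.
editDist-glue : ∀ (G : Graph n) (P : Fin n → Fin k) B →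
  ι (editDist G (glue G P B)) ≤ ∬ (λ u v → χ (adj G u v xor B u v))
editDist-glue {n} G P B = begin
  ι (editDist G (glue G P B))
    ≡⟨ trans (ι-∬ (λ u v → lt u v ∧ (adj G u v xor adj (glue G P B) u v))) (∬-cong (λ u v → trans (χ-∧ (lt u v) _) (cong (χ (lt u v) *_) (changed u v)))) ⟩
  ∬ (λ u v → χ (lt u v) * (a u v + a v u)) ≡⟨ ∬-ordered a ⟩
  ∬ (λ u v → (χ (lt u v) + χ (lt v u)) * a u v)
    ≤⟨ ∬-mono (λ u v → ≤-trans (*-monoˡ (0≤a u v) (lt-once u v)) (≤-trans (≤-reflexive (*-identityˡ (a u v)))
         (≤-trans (*-monoˡ (0≤χ (adj G u v xor B u v)) (χ≤1 (lt (P u) (P v)))) (≤-reflexive (*-identityˡ _))))) ⟩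
  ∬ (λ u v → χ (adj G u v xor B u v)) ∎
  where
  open ≤-Reasoning
  a : Fin n → Fin n → ℚ
  a u v = χ (lt (P u) (P v)) * χ (adj G u v xor B u v)
  0≤a : ∀ u v → 0ℚ ≤ a u v
  0≤a u v = 0≤* (0≤χ (lt (P u) (P v))) (0≤χ (adj G u v xor B u v))
  xor-self : ∀ b → χ (b xor b) ≡ 0ℚ
  xor-self true = refl
  xor-self false = refl
  changed : ∀ u v → χ (adj G u v xor adj (glue G P B) u v) ≡ a u v + a v u
  changed u v with compare (P u) (P v)
  ... | less p q rewrite p | q = solve 2 (λ a b → a := con 1ℚ :* a :+ con 0ℚ :* b) refl (χ (adj G u v xor B u v)) (χ (adj G v u xor B v u))
  ... | greater p q rewrite p | q | Graph.sym G u v = solve 2 (λ a b → a := con 0ℚ :* b :+ con 1ℚ :* a) refl (χ (adj G v u xor B v u)) (χ (adj G v u xor B u v))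
  ... | equal _ p q rewrite p | q = trans (xor-self (adj G u v)) (solve 2 (λ a b → con 0ℚ := con 0ℚ :* a :+ con 0ℚ :* b) refl (χ (adj G u v xor B u v)) (χ (adj G v u xor B v u)))

part⇒≡ : ∀ (P : Fin n → Fin k) i u → part P i u ≡ true → P u ≡ i
part⇒≡ P i u e with P u Fin.≟ i
... | yes p = p

∬-rectangle : ∀ (X Y : VSet n) → ∬ (λ u v → χ (X u) * χ (Y v)) ≡ ι (size X) * ι (size Y)
∬-rectangle X Y = trans (∑-cong (λ u → trans (∑-*ˡ (χ (X u)) (λ v → χ (Y v))) (cong (χ (X u) *_) (sym (ι-count Y)))))
  (trans (∑-*ʳ (λ u → χ (X u)) (ι (size Y))) (cong (_* ι (size Y)) (sym (ι-count X))))

-- From a fractional approximation to a regular graph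

module Realise {n k t : ℕ} (G : Graph n) (P : Fin n → Fin k) (eqP : Equi (suc t) P)
  (M : ℕ) (1≤M : 1 ℕ.≤ M) (6M⁴≤n : 6 ℕ.* (M ℕ.* M ℕ.* (M ℕ.* M)) ℕ.≤ n)
  (γ θ : ℚ) (0≤γ : 0ℚ ≤ γ) (γM : γ * ι M ≡ 1ℚ)
  (W : Fin n → Fin n → ℚ) (0≤W : ∀ u v → 0ℚ ≤ W u v) (W≤1 : ∀ u v → W u v ≤ 1ℚ) where

  open Adjust (adj G) P

  private
    N = ι n * ι n

  module _ (W-cut : ∀ σ X Y → ∬ (λ u v → (W u v - dP u v) * cutφ σ X Y u v) ≤ γ * N)
    (W-near : ∬ (λ u v → (W u v - g u v) * flipₛ u v) ≤ θ) where

    module R = Rounding (rounding M 1≤M 6M⁴≤n W flipₛ 0≤W W≤1 flipₛ-sq)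

    B : Fin n → Fin n → Bool
    B = R.H

    H : Graph n
    H = glue G P B

    unscale : ∀ {z} → ι M * z ≤ N → z ≤ γ * N
    unscale {z} h = ≤-trans (≤-reflexive (trans (sym (*-identityˡ z)) (trans (cong (_* z) (sym γM)) (*-assoc γ (ι M) z)))) (*-monoʳ 0≤γ h)

    edit-bound : ι (editDist G H) ≤ γ * N + θ
    edit-bound = begin
      ι (editDist G H) ≤⟨ editDist-glue G P B ⟩
      ∬ (λ u v → χ (adj G u v xor B u v)) ≡⟨ ∬-cong (λ u v → xor-flip (adj G u v) (B u v) (W u v)) ⟩
      ∬ (λ u v → (χ (B u v) - W u v) * flipₛ u v + (W u v - g u v) * flipₛ u v)
        ≡⟨ ∬-+ (λ u v → (χ (B u v) - W u v) * flipₛ u v) (λ u v → (W u v - g u v) * flipₛ u v) ⟩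
      ∬ (λ u v → (χ (B u v) - W u v) * flipₛ u v) + ∬ (λ u v → (W u v - g u v) * flipₛ u v)
        ≤⟨ +-mono-≤ (unscale R.sum) W-near ⟩
      γ * N + θ ∎
      where
      open ≤-Reasoning
      xor-flip : ∀ a b w → χ (a xor b) ≡ (χ b - w) * (1ℚ - (χ a + χ a)) + (w - χ a) * (1ℚ - (χ a + χ a))
      xor-flip a b w = trans (closed a b) (solve 3 (λ a b w → (b :- a) :* (con 1ℚ :- (a :+ a)) := (b :- w) :* (con 1ℚ :- (a :+ a)) :+ (w :- a) :* (con 1ℚ :- (a :+ a))) refl (χ a) (χ b) w)
        where
        closed : ∀ a b → χ (a xor b) ≡ (χ b - χ a) * (1ℚ - (χ a + χ a))
        closed true true = refl
        closed true false = refl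
        closed false true = refl
        closed false false = refl

    cut-bound : ∀ σ X Y → ∬ (λ u v → (χ (B u v) - dP u v) * cutφ σ X Y u v) ≤ γ * N + γ * N
    cut-bound σ X Y = begin
      ∬ (λ u v → (χ (B u v) - dP u v) * cutφ σ X Y u v)
        ≡⟨ ∬-cong (λ u v → solve 6 (λ b d w s x y → (b :- d) :* (s :* (x :* y)) := (b :- w) :* ((s :* x) :* y) :+ (w :- d) :* (s :* (x :* y))) refl
             (χ (B u v)) (dP u v) (W u v) (sg σ) (χ (X u)) (χ (Y v))) ⟩
      ∬ (λ u v → (χ (B u v) - W u v) * ((sg σ * χ (X u)) * χ (Y v)) + (W u v - dP u v) * cutφ σ X Y u v)
        ≡⟨ ∬-+ (λ u v → (χ (B u v) - W u v) * ((sg σ * χ (X u)) * χ (Y v))) (λ u v → (W u v - dP u v) * cutφ σ X Y u v) ⟩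
      ∬ (λ u v → (χ (B u v) - W u v) * ((sg σ * χ (X u)) * χ (Y v))) + ∬ (λ u v → (W u v - dP u v) * cutφ σ X Y u v)
        ≤⟨ +-mono-≤ (unscale (R.cut (λ u → sg σ * χ (X u)) (λ v → χ (Y v)) (λ u → sq*sq≤1 (sg σ) (χ (X u)) (sg-sq σ) (χ-sq (X u))) (λ v → χ-sq (Y v)))) (W-cut σ X Y) ⟩
      γ * N + γ * N ∎
      where
      open ≤-Reasoning

    module _ (i j : Fin k) (i<j : lt i j ≡ true) (X Y : VSet n) (X⊆ : X ⊆ part P i) (Y⊆ : Y ⊆ part P j) where

      d : ℚ
      d = Average.block P g i j

      on-block : ∀ u v → (χ (B u v) - dP u v) * (χ (X u) * χ (Y v)) ≡ χ (adj H u v) * (χ (X u) * χ (Y v)) - d * (χ (X u) * χ (Y v))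
      on-block u v with X u in eX | Y v in eY
      ... | false | b = solve 5 (λ b d h e y → (b :- d) :* (con 0ℚ :* y) := h :* (con 0ℚ :* y) :- e :* (con 0ℚ :* y)) refl (χ (B u v)) (dP u v) (χ (adj H u v)) d (χ b)
      ... | true | false = solve 4 (λ b d h e → (b :- d) :* (con 1ℚ :* con 0ℚ) := h :* (con 1ℚ :* con 0ℚ) :- e :* (con 1ℚ :* con 0ℚ)) refl (χ (B u v)) (dP u v) (χ (adj H u v)) d
      ... | true | true rewrite part⇒≡ P i u (X⊆ u eX) | part⇒≡ P j v (Y⊆ v eY) | i<j =
        solve 2 (λ b d → (b :- d) :* (con 1ℚ :* con 1ℚ) := b :* (con 1ℚ :* con 1ℚ) :- d :* (con 1ℚ :* con 1ℚ)) refl (χ (B u v)) d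

      deviation : ∬ (λ u v → (χ (B u v) - dP u v) * (χ (X u) * χ (Y v))) ≡ ι (eXY H X Y) - d * (ι (size X) * ι (size Y))
      deviation = trans (∬-cong on-block) (trans (∬-- (λ u v → χ (adj H u v) * (χ (X u) * χ (Y v))) (λ u v → d * (χ (X u) * χ (Y v))))
        (cong₂ _-_ (sym (eXY-∬ H X Y)) (trans (∬-*ˡ d (λ u v → χ (X u) * χ (Y v))) (cong (d *_) (∬-rectangle X Y)))))

      pair-close : ∀ {η} → (γ * N + γ * N) + (γ * N + γ * N) ≤ η → Half-close η (ι (eXY H X Y)) (d * (ι (size X) * ι (size Y)))
      pair-close {η} hη = both (≤-trans (+-mono-≤ above' above') hη) (≤-trans (+-mono-≤ below' below') hη)
        where
        above' : ι (eXY H X Y) - d * (ι (size X) * ι (size Y)) ≤ γ * N + γ * N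
        above' = subst (_≤ γ * N + γ * N) (trans (∬-cong (λ u v → cong ((χ (B u v) - dP u v) *_) (*-identityˡ (χ (X u) * χ (Y v))))) deviation) (cut-bound true X Y)
        below' : d * (ι (size X) * ι (size Y)) - ι (eXY H X Y) ≤ γ * N + γ * N
        below' = subst (_≤ γ * N + γ * N) (trans (∬-cong (λ u v → solve 2 (λ d f → d :* (con (- 1ℚ) :* f) := :- (d :* f)) refl (χ (B u v) - dP u v) (χ (X u) * χ (Y v))))
            (trans (∬-neg (λ u v → (χ (B u v) - dP u v) * (χ (X u) * χ (Y v)))) (trans (cong -_ deviation)
              (solve 2 (λ a b → :- (a :- b) := b :- a) refl (ι (eXY H X Y)) (d * (ι (size X) * ι (size Y))))))) (cut-bound false X Y)

    module _ (ε : ℚ) (0<ε : 0ℚ < ε) (ε≤1 : ε ≤ 1ℚ) (γ-small : γ * (ℕ→ℚ 16 * (ι k * ι k)) ≤ ε * (ε * ε)) where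

      -- Classes have t + 1 or t + 2 elements, so n ≤ 2k(t + 1) and 4γn² ≤ 16k²γ(t + 1)². This is
      -- the origin of the factor 16k² in the hypothesis on γ.
      error-small : ∀ i j → (γ * N + γ * N) + (γ * N + γ * N) ≤ ε * (ε * ι (size (part P i)) * (ε * ι (size (part P j))))
      error-small i j = begin
        (γ * N + γ * N) + (γ * N + γ * N) ≡⟨ solve 2 (λ g N → (g :* N :+ g :* N) :+ (g :* N :+ g :* N) := con (ℕ→ℚ 4) :* g :* N) refl γ N ⟩
        ℕ→ℚ 4 * γ * (ι n * ι n) ≤⟨ *-monoʳ (0≤* (<⇒≤ (positive⁻¹ (ℕ→ℚ 4))) 0≤γ) (*-mono (0≤ι n) (0≤+ 0≤kμ 0≤kμ) n≤ n≤) ⟩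
        ℕ→ℚ 4 * γ * ((κ * μ + κ * μ) * (κ * μ + κ * μ))
          ≡⟨ solve 3 (λ g k m → con (ℕ→ℚ 4) :* g :* ((k :* m :+ k :* m) :* (k :* m :+ k :* m)) := g :* (con (ℕ→ℚ 16) :* (k :* k)) :* (m :* m)) refl γ κ μ ⟩
        γ * (ℕ→ℚ 16 * (κ * κ)) * (μ * μ) ≤⟨ *-monoˡ (0≤sq μ) γ-small ⟩
        ε * (ε * ε) * (μ * μ) ≤⟨ *-monoʳ (0≤* 0≤ε (0≤sq ε)) (*-mono 0≤μ (0≤ι _) (ι-mono (proj₁ (eqP i))) (ι-mono (proj₁ (eqP j)))) ⟩
        ε * (ε * ε) * (ι (size (part P i)) * ι (size (part P j)))
          ≡⟨ solve 3 (λ e x y → e :* (e :* e) :* (x :* y) := e :* (e :* x :* (e :* y))) refl ε (ι (size (part P i))) (ι (size (part P j))) ⟩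
        ε * (ε * ι (size (part P i)) * (ε * ι (size (part P j)))) ∎
        where
        open ≤-Reasoning
        κ = ι k
        μ = ι (suc t)
        0≤ε = <⇒≤ 0<ε
        0≤μ = 0≤ι (suc t)
        0≤kμ = 0≤* (0≤ι k) 0≤μ
        n≤ : ι n ≤ κ * μ + κ * μ
        n≤ = ≤-trans (ι-mono (ℕP.≤-trans (Equi-n≤ eqP) (ℕP.*-monoʳ-≤ k (s≤s (ℕP.m≤n+m (suc t) t)))))
          (≤-reflexive (trans (ι-* k (suc t ℕ.+ suc t)) (trans (cong (κ *_) (ι-+ (suc t) (suc t))) (*-distribˡ-+ κ μ μ))))

      regular-< : ∀ i j → lt i j ≡ true → IsRegularPair H ε (part P i) (part P j)
      regular-< i j i<j = regular-pair H (part P i) (part P j) (Average.block P g i j) 0<ε ε≤1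
        (ℕP.≤-trans (s≤s z≤n) (proj₁ (eqP i))) (ℕP.≤-trans (s≤s z≤n) (proj₁ (eqP j)))
        (λ X Y X⊆ Y⊆ → pair-close i j i<j X Y X⊆ Y⊆ (error-small i j))

      regular : ∀ i j → i ≢ j → IsRegularPair H ε (part P i) (part P j)
      regular i j i≢j with compare i j
      ... | less p _ = regular-< i j p
      ... | equal e _ _ = ⊥-elim (i≢j e)
      ... | greater p _ = regular-sym {H = H} {X = part P j} {part P i} (regular-< j i p)

-- Powers of natural numbers

^-cancelʳ-≤ : ∀ {a b} m → 0 ℕ.< m → a ℕ.^ m ℕ.≤ b ℕ.^ m → a ℕ.≤ b
^-cancelʳ-≤ {a} {b} m@(suc _) _ h = ℕP.≮⇒≥ λ b<a → ℕP.<⇒≱ (ℕP.^-monoˡ-< m b<a) h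

^-distrib : ∀ m a b → (a ℕ.* b) ℕ.^ m ≡ a ℕ.^ m ℕ.* b ℕ.^ m
^-distrib zero a b = refl
^-distrib (suc m) a b = trans (cong (a ℕ.* b ℕ.*_) (^-distrib m a b))
  (solveℕ 4 (λ a b c d → (a ⊠ b) ⊠ (c ⊠ d) ≐ (a ⊠ c) ⊠ (b ⊠ d)) refl a b (a ℕ.^ m) (b ℕ.^ m))

n<2^n : ∀ n → n ℕ.< 2 ℕ.^ n
n<2^n zero = s≤s z≤n
n<2^n (suc n) = ℕP.≤-trans (s≤s (n<2^n n)) (ℕP.≤-trans (ℕP.+-monoˡ-≤ (2 ℕ.^ n) (ℕP.m^n>0 2 n)) (ℕP.+-monoʳ-≤ (2 ℕ.^ n) (ℕP.m≤m+n (2 ℕ.^ n) 0)))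

n≤2^n : ∀ n → n ℕ.≤ 2 ℕ.^ n
n≤2^n n = ℕP.<⇒≤ (n<2^n n)

2n≤2^n : ∀ n → 1 ℕ.≤ n → 2 ℕ.* n ℕ.≤ 2 ℕ.^ n
2n≤2^n (suc n) _ = ℕP.*-monoʳ-≤ 2 (n<2^n n)

n²≤2^n : ∀ n → 4 ℕ.≤ n → n ℕ.* n ℕ.≤ 2 ℕ.^ n
n²≤2^n n 4≤n with ℕP.m≤n⇒∃[o]m+o≡n 4≤n
... | o , refl = go o
  where
  go : ∀ o → (4 ℕ.+ o) ℕ.* (4 ℕ.+ o) ℕ.≤ 2 ℕ.^ (4 ℕ.+ o)
  go zero = ℕP.≤-refl
  go (suc o) = ℕP.≤-trans (ℕP.≤-trans (ℕP.m≤m+n _ (7 ℕ.+ 6 ℕ.* o ℕ.+ o ℕ.* o)) (ℕP.≤-reflexive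
      (solveℕ 1 (λ o → (conℕ 5 ⊞ o) ⊠ (conℕ 5 ⊞ o) ⊞ (conℕ 7 ⊞ conℕ 6 ⊠ o ⊞ o ⊠ o) ≐ conℕ 2 ⊠ ((conℕ 4 ⊞ o) ⊠ (conℕ 4 ⊞ o))) refl o)))
    (ℕP.*-monoʳ-≤ 2 (go o))

-- Bernoulli's inequality (1 + 1/e)ᵐ ≥ 1 + m/e, cleared of denominators.
bernoulli : ∀ e m → e ℕ.^ m ℕ.* (e ℕ.+ m) ℕ.≤ e ℕ.* suc e ℕ.^ m
bernoulli e zero = ℕP.≤-reflexive (solveℕ 1 (λ e → conℕ 1 ⊠ (e ⊞ conℕ 0) ≐ e ⊠ conℕ 1) refl e)
bernoulli e (suc m) = begin
  e ℕ.* p ℕ.* (e ℕ.+ suc m) ≤⟨ ℕP.m≤m+n _ (p ℕ.* m) ⟩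
  e ℕ.* p ℕ.* (e ℕ.+ suc m) ℕ.+ p ℕ.* m
    ≡⟨ solveℕ 3 (λ e p m → e ⊠ p ⊠ (e ⊞ (conℕ 1 ⊞ m)) ⊞ p ⊠ m ≐ (conℕ 1 ⊞ e) ⊠ (p ⊠ (e ⊞ m))) refl e p m ⟩
  suc e ℕ.* (p ℕ.* (e ℕ.+ m)) ≤⟨ ℕP.*-monoʳ-≤ (suc e) (bernoulli e m) ⟩
  suc e ℕ.* (e ℕ.* suc e ℕ.^ m) ≡⟨ solveℕ 3 (λ a b c → a ⊠ (b ⊠ c) ≐ b ⊠ (a ⊠ c)) refl (suc e) e (suc e ℕ.^ m) ⟩
  e ℕ.* (suc e ℕ.* suc e ℕ.^ m) ∎
  where
  open ℕP.≤-Reasoning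
  p = e ℕ.^ m

double-^ : ∀ e m → 1 ℕ.≤ e → e ℕ.≤ m → 2 ℕ.* e ℕ.^ m ℕ.≤ suc e ℕ.^ m
double-^ e@(suc _) m _ e≤m = ℕP.*-cancelˡ-≤ e (begin
  e ℕ.* (2 ℕ.* e ℕ.^ m) ≡⟨ solveℕ 2 (λ e p → e ⊠ (conℕ 2 ⊠ p) ≐ p ⊠ (e ⊞ e)) refl e (e ℕ.^ m) ⟩
  e ℕ.^ m ℕ.* (e ℕ.+ e) ≤⟨ ℕP.*-monoʳ-≤ (e ℕ.^ m) (ℕP.+-monoʳ-≤ e e≤m) ⟩
  e ℕ.^ m ℕ.* (e ℕ.+ m) ≤⟨ bernoulli e m ⟩
  e ℕ.* suc e ℕ.^ m ∎)
  where open ℕP.≤-Reasoning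

-- (1 - x/N)^N ≤ 2⁻ˣ
2^x*e^N≤N^N : ∀ N x e → 1 ℕ.≤ e → e ℕ.+ x ℕ.≤ N → 2 ℕ.^ x ℕ.* e ℕ.^ N ℕ.≤ (e ℕ.+ x) ℕ.^ N
2^x*e^N≤N^N N zero e 1≤e h = ℕP.≤-reflexive (trans (ℕP.*-identityˡ (e ℕ.^ N)) (cong (ℕ._^ N) (sym (ℕP.+-identityʳ e))))
2^x*e^N≤N^N N (suc x) e 1≤e h = begin
  2 ℕ.* 2 ℕ.^ x ℕ.* e ℕ.^ N ≡⟨ solveℕ 2 (λ a b → conℕ 2 ⊠ a ⊠ b ≐ a ⊠ (conℕ 2 ⊠ b)) refl (2 ℕ.^ x) (e ℕ.^ N) ⟩
  2 ℕ.^ x ℕ.* (2 ℕ.* e ℕ.^ N) ≤⟨ ℕP.*-monoʳ-≤ (2 ℕ.^ x) (double-^ e N 1≤e (ℕP.≤-trans (ℕP.m≤m+n e (suc x)) h)) ⟩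
  2 ℕ.^ x ℕ.* suc e ℕ.^ N ≤⟨ 2^x*e^N≤N^N N x (suc e) (s≤s z≤n) (ℕP.≤-trans (ℕP.≤-reflexive (sym (ℕP.+-suc e x))) h) ⟩
  (suc e ℕ.+ x) ℕ.^ N ≡⟨ cong (ℕ._^ N) (sym (ℕP.+-suc e x)) ⟩
  (e ℕ.+ suc x) ℕ.^ N ∎
  where open ℕP.≤-Reasoning

-- J is the integral part of log₂ (N/e).
log-ratio : ∀ N e → 1 ℕ.≤ e → e ℕ.≤ N → ∃ λ J → 2 ℕ.^ J ℕ.* e ℕ.≤ N × N ℕ.< 2 ℕ.^ suc J ℕ.* e
log-ratio N e 1≤e e≤N = go N (ℕP.≤-trans (n<2^n N) (ℕP.m≤m*n (2 ℕ.^ N) e {{ℕ.>-nonZero 1≤e}}))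
  where
  go : ∀ i → N ℕ.< 2 ℕ.^ i ℕ.* e → ∃ λ J → 2 ℕ.^ J ℕ.* e ℕ.≤ N × N ℕ.< 2 ℕ.^ suc J ℕ.* e
  go zero h = ⊥-elim (ℕP.<⇒≱ (subst (N ℕ.<_) (ℕP.*-identityˡ e) h) e≤N)
  go (suc i) h with N ℕP.<? 2 ℕ.^ i ℕ.* e
  ... | yes h' = go i h'
  ... | no ¬h' = i , ℕP.≮⇒≥ ¬h' , h

-- With p = e/N the conclusion is h·r ≤ 2B·log₂(1/p). Both x/N = 1 - p and J are lower bounds for
-- log₂(1/p), the first by `2^x*e^N≤N^N`, and each consumes one copy of B. Raising to the power N
-- clears the denominator of x/N.
power-bound : ∀ {N e x J h A r B} → 1 ℕ.≤ e → e ℕ.+ x ≡ N → 2 ℕ.^ J ℕ.* e ℕ.≤ N →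
  h ℕ.* N ℕ.≤ A ℕ.* (x ℕ.+ J ℕ.* N) → A ℕ.* r ℕ.≤ B →
  2 ℕ.^ (h ℕ.* r) ℕ.* e ℕ.^ (B ℕ.+ B) ℕ.≤ N ℕ.^ (B ℕ.+ B)
power-bound {N} {e} {x} {J} {h} {A} {r} {B} 1≤e refl 2ᴶe≤N hN Ar≤B = ^-cancelʳ-≤ N 0<N (begin
  (2 ℕ.^ (h ℕ.* r) ℕ.* e ℕ.^ (B ℕ.+ B)) ℕ.^ N
    ≡⟨ trans (^-distrib N (2 ℕ.^ (h ℕ.* r)) (e ℕ.^ (B ℕ.+ B))) (cong₂ ℕ._*_ (ℕP.^-*-assoc 2 (h ℕ.* r) N) (ℕP.^-*-assoc e (B ℕ.+ B) N)) ⟩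
  2 ℕ.^ (h ℕ.* r ℕ.* N) ℕ.* e ℕ.^ ((B ℕ.+ B) ℕ.* N)
    ≤⟨ ℕP.*-monoˡ-≤ (e ℕ.^ ((B ℕ.+ B) ℕ.* N)) (ℕP.^-monoʳ-≤ 2 exponent) ⟩
  2 ℕ.^ (x ℕ.* B ℕ.+ J ℕ.* (N ℕ.* B)) ℕ.* e ℕ.^ ((B ℕ.+ B) ℕ.* N)
    ≡⟨ cong₂ ℕ._*_ (trans (ℕP.^-distribˡ-+-* 2 (x ℕ.* B) (J ℕ.* (N ℕ.* B))) (cong₂ ℕ._*_ (sym (ℕP.^-*-assoc 2 x B)) (sym (ℕP.^-*-assoc 2 J (N ℕ.* B)))))
        (trans (cong (e ℕ.^_) (solveℕ 2 (λ b n → (b ⊞ b) ⊠ n ≐ n ⊠ b ⊞ n ⊠ b) refl B N))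
          (trans (ℕP.^-distribˡ-+-* e (N ℕ.* B) (N ℕ.* B)) (cong (ℕ._* e ℕ.^ (N ℕ.* B)) (sym (ℕP.^-*-assoc e N B))))) ⟩
  ((2 ℕ.^ x) ℕ.^ B ℕ.* (2 ℕ.^ J) ℕ.^ (N ℕ.* B)) ℕ.* ((e ℕ.^ N) ℕ.^ B ℕ.* e ℕ.^ (N ℕ.* B))
    ≡⟨ trans (solveℕ 4 (λ a b c d → (a ⊠ b) ⊠ (c ⊠ d) ≐ (a ⊠ c) ⊠ (b ⊠ d)) refl ((2 ℕ.^ x) ℕ.^ B) ((2 ℕ.^ J) ℕ.^ (N ℕ.* B)) ((e ℕ.^ N) ℕ.^ B) (e ℕ.^ (N ℕ.* B)))
        (cong₂ ℕ._*_ (sym (^-distrib B (2 ℕ.^ x) (e ℕ.^ N))) (sym (^-distrib (N ℕ.* B) (2 ℕ.^ J) e))) ⟩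
  (2 ℕ.^ x ℕ.* e ℕ.^ N) ℕ.^ B ℕ.* (2 ℕ.^ J ℕ.* e) ℕ.^ (N ℕ.* B)
    ≤⟨ ℕP.*-mono-≤ (ℕP.^-monoˡ-≤ B (2^x*e^N≤N^N N x e 1≤e ℕP.≤-refl)) (ℕP.^-monoˡ-≤ (N ℕ.* B) 2ᴶe≤N) ⟩
  (N ℕ.^ N) ℕ.^ B ℕ.* N ℕ.^ (N ℕ.* B)
    ≡⟨ trans (cong (ℕ._* N ℕ.^ (N ℕ.* B)) (ℕP.^-*-assoc N N B)) (sym (ℕP.^-distribˡ-+-* N (N ℕ.* B) (N ℕ.* B))) ⟩
  N ℕ.^ (N ℕ.* B ℕ.+ N ℕ.* B)
    ≡⟨ trans (cong (N ℕ.^_) (solveℕ 2 (λ b n → n ⊠ b ⊞ n ⊠ b ≐ (b ⊞ b) ⊠ n) refl B N)) (sym (ℕP.^-*-assoc N (B ℕ.+ B) N)) ⟩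
  (N ℕ.^ (B ℕ.+ B)) ℕ.^ N ∎)
  where
  open ℕP.≤-Reasoning
  0<N : 0 ℕ.< N
  0<N = ℕP.≤-trans 1≤e (ℕP.m≤m+n e x)
  exponent : h ℕ.* r ℕ.* N ℕ.≤ x ℕ.* B ℕ.+ J ℕ.* (N ℕ.* B)
  exponent = begin
    h ℕ.* r ℕ.* N ≡⟨ solveℕ 3 (λ h r n → h ⊠ r ⊠ n ≐ h ⊠ n ⊠ r) refl h r N ⟩
    h ℕ.* N ℕ.* r ≤⟨ ℕP.*-monoˡ-≤ r hN ⟩
    A ℕ.* (x ℕ.+ J ℕ.* N) ℕ.* r ≡⟨ solveℕ 3 (λ a y r → a ⊠ y ⊠ r ≐ a ⊠ r ⊠ y) refl A (x ℕ.+ J ℕ.* N) r ⟩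
    A ℕ.* r ℕ.* (x ℕ.+ J ℕ.* N) ≤⟨ ℕP.*-monoˡ-≤ (x ℕ.+ J ℕ.* N) Ar≤B ⟩
    B ℕ.* (x ℕ.+ J ℕ.* N) ≡⟨ solveℕ 4 (λ b x j n → b ⊠ (x ⊞ j ⊠ n) ≐ x ⊠ b ⊞ j ⊠ (n ⊠ b)) refl B x J N ⟩
    x ℕ.* B ℕ.+ J ℕ.* (N ℕ.* B) ∎

-- The function ⌊2^(x / f x)⌋

module _ (b N : ℕ) where

  largestRoot-^ : 0 ℕ.< b → ∀ m → largestRoot b N m ℕ.^ b ℕ.≤ N
  largestRoot-^ 0<b zero = ℕP.≤-trans (ℕP.≤-reflexive (0^ 0<b)) z≤n
    where
    0^ : ∀ {b} → 0 ℕ.< b → 0 ℕ.^ b ≡ 0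
    0^ {suc _} _ = refl
  largestRoot-^ 0<b (suc m) with suc m ℕ.^ b ℕ.≤ᵇ N in eq
  ... | true = ℕP.≤ᵇ⇒≤ _ _ (subst Data.Bool.T (sym eq) _)
  ... | false = largestRoot-^ 0<b m

  ≤largestRoot : ∀ {r} m → r ℕ.≤ m → r ℕ.^ b ℕ.≤ N → r ℕ.≤ largestRoot b N m
  ≤largestRoot zero r≤m h = r≤m
  ≤largestRoot {r} (suc m) r≤m h with suc m ℕ.^ b ℕ.≤ᵇ N in eq
  ... | true = r≤m
  ... | false with ℕP.m≤n⇒m<n∨m≡n r≤m
  ...   | inj₁ (s≤s r≤m') = ≤largestRoot m r≤m' h
  ...   | inj₂ refl = ⊥-elim (subst Data.Bool.T eq (ℕP.≤⇒≤ᵇ h))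

m≤m^n : ∀ m {n} → 0 ℕ.< n → m ℕ.≤ m ℕ.^ n
m≤m^n zero _ = z≤n
m≤m^n m@(suc _) {n} 0<n = ℕP.≤-trans (ℕP.≤-reflexive (sym (ℕP.^-identityʳ m))) (ℕP.^-monoʳ-≤ m 0<n)

floor2^-lower : ∀ {a b} c → 0 ℕ.< b → c ℕ.* b ℕ.≤ a → 2 ℕ.^ c ℕ.≤ floor2^ a b
floor2^-lower {a} {b} c 0<b cb≤a = ≤largestRoot b (2 ℕ.^ a) (2 ℕ.^ a)
  (ℕP.^-monoʳ-≤ 2 (ℕP.≤-trans (ℕP.m≤m*n c b {{ℕ.>-nonZero 0<b}}) cb≤a))
  (ℕP.≤-trans (ℕP.≤-reflexive (ℕP.^-*-assoc 2 c b)) (ℕP.^-monoʳ-≤ 2 cb≤a))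

floor2^-mono : ∀ {a b a' b'} → 0 ℕ.< b → 0 ℕ.< b' → a ℕ.* b' ℕ.≤ a' ℕ.* b → floor2^ a b ℕ.≤ floor2^ a' b'
floor2^-mono {a} {b} {a'} {b'} 0<b 0<b' h = ≤largestRoot b' (2 ℕ.^ a') (2 ℕ.^ a') (ℕP.≤-trans (m≤m^n r 0<b') r^b') r^b'
  where
  r = floor2^ a b
  r^b' : r ℕ.^ b' ℕ.≤ 2 ℕ.^ a'
  r^b' = ^-cancelʳ-≤ b 0<b (begin
    (r ℕ.^ b') ℕ.^ b ≡⟨ trans (ℕP.^-*-assoc r b' b) (trans (cong (r ℕ.^_) (ℕP.*-comm b' b)) (sym (ℕP.^-*-assoc r b b'))) ⟩
    (r ℕ.^ b) ℕ.^ b' ≤⟨ ℕP.^-monoˡ-≤ b' (largestRoot-^ b (2 ℕ.^ a) 0<b (2 ℕ.^ a)) ⟩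
    (2 ℕ.^ a) ℕ.^ b' ≡⟨ ℕP.^-*-assoc 2 a b' ⟩
    2 ℕ.^ (a ℕ.* b') ≤⟨ ℕP.^-monoʳ-≤ 2 h ⟩
    2 ℕ.^ (a' ℕ.* b) ≡⟨ sym (ℕP.^-*-assoc 2 a' b) ⟩
    (2 ℕ.^ a') ℕ.^ b ∎)
    where open ℕP.≤-Reasoning

num : ℚ → ℕ
num p = ℤ.∣ ↥ p ∣

0<num : ∀ p → 0ℚ < p → 0 ℕ.< num p
0<num p@(mkℚ (ℤ.+ suc _) _ _) _ = s≤s z≤n
0<num p@(mkℚ (ℤ.+ 0) _ _) (ℚ.*<* (ℤ.+<+ ()))
0<num p@(mkℚ ℤ.-[1+ _ ] _ _) (ℚ.*<* ())

num-cross : ∀ {p q} → 0ℚ < p → 0ℚ < q → p ≤ q → num p ℕ.* ↧ₙ q ℕ.≤ num q ℕ.* ↧ₙ p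
num-cross {p} {q} 0<p 0<q p≤q with +num p 0<p | +num q 0<q | drop-*≤* p≤q
  where
  +num : ∀ p → 0ℚ < p → ↥ p ≡ ℤ.+ num p
  +num (mkℚ (ℤ.+ _) _ _) _ = refl
  +num (mkℚ ℤ.-[1+ _ ] _ _) (ℚ.*<* ())
... | ep | eq | h rewrite ep | eq = ℤP.drop‿+≤+ (subst₂ ℤ._≤_ (sym (ℤP.pos-* (num p) (↧ₙ q))) (sym (ℤP.pos-* (num q) (↧ₙ p))) h)

*-denominator : ∀ {p} → 0ℚ < p → p * ι (↧ₙ p) ≡ ι (num p)
*-denominator {p@(mkℚ (ℤ.+ a) d _)} _ = trans (cong (p *_) (ι≡ (suc d))) (trans (toℚᵘ-injective (ℚᵘP.≃-trans
    (toℚᵘ-homo-* p (ℕ→ℚ (suc d)))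
    (ℚᵘP.≃-trans (ℚᵘP.*-cong (ℚᵘP.≃-refl {ℚ.toℚᵘ p}) (/1-toℚᵘ (ℤ.+ suc d)))
      (ℚᵘP.≃-trans (ℚᵘ.*≡* (trans (ℤP.*-identityʳ _) (cong (λ t → ℤ.+ a ℤ.* ℤ.+ suc t) (sym (ℕP.*-identityʳ d))))) (ℚᵘP.≃-sym (/1-toℚᵘ (ℤ.+ a))))))) (sym (ι≡ a)))
*-denominator {mkℚ ℤ.-[1+ _ ] _ _} (ℚ.*<* ())

module Tower (f : ℕ → ℚ) (range : ∀ x → (0ℚ < f x) × (f x < 1ℚ)) (decreasing : ∀ x y → x ℕ.≤ y → f y ≤ f x) where

  F : ℕ → ℕ
  F = Ffloor f

  0<numf : ∀ x → 0 ℕ.< num (f x)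
  0<numf x = 0<num (f x) (proj₁ (range x))

  -- The integral part of 1/f(x). It is at least 1, so 1/f(x) lies between `q x` and twice `q x`.
  q : ℕ → ℕ
  q x = (↧ₙ (f x) ℕ./ num (f x)) {{ℕ.>-nonZero (0<numf x)}}

  q*num≤den : ∀ x → q x ℕ.* num (f x) ℕ.≤ ↧ₙ (f x)
  q*num≤den x = m/n*n≤m (↧ₙ (f x)) (num (f x)) {{ℕ.>-nonZero (0<numf x)}}

  1≤q : ∀ x → 1 ℕ.≤ q x
  1≤q x = ℕP.≤-trans (ℕP.≤-reflexive (sym (n/n≡1 (num (f x)) {{nz}}))) (/-monoˡ-≤ (num (f x)) {{nz}} num≤den)
    where
    nz = ℕ.>-nonZero (0<numf x)
    num≤den : num (f x) ℕ.≤ ↧ₙ (f x)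
    num≤den = subst₂ ℕ._≤_ (ℕP.*-identityʳ (num (f x))) (ℕP.*-identityˡ (↧ₙ (f x)))
      (num-cross {f x} {1ℚ} (proj₁ (range x)) 0<1 (<⇒≤ (proj₂ (range x))))

  den≤ : ∀ x → ↧ₙ (f x) ℕ.≤ num (f x) ℕ.* (q x ℕ.+ q x)
  den≤ x = begin
    ↧ₙ (f x) ≡⟨ m≡m%n+[m/n]*n (↧ₙ (f x)) a {{nz}} ⟩
    (↧ₙ (f x) ℕ.% a) {{nz}} ℕ.+ q x ℕ.* a ≤⟨ ℕP.+-monoˡ-≤ (q x ℕ.* a) (ℕP.≤-trans (ℕP.<⇒≤ (m%n<n (↧ₙ (f x)) a {{nz}})) (ℕP.m≤n*m a (q x) {{ℕ.>-nonZero (1≤q x)}})) ⟩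
    q x ℕ.* a ℕ.+ q x ℕ.* a ≡⟨ solveℕ 2 (λ q a → q ⊠ a ⊞ q ⊠ a ≐ a ⊠ (q ⊞ q)) refl (q x) a ⟩
    a ℕ.* (q x ℕ.+ q x) ∎
    where
    open ℕP.≤-Reasoning
    a = num (f x)
    nz = ℕ.>-nonZero (0<numf x)

  1≤f*2q : ∀ x → 1ℚ ≤ f x * (ι (q x) + ι (q x))
  1≤f*2q x = *-cancel {ι (↧ₙ (f x))} (0<ι (s≤s z≤n)) (begin
    ι (↧ₙ (f x)) * 1ℚ ≡⟨ *-identityʳ _ ⟩
    ι (↧ₙ (f x)) ≤⟨ ι-mono (den≤ x) ⟩
    ι (num (f x) ℕ.* (q x ℕ.+ q x)) ≡⟨ trans (ι-* (num (f x)) (q x ℕ.+ q x)) (cong (ι (num (f x)) *_) (ι-+ (q x) (q x))) ⟩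
    ι (num (f x)) * (ι (q x) + ι (q x)) ≡⟨ cong (_* (ι (q x) + ι (q x))) (trans (sym (*-denominator (proj₁ (range x)))) (*-comm (f x) _)) ⟩
    ι (↧ₙ (f x)) * f x * (ι (q x) + ι (q x)) ≡⟨ *-assoc (ι (↧ₙ (f x))) (f x) _ ⟩
    ι (↧ₙ (f x)) * (f x * (ι (q x) + ι (q x))) ∎)
    where open ≤-Reasoning

  F-lower : ∀ x → 2 ℕ.^ (x ℕ.* q x) ℕ.≤ F x
  F-lower x = floor2^-lower {x ℕ.* ↧ₙ (f x)} {num (f x)} (x ℕ.* q x) (0<numf x) (ℕP.≤-trans (ℕP.≤-reflexive (ℕP.*-assoc x (q x) (num (f x)))) (ℕP.*-monoʳ-≤ x (q*num≤den x)))

  F-mono : ∀ {x y} → x ℕ.≤ y → F x ℕ.≤ F y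
  F-mono {x} {y} x≤y = floor2^-mono {x ℕ.* ↧ₙ (f x)} {num (f x)} {y ℕ.* ↧ₙ (f y)} {num (f y)} (0<numf x) (0<numf y) (begin
    x ℕ.* ↧ₙ (f x) ℕ.* num (f y) ≡⟨ solveℕ 3 (λ x d n → x ⊠ d ⊠ n ≐ x ⊠ (n ⊠ d)) refl x (↧ₙ (f x)) (num (f y)) ⟩
    x ℕ.* (num (f y) ℕ.* ↧ₙ (f x)) ≤⟨ ℕP.*-mono-≤ x≤y (num-cross (proj₁ (range y)) (proj₁ (range x)) (decreasing x y x≤y)) ⟩
    y ℕ.* (num (f x) ℕ.* ↧ₙ (f y)) ≡⟨ solveℕ 3 (λ x d n → x ⊠ (n ⊠ d) ≐ x ⊠ d ⊠ n) refl y (↧ₙ (f y)) (num (f x)) ⟩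
    y ℕ.* ↧ₙ (f y) ℕ.* num (f x) ∎)
    where open ℕP.≤-Reasoning

  2^≤F : ∀ x → 2 ℕ.^ x ℕ.≤ F x
  2^≤F x = ℕP.≤-trans (ℕP.^-monoʳ-≤ 2 (ℕP.m≤m*n x (q x) {{ℕ.>-nonZero (1≤q x)}})) (F-lower x)

  x<F : ∀ x → x ℕ.< F x
  x<F x = ℕP.≤-trans (n<2^n x) (2^≤F x)

  sq≤F : ∀ {x y} → 4 ℕ.≤ x → x ℕ.≤ y → x ℕ.* x ℕ.≤ F y
  sq≤F {x} 4≤x x≤y = ℕP.≤-trans (n²≤2^n x 4≤x) (ℕP.≤-trans (2^≤F x) (F-mono x≤y))

  iter-mono : ∀ h {x y} → x ℕ.≤ y → iter F h x ℕ.≤ iter F h y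
  iter-mono zero x≤y = x≤y
  iter-mono (suc h) x≤y = F-mono (iter-mono h x≤y)

  iter-+ : ∀ a b x → iter F (a ℕ.+ b) x ≡ iter F a (iter F b x)
  iter-+ zero b x = refl
  iter-+ (suc a) b x = cong F (iter-+ a b x)

  iter-grow : ∀ h x → h ℕ.+ x ℕ.≤ iter F h x
  iter-grow zero x = ℕP.≤-refl
  iter-grow (suc h) x = ℕP.≤-trans (s≤s (iter-grow h x)) (x<F (iter F h x))

  x≤iter : ∀ h x → x ℕ.≤ iter F h x
  x≤iter h x = ℕP.≤-trans (ℕP.m≤n+m x h) (iter-grow h x)

  iter-≤ : ∀ {a b} x → a ℕ.≤ b → iter F a x ℕ.≤ iter F b x
  iter-≤ {a} {b} x a≤b with ℕP.m≤n⇒∃[o]m+o≡n a≤b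
  ... | o , refl = ℕP.≤-trans (x≤iter o (iter F a x)) (ℕP.≤-reflexive (trans (sym (iter-+ o a x)) (cong (λ t → iter F t x) (ℕP.+-comm o a))))

  -- With ε = f k ≥ 1/(2 q k), the accuracy 1/M = 1/(128 L³) is at most ε³/(16 k²).
  module Scale (k : ℕ) (4≤k : 4 ℕ.≤ k) where

    L M b T : ℕ
    L = k ℕ.* q k
    M = 2 ℕ.* (4 ℕ.* (4 ℕ.* (4 ℕ.* (L ℕ.* (L ℕ.* L)))))
    -- The step length will be c = 1/(2M), and cb = 4 gives b. The descent starts at squared
    -- distance at most N and loses c²N = N/(4M²) per move; one move more than 4M² makes the
    -- inequality strict.
    b = 8 ℕ.* M
    T = suc (4 ℕ.* (M ℕ.* M))

    k≤L : k ℕ.≤ L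
    k≤L = ℕP.m≤m*n k (q k) {{ℕ.>-nonZero (1≤q k)}}

    4≤L : 4 ℕ.≤ L
    4≤L = ℕP.≤-trans 4≤k k≤L

    instance
      L≢0 : ℕ.NonZero L
      L≢0 = ℕ.>-nonZero (ℕP.≤-trans (s≤s z≤n) 4≤L)

    L≤M : L ℕ.≤ M
    L≤M = grow 2 (grow 4 (grow 4 (grow 4 (ℕP.m≤m*n L (L ℕ.* L) {{ℕP.m*n≢0 L L}}))))
      where
      grow : ∀ {y} c .{{_ : ℕ.NonZero c}} → L ℕ.≤ y → L ℕ.≤ c ℕ.* y
      grow {y} c h = ℕP.≤-trans h (ℕP.m≤n*m y c)

    1≤M : 1 ℕ.≤ M
    1≤M = ℕP.≤-trans (s≤s z≤n) (ℕP.≤-trans 4≤L L≤M)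

    M≤b : M ℕ.≤ b
    M≤b = ℕP.m≤n*m M 8

    4≤b : 4 ℕ.≤ b
    4≤b = ℕP.≤-trans 4≤L (ℕP.≤-trans L≤M M≤b)

    k≤M : k ℕ.≤ M
    k≤M = ℕP.≤-trans k≤L L≤M

    -- Here b = 4⁵L³ ≤ L⁸, and L², L⁴, L⁸ are reached by one, two and three applications of F. The
    -- first, L² ≤ 2ᴸ ≤ F(k), exploits the factor 1/f in the exponent of F.
    b≤F³ : b ℕ.≤ iter F 3 k
    b≤F³ = begin
      b ≡⟨ solveℕ 1 (λ y → conℕ 8 ⊠ (conℕ 2 ⊠ (conℕ 4 ⊠ (conℕ 4 ⊠ (conℕ 4 ⊠ y)))) ≐ conℕ 4 ⊠ (conℕ 4 ⊠ (conℕ 4 ⊠ (conℕ 4 ⊠ (conℕ 4 ⊠ y))))) refl (L ℕ.* (L ℕ.* L)) ⟩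
      4 ℕ.* (4 ℕ.* (4 ℕ.* (4 ℕ.* (4 ℕ.* (L ℕ.* (L ℕ.* L))))))
        ≤⟨ up (up (up (up (up ℕP.≤-refl)))) ⟩
      L ℕ.* (L ℕ.* (L ℕ.* (L ℕ.* (L ℕ.* (L ℕ.* (L ℕ.* L))))))
        ≡⟨ solveℕ 1 (λ l → l ⊠ (l ⊠ (l ⊠ (l ⊠ (l ⊠ (l ⊠ (l ⊠ l)))))) ≐ ((l ⊠ l) ⊠ (l ⊠ l)) ⊠ ((l ⊠ l) ⊠ (l ⊠ l))) refl L ⟩
      ((L ℕ.* L) ℕ.* (L ℕ.* L)) ℕ.* ((L ℕ.* L) ℕ.* (L ℕ.* L))
        ≤⟨ sq≤F (4≤sq (4≤sq 4≤L)) (sq≤F (4≤sq 4≤L) L²≤F) ⟩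
      iter F 3 k ∎
      where
      open ℕP.≤-Reasoning
      up : ∀ {y z} → y ℕ.≤ z → 4 ℕ.* y ℕ.≤ L ℕ.* z
      up h = ℕP.*-mono-≤ 4≤L h
      4≤sq : ∀ {y} → 4 ℕ.≤ y → 4 ℕ.≤ y ℕ.* y
      4≤sq {y} h = ℕP.≤-trans h (ℕP.m≤m*n y y {{ℕ.>-nonZero (ℕP.≤-trans (s≤s z≤n) h)}})
      L²≤F : L ℕ.* L ℕ.≤ F k
      L²≤F = ℕP.≤-trans (n²≤2^n L 4≤L) (F-lower k)

    b⁴≤F⁵ : (b ℕ.* b) ℕ.* (b ℕ.* b) ℕ.≤ iter F 5 k
    b⁴≤F⁵ = sq≤F (ℕP.≤-trans 4≤b (ℕP.m≤m*n b b {{ℕ.>-nonZero (ℕP.≤-trans (s≤s z≤n) 4≤b)}})) (sq≤F 4≤b b≤F³)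

    6M⁴≤F⁵ : 6 ℕ.* (M ℕ.* M ℕ.* (M ℕ.* M)) ℕ.≤ iter F 5 k
    6M⁴≤F⁵ = ℕP.≤-trans (ℕP.≤-trans (ℕP.m≤m+n _ (58 ℕ.* (M ℕ.* M ℕ.* (M ℕ.* M))))
        (ℕP.≤-reflexive (solveℕ 1 (λ m → conℕ 6 ⊠ (m ⊠ m ⊠ (m ⊠ m)) ⊞ conℕ 58 ⊠ (m ⊠ m ⊠ (m ⊠ m)) ≐ (conℕ 8 ⊠ m ⊠ (conℕ 8 ⊠ m)) ⊠ (m ⊠ m)) refl M)))
      (ℕP.≤-trans (ℕP.*-monoʳ-≤ (b ℕ.* b) (ℕP.*-mono-≤ M≤b M≤b)) b⁴≤F⁵)

    T≤b² : T ℕ.≤ b ℕ.* b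
    T≤b² = ℕP.≤-trans (ℕP.+-monoˡ-≤ (4 ℕ.* (M ℕ.* M)) (ℕP.*-mono-≤ 1≤M 1≤M)) (ℕP.≤-trans (ℕP.m≤m+n _ (59 ℕ.* (M ℕ.* M)))
      (ℕP.≤-reflexive (solveℕ 1 (λ m → (m ⊠ m ⊞ conℕ 4 ⊠ (m ⊠ m)) ⊞ conℕ 59 ⊠ (m ⊠ m) ≐ conℕ 8 ⊠ m ⊠ (conℕ 8 ⊠ m)) refl M)))

    exponent≤ : k ℕ.+ (b ℕ.+ b) ℕ.* T ℕ.≤ (b ℕ.* b) ℕ.* (b ℕ.* b)
    exponent≤ = begin
      k ℕ.+ (b ℕ.+ b) ℕ.* T
        ≤⟨ ℕP.+-mono-≤ (ℕP.≤-trans (ℕP.≤-trans k≤M M≤b) (ℕP.m≤m*n b (b ℕ.* b) {{ℕP.m*n≢0 b b {{b≢0}} {{b≢0}}}})) (ℕP.*-monoʳ-≤ (b ℕ.+ b) T≤b²) ⟩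
      b ℕ.* (b ℕ.* b) ℕ.+ (b ℕ.+ b) ℕ.* (b ℕ.* b)
        ≤⟨ ℕP.m≤m+n _ (b ℕ.* (b ℕ.* b)) ⟩
      b ℕ.* (b ℕ.* b) ℕ.+ (b ℕ.+ b) ℕ.* (b ℕ.* b) ℕ.+ b ℕ.* (b ℕ.* b)
        ≡⟨ expand b ⟩
      4 ℕ.* (b ℕ.* (b ℕ.* b)) ≤⟨ ℕP.*-monoˡ-≤ (b ℕ.* (b ℕ.* b)) 4≤b ⟩
      b ℕ.* (b ℕ.* (b ℕ.* b)) ≡⟨ sym (ℕP.*-assoc b b (b ℕ.* b)) ⟩
      (b ℕ.* b) ℕ.* (b ℕ.* b) ∎
      where
      open ℕP.≤-Reasoning
      b≢0 = ℕ.>-nonZero (ℕP.≤-trans (s≤s z≤n) 4≤b)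
      expand : ∀ b → b ℕ.* (b ℕ.* b) ℕ.+ (b ℕ.+ b) ℕ.* (b ℕ.* b) ℕ.+ b ℕ.* (b ℕ.* b) ≡ 4 ℕ.* (b ℕ.* (b ℕ.* b))
      expand = solveℕ 1 (λ b → b ⊠ (b ⊠ b) ⊞ (b ⊞ b) ⊠ (b ⊠ b) ⊞ b ⊠ (b ⊠ b) ≐ conℕ 4 ⊠ (b ⊠ (b ⊠ b))) refl

    -- The crude bound y ≤ 2ʸ turns the product into a power of 2 with exponent k + 2bT ≤ b⁴, and
    -- one application of F beyond `b⁴≤F⁵` covers that power.
    growth : k ℕ.* (b ℕ.* b) ℕ.^ T ℕ.≤ iter F 6 k
    growth = begin
      k ℕ.* (b ℕ.* b) ℕ.^ T ≤⟨ ℕP.*-mono-≤ (n≤2^n k) (ℕP.^-monoˡ-≤ T (ℕP.*-mono-≤ (n≤2^n b) (n≤2^n b))) ⟩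
      2 ℕ.^ k ℕ.* (2 ℕ.^ b ℕ.* 2 ℕ.^ b) ℕ.^ T
        ≡⟨ cong (2 ℕ.^ k ℕ.*_) (trans (cong (ℕ._^ T) (sym (ℕP.^-distribˡ-+-* 2 b b))) (ℕP.^-*-assoc 2 (b ℕ.+ b) T)) ⟩
      2 ℕ.^ k ℕ.* 2 ℕ.^ ((b ℕ.+ b) ℕ.* T) ≡⟨ sym (ℕP.^-distribˡ-+-* 2 k ((b ℕ.+ b) ℕ.* T)) ⟩
      2 ℕ.^ (k ℕ.+ (b ℕ.+ b) ℕ.* T) ≤⟨ ℕP.^-monoʳ-≤ 2 (ℕP.≤-trans exponent≤ b⁴≤F⁵) ⟩
      2 ℕ.^ iter F 5 k ≤⟨ 2^≤F (iter F 5 k) ⟩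
      iter F 6 k ∎
      where open ℕP.≤-Reasoning

    -- The seventh application of a stage provides the factor 2 by which `refine` wants n to exceed
    -- the order.
    2F⁶≤F⁷ : 2 ℕ.* iter F 6 k ℕ.≤ iter F 7 k
    2F⁶≤F⁷ = ℕP.≤-trans (2n≤2^n (iter F 6 k) (ℕP.≤-trans (s≤s z≤n) (ℕP.≤-trans 4≤k (x≤iter 6 k)))) (2^≤F (iter F 6 k))

-- Edge counts and density

ι-2^ : ∀ J → ι (2 ℕ.^ J) ≡ pw J
ι-2^ zero = ι-1
ι-2^ (suc J) = trans (ι-* 2 (2 ℕ.^ J)) (cong₂ _*_ (ι≡ 2) (ι-2^ J))

module Edges (G : Graph n) where

  e : ℕ
  e = edges G ℕ.+ edges G

  ∬g : ∬ (λ u v → χ (adj G u v)) ≡ ι e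
  ∬g = trans (∬-adj G) (sym (ι-+ (edges G) (edges G)))

  ∬1 : ∬ {n} {n} (λ _ _ → 1ℚ) ≡ ι (n ℕ.* n)
  ∬1 = trans (∬-const n n 1ℚ) (trans (cong (ι n *_) (*-identityʳ (ι n))) (sym (ι-* n n)))

  e≤n² : e ℕ.≤ n ℕ.* n
  e≤n² = ι-reflect-≤ (subst₂ _≤_ ∬g ∬1 (∬-mono (λ u v → χ≤1 (adj G u v))))

  nonadj : ℕ
  nonadj = n ℕ.* n ℕ.∸ e

  e+x : e ℕ.+ nonadj ≡ n ℕ.* n
  e+x = ℕP.m+[n∸m]≡n e≤n²

  editDist-complete : ∀ (P : Fin n → Fin k) → editDist G (glue G P (λ _ _ → true)) ℕ.≤ nonadj
  editDist-complete P = ι-reflect-≤ (≤-trans (editDist-glue G P (λ _ _ → true)) (≤-reflexive (begin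
    ∬ (λ u v → χ (adj G u v xor true)) ≡⟨ ∬-cong (λ u v → complement (adj G u v)) ⟩
    ∬ (λ u v → 1ℚ - χ (adj G u v)) ≡⟨ ∬-- (λ _ _ → 1ℚ) (λ u v → χ (adj G u v)) ⟩
    ∬ {n} {n} (λ _ _ → 1ℚ) - ∬ (λ u v → χ (adj G u v)) ≡⟨ cong₂ _-_ (trans ∬1 (trans (cong ι (sym e+x)) (ι-+ e nonadj))) ∬g ⟩
    ι e + ι nonadj - ι e ≡⟨ solve 2 (λ e x → e :+ x :- e := x) refl (ι e) (ι nonadj) ⟩
    ι nonadj ∎)))
    where
    open ≡-Reasoning
    complement : ∀ b → χ (b xor true) ≡ 1ℚ - χ b
    complement true = refl
    complement false = refl

-- The outer iteration

module Outer (f : ℕ → ℚ) (range : ∀ x → (0ℚ < f x) × (f x < 1ℚ)) (decreasing : ∀ x y → x ℕ.≤ y → f y ≤ f x)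
  {n : ℕ} (G : Graph n) (D J K₀ : ℕ) (0<D : 0 ℕ.< D) (0<E : 0 ℕ.< edges G) (0<n : 0 ℕ.< n)
  (N<2ᴶ⁺¹e : n ℕ.* n ℕ.≤ 2 ℕ.* (2 ℕ.^ J ℕ.* Edges.e G))
  (4≤K₀ : 4 ℕ.≤ K₀) (4DN≤K₀e : 4 ℕ.* (D ℕ.* (n ℕ.* n)) ℕ.≤ K₀ ℕ.* Edges.e G) where

  open Tower f range decreasing

  g one : Fin n → Fin n → ℚ
  g u v = χ (adj G u v)
  one _ _ = 1ℚ

  0≤g : ∀ u v → 0ℚ ≤ g u v
  0≤g u v = 0≤χ (adj G u v)
  g≤1 : ∀ u v → g u v ≤ 1ℚ
  g≤1 u v = χ≤1 (adj G u v)

  open Edges G using (e; ∬g)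

  S N p d : ℚ
  S = ι e
  N = ι n * ι n
  p = S * inv N
  d = inv (ι D)

  ∬1 : ∬ one ≡ N
  ∬1 = trans (∬-const n n 1ℚ) (cong (ι n *_) (*-identityʳ (ι n)))

  0<N : 0ℚ < N
  0<N = 0<* (0<ι 0<n) (0<ι 0<n)

  0<S : 0ℚ < S
  0<S = 0<ι (ℕP.≤-trans 0<E (ℕP.m≤m+n (edges G) (edges G)))

  0<d : 0ℚ < d
  0<d = 0<inv (0<ι 0<D)

  0<p : 0ℚ < p
  0<p = 0<* 0<S (0<inv 0<N)

  pN : p * N ≡ S
  pN = trans (*-assoc S (inv N) N) (trans (cong (S *_) (trans (*-comm (inv N) N) (*-inv 0<N))) (*-identityʳ S))

  pN' : p * ∬ one ≡ ∬ g
  pN' = trans (cong (p *_) ∬1) (trans pN (sym ∬g))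

  -- Since ∬ g = S, a separation by κ raises the energy by 2τκ - 4τ²S = gain.
  κ θ τ gain : ℚ
  κ = (ℤ.+ 1 / 16) * (S * d)
  θ = (ℤ.+ 1 / 4) * (S * d)
  τ = (ℤ.+ 1 / 64) * d
  gain = (ℤ.+ 1 / 1024) * (S * (d * d))

  energy : ∀ {j} → (Fin n → Fin j) → ℚ
  energy R = ∬ (λ u v → Φ J (Average.E R g u v))

  hf≤2p : hf J ≤ p + p
  hf≤2p = *-cancel 0<N (begin
    N * hf J ≤⟨ *-monoˡ (<⇒≤ (0<hf J)) (≤-trans (≤-reflexive (sym (ι-* n n))) (ι-mono N<2ᴶ⁺¹e)) ⟩
    ι (2 ℕ.* (2 ℕ.^ J ℕ.* e)) * hf J
      ≡⟨ cong (_* hf J) (trans (ι-* 2 (2 ℕ.^ J ℕ.* e)) (cong₂ _*_ (ι≡ 2) (trans (ι-* (2 ℕ.^ J) e) (cong (_* S) (ι-2^ J))))) ⟩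
    ℕ→ℚ 2 * (pw J * S) * hf J ≡⟨ solve 3 (λ w s h → con (ℕ→ℚ 2) :* (w :* s) :* h := (w :* h) :* s :+ (w :* h) :* s) refl (pw J) S (hf J) ⟩
    (pw J * hf J) * S + (pw J * hf J) * S ≡⟨ cong (λ t → t * S + t * S) (pw*hf J) ⟩
    1ℚ * S + 1ℚ * S ≡⟨ cong₂ _+_ (trans (*-identityˡ S) (sym pN)) (trans (*-identityˡ S) (sym pN)) ⟩
    p * N + p * N ≡⟨ solve 2 (λ p N → p :* N :+ p :* N := N :* (p :+ p)) refl p N ⟩
    N * (p + p) ∎)
    where open ≤-Reasoning

  energy-step : ∀ {j j'} (P : Fin n → Fin j) (Q : Fin n → Fin j') → Refines Q P →
    κ < ∬ (λ u v → pos (Average.E P g u v) (Average.E Q g u v)) → energy P + gain ≤ energy Q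
  energy-step P Q Q≼P sep = diff≤ (≤-trans (0≤diff (≤-trans (+-monoʳ-≤ (energy P) (*-monoʳ 0≤2τ (<⇒≤ sep)))
      (≤-trans (Energy.energy-gain g 0≤g g≤1 P Q Q≼P J {p} {τ} (<⇒≤ 0<p) 0≤τ hf≤2p pN')
        (≤-reflexive (cong (λ s → energy Q + τ * τ * ((s + s) + (s + s))) ∬g)))))
    -- The slope τ = κ/(4S) is the maximiser of 2τκ - 4τ²S.
    (≤-reflexive (solve 4 (λ P Q s d → (Q :+ con (ℤ.+ 1 / 64) :* d :* (con (ℤ.+ 1 / 64) :* d) :* ((s :+ s) :+ (s :+ s))) :-
         (P :+ (con (ℤ.+ 1 / 64) :* d :+ con (ℤ.+ 1 / 64) :* d) :* (con (ℤ.+ 1 / 16) :* (s :* d))) := Q :- (P :+ con (ℤ.+ 1 / 1024) :* (s :* (d :* d))))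
      refl (energy P) (energy Q) S d)))
    where
    0≤τ = 0≤* (<⇒≤ (positive⁻¹ (ℤ.+ 1 / 64))) (<⇒≤ 0<d)
    0≤2τ = 0≤+ 0≤τ 0≤τ

  energy-cap : ∀ {j j'} (P : Fin n → Fin j) (Q : Fin n → Fin j') → Refines Q P →
    energy Q ≤ energy P + (p * (N - S) + ι J * (S + S))
  energy-cap P Q Q≼P = ≤-trans (Energy.energy-range g 0≤g g≤1 P Q Q≼P J {p} pN')
    (≤-reflexive (cong₂ (λ a b → energy P + (p * (a - b) + ι J * (b + b))) ∬1 ∬g))

  record Regularised {j} (P₁ : Fin n → Fin j) (bound : ℕ) : Set where
    field
      H       : Graph n
      edit    : ι (editDist G H) ≤ ι (edges G) * d
      {order t} : ℕ
      Q       : Fin n → Fin order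
      equi    : Equi (suc t) Q
      refines : Refines Q P₁
      regular : IsFRegular f H Q
      order≤  : order ℕ.≤ bound

  module Stage {k t : ℕ} (P : Fin n → Fin k) (eqP : Equi (suc t) P) (K₀≤k : K₀ ℕ.≤ k) (F⁷≤n : iter F 7 k ℕ.≤ n) where

    open Scale k (ℕP.≤-trans 4≤K₀ K₀≤k)

    μ γ c : ℚ
    μ = ι M
    γ = inv μ
    c = ½ * γ

    0<μ : 0ℚ < μ
    0<μ = 0<ι 1≤M

    0<γ : 0ℚ < γ
    0<γ = 0<inv 0<μ

    γμ : γ * μ ≡ 1ℚ
    γμ = trans (*-comm γ μ) (*-inv 0<μ)

    0≤c : 0ℚ ≤ c
    0≤c = 0≤* 0≤½ (<⇒≤ 0<γ)

    -- The accuracy 1/M is at most dp/4. This is what the large initial order is for: M ≥ k ≥ `K₀`.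
    γN≤θ : γ * N ≤ θ
    γN≤θ = begin
      γ * N ≡⟨ trans (sym (*-identityʳ (γ * N))) (cong (γ * N *_) (sym (*-inv (0<ι 0<D)))) ⟩
      γ * N * (ι D * d) ≡⟨ solve 4 (λ g N D d → g :* N :* (D :* d) := con (ℤ.+ 1 / 4) :* (g :* d) :* (con (ℕ→ℚ 4) :* (D :* N))) refl γ N (ι D) d ⟩
      (ℤ.+ 1 / 4) * (γ * d) * (ℕ→ℚ 4 * (ι D * N)) ≤⟨ *-monoʳ (0≤* (<⇒≤ (positive⁻¹ (ℤ.+ 1 / 4))) (0≤* (<⇒≤ 0<γ) (<⇒≤ 0<d))) scaled ⟩
      (ℤ.+ 1 / 4) * (γ * d) * (μ * S) ≡⟨ solve 4 (λ g d m s → con (ℤ.+ 1 / 4) :* (g :* d) :* (m :* s) := con (ℤ.+ 1 / 4) :* (s :* d) :* (g :* m)) refl γ d μ S ⟩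
      (ℤ.+ 1 / 4) * (S * d) * (γ * μ) ≡⟨ trans (cong (θ *_) γμ) (*-identityʳ θ) ⟩
      θ ∎
      where
      open ≤-Reasoning
      scaled : ℕ→ℚ 4 * (ι D * N) ≤ μ * S
      scaled = subst₂ _≤_ (trans (ι-* 4 (D ℕ.* (n ℕ.* n))) (cong₂ _*_ (ι≡ 4) (trans (ι-* D (n ℕ.* n)) (cong (ι D *_) (ι-* n n)))))
        (ι-* M e)
        (ι-mono (ℕP.≤-trans 4DN≤K₀e (ℕP.*-monoˡ-≤ e (ℕP.≤-trans K₀≤k k≤M))))

    -- The two halves of θ = Sd/4: cN = γN/2 is at most Sd/8, and 2κ is Sd/8.
    cN≤θ : c * ∬ one + (κ + κ) ≤ θ
    cN≤θ = ≤-trans (≤-reflexive (cong (λ t → c * t + (κ + κ)) ∬1)) (≤-trans (+-monoˡ-≤ (κ + κ) (≤-trans (≤-reflexive (*-assoc ½ γ N)) (*-monoʳ 0≤½ γN≤θ)))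
      (≤-reflexive (solve 1 (λ a → con ½ :* (con (ℤ.+ 1 / 4) :* a) :+ (con (ℤ.+ 1 / 16) :* a :+ con (ℤ.+ 1 / 16) :* a) := con (ℤ.+ 1 / 4) :* a) refl (S * d))))

    sb≡b : suc (ℕ.pred b) ≡ b
    sb≡b = ℕP.suc-pred b {{ℕ.>-nonZero (ℕP.≤-trans (s≤s z≤n) 4≤b)}}

    cb : c * ι (suc (ℕ.pred b)) ≡ ℕ→ℚ 4
    cb = trans (cong (λ t → c * ι t) sb≡b) (trans (cong (c *_) (trans (ι-* 8 M) (cong (_* μ) (ι≡ 8))))
      (trans (solve 2 (λ g m → con ½ :* g :* (con (ℕ→ℚ 8) :* m) := con (ℕ→ℚ 4) :* (g :* m)) refl γ μ) (trans (cong (ℕ→ℚ 4 *_) γμ) (*-identityʳ (ℕ→ℚ 4)))))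

    enough-steps : ∬ one < ι T * (c * c * ∬ one)
    enough-steps = subst₂ _<_ (trans (+-identityˡ N) (sym ∬1)) (trans eq (sym (cong (λ t → ι T * (c * c * t)) ∬1)))
      (+-monoˡ-< N (0<* (0<* (positive⁻¹ (ℤ.+ 1 / 4)) (0<* 0<γ 0<γ)) 0<N))
      where
      eq : (ℤ.+ 1 / 4) * (γ * γ) * N + N ≡ ι T * (c * c * N)
      eq = sym (trans (cong (_* (c * c * N)) (trans (ι-suc (4 ℕ.* (M ℕ.* M))) (cong (1ℚ +_) (trans (ι-* 4 (M ℕ.* M)) (cong₂ _*_ (ι≡ 4) (ι-* M M))))))
        (trans (solve 3 (λ m g N → (con 1ℚ :+ con (ℕ→ℚ 4) :* (m :* m)) :* (con ½ :* g :* (con ½ :* g) :* N) := con (ℤ.+ 1 / 4) :* (g :* g) :* N :+ (g :* m) :* (g :* m) :* N) refl μ γ N)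
          (cong ((ℤ.+ 1 / 4) * (γ * γ) * N +_) (trans (cong (λ t → t * t * N) γμ) (trans (*-assoc 1ℚ 1ℚ N) (trans (*-identityˡ (1ℚ * N)) (*-identityˡ N)))))))

    open Loop (adj G) P (ℕ.pred b) (iter F 6 k) (ℕP.≤-trans 2F⁶≤F⁷ F⁷≤n) θ κ c 0≤c cb cN≤θ
      using (Approximation; Separation; approximate-or-separate)

    dichotomy : Approximation ⊎ Separation
    dichotomy = approximate-or-separate T eqP (ℕP.≤-trans (ℕP.≤-reflexive (cong (λ t → k ℕ.* (t ℕ.* t) ℕ.^ T) sb≡b)) growth) enough-steps

    γ-small : γ * (ℕ→ℚ 16 * (ι k * ι k)) ≤ f k * (f k * f k)
    γ-small = begin
      γ * (ℕ→ℚ 16 * (ι k * ι k)) ≡⟨ cong (γ *_) (sym (*-identityʳ _)) ⟩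
      γ * (ℕ→ℚ 16 * (ι k * ι k) * 1ℚ)
        ≤⟨ *-monoʳ (<⇒≤ 0<γ) (*-mono (0≤* 0≤16 (0≤sq (ι k))) (0≤* 0≤y (0≤sq f·2q)) (*-monoʳ 0≤16 k²≤k³) 1≤y³) ⟩
      γ * (ℕ→ℚ 16 * (ι k * (ι k * ι k)) * (f·2q * (f·2q * f·2q)))
        ≡⟨ solve 4 (λ g k f q → g :* (con (ℕ→ℚ 16) :* (k :* (k :* k)) :* (f :* (q :+ q) :* (f :* (q :+ q) :* (f :* (q :+ q))))) :=
             (f :* (f :* f)) :* (g :* (con (ℕ→ℚ 2) :* (con (ℕ→ℚ 4) :* (con (ℕ→ℚ 4) :* (con (ℕ→ℚ 4) :* (k :* q :* ((k :* q) :* (k :* q))))))))) refl γ (ι k) (f k) (ι (q k)) ⟩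
      f k * (f k * f k) * (γ * (ℕ→ℚ 2 * (ℕ→ℚ 4 * (ℕ→ℚ 4 * (ℕ→ℚ 4 * (ι k * ι (q k) * (ι k * ι (q k) * (ι k * ι (q k)))))))))
        ≡⟨ cong (λ t → f k * (f k * f k) * (γ * t)) (sym μ≡) ⟩
      f k * (f k * f k) * (γ * μ) ≡⟨ trans (cong (f k * (f k * f k) *_) γμ) (*-identityʳ _) ⟩
      f k * (f k * f k) ∎
      where
      open ≤-Reasoning
      f·2q = f k * (ι (q k) + ι (q k))
      0≤16 = <⇒≤ (positive⁻¹ (ℕ→ℚ 16))
      1≤y : 1ℚ ≤ f·2q
      1≤y = 1≤f*2q k
      0≤y = ≤-trans 0≤1 1≤y
      1≤y³ : 1ℚ ≤ f·2q * (f·2q * f·2q)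
      1≤y³ = *-mono 0≤1 (0≤sq f·2q) 1≤y (*-mono 0≤1 0≤y 1≤y 1≤y)
      k²≤k³ : ι k * ι k ≤ ι k * (ι k * ι k)
      k²≤k³ = ≤-trans (≤-reflexive (sym (*-identityˡ _))) (*-monoˡ (0≤sq (ι k)) (subst (_≤ ι k) ι-1 (ι-mono (ℕP.≤-trans (s≤s z≤n) (ℕP.≤-trans 4≤K₀ K₀≤k)))))
      ι4 : ∀ y {z} → ι y ≡ z → ι (4 ℕ.* y) ≡ ℕ→ℚ 4 * z
      ι4 y e = trans (ι-* 4 y) (cong₂ _*_ (ι≡ 4) e)
      ιL : ι L ≡ ι k * ι (q k)
      ιL = ι-* k (q k)
      μ≡ : μ ≡ ℕ→ℚ 2 * (ℕ→ℚ 4 * (ℕ→ℚ 4 * (ℕ→ℚ 4 * (ι k * ι (q k) * (ι k * ι (q k) * (ι k * ι (q k)))))))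
      μ≡ = trans (ι-* 2 (4 ℕ.* (4 ℕ.* (4 ℕ.* (L ℕ.* (L ℕ.* L)))))) (cong₂ _*_ (ι≡ 2) (ι4 (4 ℕ.* (4 ℕ.* (L ℕ.* (L ℕ.* L)))) (ι4 (4 ℕ.* (L ℕ.* (L ℕ.* L))) (ι4 (L ℕ.* (L ℕ.* L))
        (trans (ι-* L (L ℕ.* L)) (cong₂ _*_ ιL (trans (ι-* L L) (cong₂ _*_ ιL ιL))))))))

    module _ (A : Approximation) where

      module A = Approximation A

      A-cut : ∀ σ X Y → ∬ (λ u v → (A.W u v - Average.E P g u v) * cutφ σ X Y u v) ≤ γ * N
      A-cut σ X Y = ≤-trans (A.cut σ X Y) (≤-reflexive (trans (cong ((c + c) *_) ∬1) (cong (_* N) (solve 1 (λ g → con ½ :* g :+ con ½ :* g := g) refl γ))))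

      module Re = Realise G P eqP M 1≤M (ℕP.≤-trans 6M⁴≤F⁵ (ℕP.≤-trans (iter-≤ {5} {7} k (ℕP.m≤m+n 5 2)) F⁷≤n)) γ θ (<⇒≤ 0<γ) γμ A.W A.0≤W A.W≤1

      regularised : ∀ {j} (P₁ : Fin n → Fin j) bound → Refines P P₁ → k ℕ.≤ bound → Regularised P₁ bound
      regularised P₁ bound P≼P₁ k≤ = record
        { H = Re.H A-cut A.near
        -- Rounding and the distance of W from the graph cost at most θ each, and 2θ = Sd/2 = |E|d
        -- because S = 2|E|.
        ; edit = ≤-trans (Re.edit-bound A-cut A.near) (≤-trans (+-monoˡ-≤ θ γN≤θ) (≤-reflexive
            (trans (cong (λ s → (ℤ.+ 1 / 4) * (s * d) + (ℤ.+ 1 / 4) * (s * d)) (ι-+ (edges G) (edges G)))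
              (solve 2 (λ e d → con (ℤ.+ 1 / 4) :* ((e :+ e) :* d) :+ con (ℤ.+ 1 / 4) :* ((e :+ e) :* d) := e :* d) refl (ι (edges G)) d))))
        ; Q = P ; equi = eqP ; refines = P≼P₁
        ; regular = Re.regular A-cut A.near (f k) (proj₁ (range k)) (<⇒≤ (proj₂ (range k))) γ-small
        ; order≤ = k≤ }

  -- T is the number of stages left. The hypothesis on energies says that the gains so far and T
  -- further ones exceed the range above the energy of `P₁`. A separation preserves it, and at T = 0
  -- it contradicts `energy-cap`.
  outer : ∀ T {j} (P₁ : Fin n → Fin j) {k t} (P : Fin n → Fin k) → Equi (suc t) P → Refines P P₁ → K₀ ℕ.≤ k → iter F (7 ℕ.* T) k ℕ.≤ n →
    energy P₁ + (p * (N - S) + ι J * (S + S)) < energy P + ι T * gain → Regularised P₁ (iter F (7 ℕ.* T) k)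
  outer zero P₁ P eqP P≼P₁ K₀≤k big fuel = ⊥-elim (<-irrefl refl (≤-<-trans (energy-cap P₁ P P≼P₁)
    (<-≤-trans fuel (≤-reflexive (trans (cong (λ t → energy P + t * gain) ι-0) (solve 2 (λ a b → a :+ con 0ℚ :* b := a) refl (energy P) gain))))))
  outer (suc T) P₁ {k} P eqP P≼P₁ K₀≤k big fuel = [ (λ A → regularised A P₁ _ P≼P₁ (x≤iter (7 ℕ.* suc T) k)) , continue ]′ dichotomy
    where
    open Stage P eqP K₀≤k (ℕP.≤-trans (iter-≤ k (ℕP.m≤m*n 7 (suc T))) big)
    open Loop (adj G) P (ℕ.pred (Scale.b k (ℕP.≤-trans 4≤K₀ K₀≤k))) (iter F 6 k) (ℕP.≤-trans (Scale.2F⁶≤F⁷ k (ℕP.≤-trans 4≤K₀ K₀≤k)) (ℕP.≤-trans (iter-≤ k (ℕP.m≤m*n 7 (suc T))) big)) θ κ c 0≤c cb cN≤θ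
      using (Separation)
    continue : Separation → Regularised P₁ (iter F (7 ℕ.* suc T) k)
    continue s = record { Regularised r ; order≤ = ℕP.≤-trans (Regularised.order≤ r) shrink }
      where
      module s = Separation s
      shrink : iter F (7 ℕ.* T) s.order ℕ.≤ iter F (7 ℕ.* suc T) k
      shrink = ℕP.≤-trans (iter-mono (7 ℕ.* T) s.order≤) (ℕP.≤-trans (ℕP.≤-reflexive (sym (iter-+ (7 ℕ.* T) 6 k)))
        (iter-≤ k (ℕP.≤-trans (ℕP.+-monoʳ-≤ (7 ℕ.* T) (ℕP.n≤1+n 6)) (ℕP.≤-reflexive (trans (ℕP.+-comm (7 ℕ.* T) 7) (sym (ℕP.*-suc 7 T)))))))
      r : Regularised P₁ (iter F (7 ℕ.* T) s.order)
      r = outer T P₁ s.Q s.equi (λ u v e → P≼P₁ u v (s.refines u v e)) (ℕP.≤-trans K₀≤k s.base≤) (ℕP.≤-trans shrink big)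
        (<-≤-trans fuel (≤-trans (≤-reflexive (trans (cong (λ t → energy P + t * gain) (ι-suc T))
            (solve 3 (λ a t g → a :+ (con 1ℚ :+ t) :* g := (a :+ g) :+ t :* g) refl (energy P) (ι T) gain)))
          (+-monoˡ-≤ (ι T * gain) (energy-step P s.Q s.refines s.separated))))

  -- The range p(N - S) + 2JS is S(x + 2JN)/N, and a stage gains S/(1024D²).
  enough-fuel : ∀ {j} (P₁ : Fin n → Fin j) x T → e ℕ.+ x ≡ n ℕ.* n →
    1024 ℕ.* (D ℕ.* D) ℕ.* (x ℕ.+ 2 ℕ.* (J ℕ.* (n ℕ.* n))) ℕ.< T ℕ.* (n ℕ.* n) →
    energy P₁ + (p * (N - S) + ι J * (S + S)) < energy P₁ + ι T * gain
  enough-fuel P₁ x T N≡ h = +-monoʳ-< (energy P₁) (*-cancelˡ-<-nonNeg N {{ℚ.nonNegative (<⇒≤ 0<N)}} (subst₂ _<_ (sym left) (sym right)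
      (*-monoʳ-<-pos unit {{ℚ.positive 0<w}} (ι-mono-< h))))
    where
    unit = (ℤ.+ 1 / 1024) * (S * (d * d))
    0<w = 0<* (positive⁻¹ (ℤ.+ 1 / 1024)) (0<* 0<S (0<* 0<d 0<d))
    S+x : S + ι x ≡ N
    S+x = trans (sym (ι-+ e x)) (trans (cong ι N≡) (ι-* n n))
    left : N * (p * (N - S) + ι J * (S + S)) ≡ unit * ι (1024 ℕ.* (D ℕ.* D) ℕ.* (x ℕ.+ 2 ℕ.* (J ℕ.* (n ℕ.* n))))
    left = trans (solve 4 (λ N p S J → N :* (p :* (N :- S) :+ J :* (S :+ S)) := (p :* N) :* (N :- S) :+ J :* N :* (S :+ S)) refl N p S (ι J))
      (trans (cong₂ (λ a b → a * b + ι J * N * (S + S)) pN (trans (cong (_- S) (sym S+x)) (solve 2 (λ s x → s :+ x :- s := x) refl S (ι x))))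
      (trans (solve 4 (λ S x J N → S :* x :+ J :* N :* (S :+ S) := S :* (x :+ con (ℕ→ℚ 2) :* (J :* N)) :* (con 1ℚ :* con 1ℚ)) refl S (ι x) (ι J) N)
      (trans (cong (λ t → S * (ι x + ℕ→ℚ 2 * (ι J * N)) * (t * t)) (sym (*-inv (0<ι 0<D))))
      (trans (solve 4 (λ S Y D d → S :* Y :* ((D :* d) :* (D :* d)) := con (ℤ.+ 1 / 1024) :* (S :* (d :* d)) :* (con (ℕ→ℚ 1024) :* (D :* D) :* Y)) refl S (ι x + ℕ→ℚ 2 * (ι J * N)) (ι D) d)
        (cong (unit *_) (sym ιY))))))
      where
      ιY : ι (1024 ℕ.* (D ℕ.* D) ℕ.* (x ℕ.+ 2 ℕ.* (J ℕ.* (n ℕ.* n)))) ≡ ℕ→ℚ 1024 * (ι D * ι D) * (ι x + ℕ→ℚ 2 * (ι J * N))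
      ιY = trans (ι-* (1024 ℕ.* (D ℕ.* D)) (x ℕ.+ 2 ℕ.* (J ℕ.* (n ℕ.* n)))) (cong₂ _*_
        (trans (ι-* 1024 (D ℕ.* D)) (cong₂ _*_ (ι≡ 1024) (ι-* D D)))
        (trans (ι-+ x (2 ℕ.* (J ℕ.* (n ℕ.* n)))) (cong (ι x +_) (trans (ι-* 2 (J ℕ.* (n ℕ.* n))) (cong₂ _*_ (ι≡ 2) (trans (ι-* J (n ℕ.* n)) (cong (ι J *_) (ι-* n n))))))))
    right : N * (ι T * gain) ≡ unit * ι (T ℕ.* (n ℕ.* n))
    right = trans (solve 3 (λ N T g → N :* (T :* g) := g :* (T :* N)) refl N (ι T) gain)
      (cong (unit *_) (sym (trans (ι-* T (n ℕ.* n)) (cong (ι T *_) (ι-* n n)))))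

-- Labellings whose pairs of classes are complete or empty

size-member : ∀ (X : VSet n) v → X v ≡ true → 0 ℕ.< size X
size-member X 0F e rewrite e = s≤s z≤n
size-member X (Fin.suc v) e = ℕP.≤-trans (size-member (X ∘ Fin.suc) v e) (ℕP.m≤n+m _ _)

member-size : ∀ (X : VSet n) → 0 ℕ.< size X → Σ (Fin n) λ v → X v ≡ true
member-size {suc n} X h with X 0F in eq
... | true = 0F , eq
... | false with member-size (X ∘ Fin.suc) h
...   | v , e = Fin.suc v , e

≡⇒part : ∀ (P : Fin n → Fin k) {u j} → P u ≡ j → part P j u ≡ true
≡⇒part P {u} {j} e with P u Fin.≟ j
... | yes _ = refl
... | no q = ⊥-elim (q e)

constant-regular : ∀ (H : Graph n) {ε} (X Y : VSet n) b → 0ℚ < ε → ε ≤ 1ℚ → 0 ℕ.< size X → 0 ℕ.< size Y →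
  (∀ u v → X u ≡ true → Y v ≡ true → adj H u v ≡ b) → IsRegularPair H ε X Y
constant-regular H {ε} X Y b 0<ε ε≤1 0<X 0<Y const = regular-pair H X Y (χ b) 0<ε ε≤1 0<X 0<Y λ X' Y' X'⊆ Y'⊆ →
  subst (λ t → Half-close (ε * (ε * ι (size X) * (ε * ι (size Y)))) t (χ b * (ι (size X') * ι (size Y'))))
    (sym (trans (eXY-∬ H X' Y') (trans (∬-cong (entry X' Y' X'⊆ Y'⊆)) (trans (∬-*ˡ (χ b) (λ u v → χ (X' u) * χ (Y' v))) (cong (χ b *_) (∬-rectangle X' Y'))))))
    (let c = χ b * (ι (size X') * ι (size Y')) in both (close c) (close c))
  where
  0≤ε = <⇒≤ 0<ε
  close : ∀ a → (a - a) + (a - a) ≤ ε * (ε * ι (size X) * (ε * ι (size Y)))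
  close a = ≤-trans (≤-reflexive (solve 1 (λ a → (a :- a) :+ (a :- a) := con 0ℚ) refl a))
    (0≤* 0≤ε (0≤* (0≤* 0≤ε (0≤ι (size X))) (0≤* 0≤ε (0≤ι (size Y)))))
  entry : ∀ X' Y' → X' ⊆ X → Y' ⊆ Y → ∀ u v → χ (adj H u v) * (χ (X' u) * χ (Y' v)) ≡ χ b * (χ (X' u) * χ (Y' v))
  entry X' Y' X'⊆ Y'⊆ u v with X' u in eX | Y' v in eY
  ... | true | true = cong (λ t → χ t * (1ℚ * 1ℚ)) (const u v (X'⊆ u eX) (Y'⊆ v eY))
  ... | true | false = solve 2 (λ h b → h :* (con 1ℚ :* con 0ℚ) := b :* (con 1ℚ :* con 0ℚ)) refl (χ (adj H u v)) (χ b)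
  ... | false | y = solve 3 (λ h b y → h :* (con 0ℚ :* y) := b :* (con 0ℚ :* y)) refl (χ (adj H u v)) (χ b) (χ y)

IsPartition-size : ∀ {P : Fin n → Fin k} → IsPartition P → ∀ j → 0 ℕ.< size (part P j)
IsPartition-size {P = P} partition j with partition j
... | v , e = size-member (part P j) v (≡⇒part P e)

empty : ∀ n → Graph n
empty n = record { adj = λ _ _ → false ; sym = λ _ _ → refl ; irrefl = λ _ → refl }

xor-falseʳ : ∀ b → b xor false ≡ b
xor-falseʳ true = refl
xor-falseʳ false = refl

xor-self : ∀ b → b xor b ≡ false
xor-self true = refl
xor-self false = refl

ι-cong-sumF : {F F' : Fin n → Fin n → Bool} → (∀ u v → F u v ≡ F' u v) → ι (sumF (λ u → count (F u))) ≡ ι (sumF (λ u → count (F' u)))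
ι-cong-sumF {F = F} {F'} h = trans (ι-∬ F) (trans (∬-cong (λ u v → cong χ (h u v))) (sym (ι-∬ F')))

editDist-empty : ∀ (G : Graph n) → ι (editDist G (empty n)) ≡ ι (edges G)
editDist-empty G = ι-cong-sumF (λ u v → cong (lt u v ∧_) (xor-falseʳ (adj G u v)))

editDist-self : ∀ (G : Graph n) → ι (editDist G G) ≡ 0ℚ
editDist-self {n} G = trans (ι-cong-sumF {F' = λ _ _ → false} (λ u v → trans (cong (lt u v ∧_) (xor-self (adj G u v))) (∧-false (lt u v))))
  (trans (ι-∬ {n} (λ _ _ → false)) (trans (∬-const n n 0ℚ) (trans (cong (ι n *_) (*-zeroʳ (ι n))) (*-zeroʳ (ι n)))))
  where
  ∧-false : ∀ b → b ∧ false ≡ false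
  ∧-false true = refl
  ∧-false false = refl

glue-complete-regular : ∀ (G : Graph n) (P : Fin n → Fin k) {ε} → 0ℚ < ε → ε ≤ 1ℚ → IsPartition P →
  ∀ i j → i ≢ j → IsRegularPair (glue G P (λ _ _ → true)) ε (part P i) (part P j)
glue-complete-regular G P 0<ε ε≤1 partition i j i≢j =
  constant-regular (glue G P (λ _ _ → true)) (part P i) (part P j) true 0<ε ε≤1 (IsPartition-size partition i) (IsPartition-size partition j) joined
  where
  joined : ∀ u v → part P i u ≡ true → part P j v ≡ true → adj (glue G P (λ _ _ → true)) u v ≡ true
  joined u v eu ev with compare (P u) (P v)
  ... | less p _ rewrite p = refl
  ... | greater p q rewrite p | q = refl
  ... | equal e _ _ = ⊥-elim (i≢j (trans (sym (part⇒≡ P i u eu)) (trans e (part⇒≡ P j v ev))))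

size-singleton : ∀ (j : Fin n) → size (part (λ v → v) j) ≡ 1
size-singleton {n} j = ℕP.≤-antisym (ι-reflect-≤ (≤-reflexive eq)) (ι-reflect-≤ (≤-reflexive (sym eq)))
  where
  eq : ι (size (part (λ v → v) j)) ≡ ι 1
  eq = trans (ι-count (part (λ v → v) j)) (trans (∑-cong (λ v → trans (sym (*-identityʳ (same v j))) (trans (same-swap v j (λ _ → refl)) (*-identityʳ (same j v)))))
    (trans (∑-same j) (sym ι-1)))

Equi⇒IsEquipartition : ∀ {t} {P : Fin n → Fin k} → Equi (suc t) P → IsEquipartition P
Equi⇒IsEquipartition {P = P} eq = (λ j → let v , e = member-size (part P j) (ℕP.≤-trans (s≤s z≤n) (proj₁ (eq j))) in v , part⇒≡ P j v e) ,
  λ i j → ℕP.≤-trans (proj₂ (eq i)) (s≤s (proj₁ (eq j)))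

-- A class smaller than that of `i₀` is a smallest one, since no class is smaller by two; if there
-- is none, that of `i₀` is.
IsEquipartition⇒Equi : ∀ {P : Fin n → Fin k} → Fin k → IsEquipartition P → Σ ℕ λ m → Equi m P
IsEquipartition⇒Equi {P = P} i₀ (_ , balanced) with FinP.any? (λ j → size (part P j) ℕP.<? size (part P i₀))
... | yes (j , j<) = size (part P j) , λ i → ℕP.≤-pred (ℕP.≤-trans j< (balanced i₀ i)) , balanced i j
... | no ¬smaller = size (part P i₀) , λ i → ℕP.≮⇒≥ (λ i< → ¬smaller (i , i<)) , balanced i i₀

-- The number of iterations

-- From e ≤ 2Dx follows N ≤ 3Dx, which absorbs the overhead 11N + DN into 33D²x + 3D²x; this is the
-- 36. The 14 is seven iterations per stage times the 2 in front of JN.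
h-bound : ∀ c {N e x D J t} → 0 ℕ.< D → e ℕ.+ x ≡ N → e ℕ.≤ 2 ℕ.* (D ℕ.* x) →
  t ℕ.* N ℕ.≤ c ℕ.* (D ℕ.* D) ℕ.* (x ℕ.+ 2 ℕ.* (J ℕ.* N)) ℕ.+ N →
  (7 ℕ.* t ℕ.+ (4 ℕ.+ D ℕ.+ J)) ℕ.* N ℕ.≤ (14 ℕ.* c ℕ.+ 36) ℕ.* (D ℕ.* D) ℕ.* (x ℕ.+ J ℕ.* N)
h-bound c {N} {e} {x} {D} {J} {t} 0<D e+x≡N e≤2Dx tN = begin
  (7 ℕ.* t ℕ.+ (4 ℕ.+ D ℕ.+ J)) ℕ.* N
    ≡⟨ solveℕ 4 (λ t D J N → (conℕ 7 ⊠ t ⊞ (conℕ 4 ⊞ D ⊞ J)) ⊠ N ≐ conℕ 7 ⊠ (t ⊠ N) ⊞ (conℕ 4 ⊠ N ⊞ D ⊠ N ⊞ J ⊠ N)) refl t D J N ⟩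
  7 ℕ.* (t ℕ.* N) ℕ.+ (4 ℕ.* N ℕ.+ D ℕ.* N ℕ.+ J ℕ.* N)
    ≤⟨ ℕP.+-monoˡ-≤ _ (ℕP.*-monoʳ-≤ 7 tN) ⟩
  7 ℕ.* (c ℕ.* D² ℕ.* (x ℕ.+ 2 ℕ.* (J ℕ.* N)) ℕ.+ N) ℕ.+ (4 ℕ.* N ℕ.+ D ℕ.* N ℕ.+ J ℕ.* N)
    ≡⟨ solveℕ 6 (λ c s x y N d → conℕ 7 ⊠ (c ⊠ s ⊠ (x ⊞ conℕ 2 ⊠ y) ⊞ N) ⊞ (conℕ 4 ⊠ N ⊞ d ⊠ N ⊞ y) ≐
         conℕ 7 ⊠ (c ⊠ s ⊠ (x ⊞ conℕ 2 ⊠ y)) ⊞ conℕ 11 ⊠ N ⊞ d ⊠ N ⊞ y) refl c D² x (J ℕ.* N) N D ⟩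
  7 ℕ.* (c ℕ.* D² ℕ.* (x ℕ.+ 2 ℕ.* (J ℕ.* N))) ℕ.+ 11 ℕ.* N ℕ.+ D ℕ.* N ℕ.+ J ℕ.* N
    ≤⟨ ℕP.+-mono-≤ (ℕP.+-mono-≤ (ℕP.+-monoʳ-≤ (7 ℕ.* (c ℕ.* D² ℕ.* (x ℕ.+ 2 ℕ.* (J ℕ.* N)))) (ℕP.*-monoʳ-≤ 11 (ℕP.≤-trans N≤3Dx (ℕP.*-monoʳ-≤ 3 Dx≤D²x)))) (ℕP.*-monoʳ-≤ D N≤3Dx))
         (ℕP.m≤n*m (J ℕ.* N) D² {{D²≢0}}) ⟩
  7 ℕ.* (c ℕ.* D² ℕ.* (x ℕ.+ 2 ℕ.* (J ℕ.* N))) ℕ.+ 11 ℕ.* (3 ℕ.* (D² ℕ.* x)) ℕ.+ D ℕ.* (3 ℕ.* (D ℕ.* x)) ℕ.+ D² ℕ.* (J ℕ.* N)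
    ≤⟨ ℕP.m≤m+n _ (7 ℕ.* (c ℕ.* D² ℕ.* x) ℕ.+ 35 ℕ.* (D² ℕ.* (J ℕ.* N))) ⟩
  7 ℕ.* (c ℕ.* D² ℕ.* (x ℕ.+ 2 ℕ.* (J ℕ.* N))) ℕ.+ 11 ℕ.* (3 ℕ.* (D² ℕ.* x)) ℕ.+ D ℕ.* (3 ℕ.* (D ℕ.* x)) ℕ.+ D² ℕ.* (J ℕ.* N)
      ℕ.+ (7 ℕ.* (c ℕ.* D² ℕ.* x) ℕ.+ 35 ℕ.* (D² ℕ.* (J ℕ.* N)))
    ≡⟨ solveℕ 4 (λ c d x y → conℕ 7 ⊠ (c ⊠ (d ⊠ d) ⊠ (x ⊞ conℕ 2 ⊠ y)) ⊞ conℕ 11 ⊠ (conℕ 3 ⊠ ((d ⊠ d) ⊠ x)) ⊞ d ⊠ (conℕ 3 ⊠ (d ⊠ x)) ⊞ (d ⊠ d) ⊠ y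
           ⊞ (conℕ 7 ⊠ (c ⊠ (d ⊠ d) ⊠ x) ⊞ conℕ 35 ⊠ ((d ⊠ d) ⊠ y)) ≐ (conℕ 14 ⊠ c ⊞ conℕ 36) ⊠ (d ⊠ d) ⊠ (x ⊞ y)) refl c D x (J ℕ.* N) ⟩
  (14 ℕ.* c ℕ.+ 36) ℕ.* (D ℕ.* D) ℕ.* (x ℕ.+ J ℕ.* N) ∎
  where
  open ℕP.≤-Reasoning
  D² = D ℕ.* D
  D≢0 = ℕ.>-nonZero 0<D
  D²≢0 = ℕP.m*n≢0 D D {{D≢0}} {{D≢0}}
  x≤Dx : x ℕ.≤ D ℕ.* x
  x≤Dx = ℕP.m≤n*m x D {{D≢0}}
  Dx≤D²x : D ℕ.* x ℕ.≤ D² ℕ.* x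
  Dx≤D²x = ℕP.≤-trans (ℕP.*-monoʳ-≤ D x≤Dx) (ℕP.≤-reflexive (sym (ℕP.*-assoc D D x)))
  N≤3Dx : N ℕ.≤ 3 ℕ.* (D ℕ.* x)
  N≤3Dx = ℕP.≤-trans (ℕP.≤-reflexive (sym e+x≡N)) (ℕP.≤-trans (ℕP.+-mono-≤ e≤2Dx x≤Dx)
    (ℕP.≤-reflexive (solveℕ 1 (λ y → conℕ 2 ⊠ y ⊞ y ≐ conℕ 3 ⊠ y) refl (D ℕ.* x))))

opaque
  c₀ : ℕ
  c₀ = 14 ℕ.* 1024 ℕ.+ 36

  c₀≡ : c₀ ≡ 14 ℕ.* 1024 ℕ.+ 36
  c₀≡ = refl

-- The factor 4 is the square of 2 in D ≤ 2/δ; the two summands are the two copies of B in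
-- `power-bound`.
C₀ : ℕ
C₀ = c₀ ℕ.* 4 ℕ.+ c₀ ℕ.* 4

n^2m : ∀ n m → n ℕ.^ (2 ℕ.* m) ≡ (n ℕ.* n) ℕ.^ m
n^2m n m = trans (sym (ℕP.^-*-assoc n 2 m)) (cong (λ t → (n ℕ.* t) ℕ.^ m) (ℕP.*-identityʳ n))

HBound-intro : ∀ (G : Graph n) δ h → 2 ℕ.^ (h ℕ.* (num δ ℕ.* num δ)) ℕ.* (edges G ℕ.+ edges G) ℕ.^ (C₀ ℕ.* (↧ₙ δ ℕ.* ↧ₙ δ)) ℕ.≤ (n ℕ.* n) ℕ.^ (C₀ ℕ.* (↧ₙ δ ℕ.* ↧ₙ δ)) →
  HBound C₀ δ G h
HBound-intro {n} G δ h bound = subst₂ ℕ._≤_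
  (cong (λ t → 2 ℕ.^ (h ℕ.* (num δ ℕ.* num δ)) ℕ.* (edges G ℕ.+ t) ℕ.^ (C₀ ℕ.* (↧ₙ δ ℕ.* ↧ₙ δ))) (sym (ℕP.+-identityʳ (edges G))))
  (sym (n^2m n (C₀ ℕ.* (↧ₙ δ ℕ.* ↧ₙ δ)))) bound

HBound-zero : ∀ (G : Graph n) δ → HBound C₀ δ G 0
HBound-zero G δ = HBound-intro G δ 0 (ℕP.≤-trans (ℕP.≤-reflexive (ℕP.*-identityˡ _)) (ℕP.^-monoˡ-≤ (C₀ ℕ.* (↧ₙ δ ℕ.* ↧ₙ δ)) (Edges.e≤n² G)))

-- The cases of the theorem

Conclusion : ℚ → (ℕ → ℚ) → ∀ {n s} → Graph n → (Fin n → Fin s) → Set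
Conclusion δ f {n} {s} G P₀ =
  Σ[ H ∈ Graph n ] (ℕ→ℚ (editDist G H) ≤ δ * ℕ→ℚ (edges G)) ×
    (Σ[ k ∈ ℕ ] Σ[ Q ∈ (Fin n → Fin k) ]
      IsEquipartition Q × Refines Q P₀ × IsFRegular f H Q ×
      (Σ[ h ∈ ℕ ] HBound C₀ δ G h × k ℕ.≤ iter (Ffloor f) h s))

module Theorem (δ : ℚ) (0<δ : 0ℚ < δ) {s : ℕ} (f : ℕ → ℚ) (range : ∀ x → (0ℚ < f x) × (f x < 1ℚ))
  (decreasing : ∀ x y → x ℕ.≤ y → f y ≤ f x) {n : ℕ} (G : Graph n) (P₀ : Fin n → Fin s) (equi₀ : IsEquipartition P₀) where

  open Edges G
  open Tower f range decreasing

  -- The iterates grow at least by 1 each time, so 3 + D + J of them bring the exponent to s + 3 + D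
  -- + J, and one more gives the power of 2.
  initial-scale : ∀ s D J → s ℕ.* (8 ℕ.* (D ℕ.* 2 ℕ.^ J)) ℕ.≤ iter F (4 ℕ.+ D ℕ.+ J) s
  initial-scale s D J = begin
    s ℕ.* (8 ℕ.* (D ℕ.* 2 ℕ.^ J))
      ≤⟨ ℕP.*-mono-≤ (n≤2^n s) (ℕP.*-monoʳ-≤ 8 (ℕP.*-monoˡ-≤ (2 ℕ.^ J) (n≤2^n D))) ⟩
    2 ℕ.^ s ℕ.* (2 ℕ.^ 3 ℕ.* (2 ℕ.^ D ℕ.* 2 ℕ.^ J))
      ≡⟨ cong (λ t → 2 ℕ.^ s ℕ.* (2 ℕ.^ 3 ℕ.* t)) (sym (ℕP.^-distribˡ-+-* 2 D J)) ⟩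
    2 ℕ.^ s ℕ.* (2 ℕ.^ 3 ℕ.* 2 ℕ.^ (D ℕ.+ J))
      ≡⟨ cong (2 ℕ.^ s ℕ.*_) (sym (ℕP.^-distribˡ-+-* 2 3 (D ℕ.+ J))) ⟩
    2 ℕ.^ s ℕ.* 2 ℕ.^ (3 ℕ.+ (D ℕ.+ J)) ≡⟨ sym (ℕP.^-distribˡ-+-* 2 s (3 ℕ.+ (D ℕ.+ J))) ⟩
    2 ℕ.^ (s ℕ.+ (3 ℕ.+ (D ℕ.+ J))) ≡⟨ cong (2 ℕ.^_) (ℕP.+-comm s (3 ℕ.+ (D ℕ.+ J))) ⟩
    2 ℕ.^ (3 ℕ.+ (D ℕ.+ J) ℕ.+ s) ≤⟨ ℕP.^-monoʳ-≤ 2 (iter-grow (3 ℕ.+ (D ℕ.+ J)) s) ⟩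
    2 ℕ.^ iter F (3 ℕ.+ (D ℕ.+ J)) s ≤⟨ 2^≤F (iter F (3 ℕ.+ (D ℕ.+ J)) s) ⟩
    iter F (4 ℕ.+ (D ℕ.+ J)) s ∎
    where open ℕP.≤-Reasoning

  edit-ι : ∀ H → ι (editDist G H) ≤ δ * ι (edges G) → ℕ→ℚ (editDist G H) ≤ δ * ℕ→ℚ (edges G)
  edit-ι H = subst₂ (λ a b → a ≤ δ * b) (ι≡ (editDist G H)) (ι≡ (edges G))

  -- With h = 0 the bound on h only says that p ≤ 1.
  keep-P₀ : ∀ H → ι (editDist G H) ≤ δ * ι (edges G) → (∀ {ε} → 0ℚ < ε → ε ≤ 1ℚ → ∀ i j → i ≢ j → IsRegularPair H ε (part P₀ i) (part P₀ j)) →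
    Conclusion δ f G P₀
  keep-P₀ H edit regular = H , edit-ι H edit , s , P₀ , equi₀ , (λ _ _ e → e) ,
    (λ i j i≢j → regular (proj₁ (range s)) (<⇒≤ (proj₂ (range s))) i j i≢j) , 0 , HBound-zero G δ , ℕP.≤-refl

  use-empty : ι (edges G) ≤ δ * ι (edges G) → Conclusion δ f G P₀
  use-empty h = keep-P₀ (empty n) (≤-trans (≤-reflexive (editDist-empty G)) h) λ 0<ε ε≤1 i j _ →
    constant-regular (empty n) (part P₀ i) (part P₀ j) false 0<ε ε≤1 (IsPartition-size (proj₁ equi₀) i) (IsPartition-size (proj₁ equi₀) j) (λ _ _ _ _ → refl)

  use-singletons : ∀ h → HBound C₀ δ G h → n ℕ.≤ iter F h s → Conclusion δ f G P₀
  use-singletons h hb n≤ = G , edit-ι G (≤-trans (≤-reflexive (editDist-self G)) (0≤* (<⇒≤ 0<δ) (0≤ι (edges G)))) , n , (λ v → v) ,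
    ((λ j → j , refl) , λ i j → ℕP.≤-trans (ℕP.≤-reflexive (size-singleton i)) (s≤s z≤n)) , (λ _ _ e → cong P₀ e) ,
    (λ i j _ → constant-regular G (part (λ v → v) i) (part (λ v → v) j) (adj G i j) (proj₁ (range n)) (<⇒≤ (proj₂ (range n)))
      (ℕP.≤-reflexive (sym (size-singleton i))) (ℕP.≤-reflexive (sym (size-singleton j)))
      (λ u v eu ev → cong₂ (adj G) (part⇒≡ (λ v → v) i u eu) (part⇒≡ (λ v → v) j v ev))) , h , hb , n≤

  regularise : ∀ D J K T h₁ h → inv (ι D) ≤ δ → 0 ℕ.< D → 0 ℕ.< edges G → 0 ℕ.< n → n ℕ.* n ℕ.≤ 2 ℕ.* (2 ℕ.^ J ℕ.* e) →
    4 ℕ.≤ suc K → 4 ℕ.* (D ℕ.* (n ℕ.* n)) ℕ.≤ suc K ℕ.* e →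
    1024 ℕ.* (D ℕ.* D) ℕ.* (nonadj ℕ.+ 2 ℕ.* (J ℕ.* (n ℕ.* n))) ℕ.< T ℕ.* (n ℕ.* n) →
    s ℕ.* suc K ℕ.≤ iter F h₁ s → h ≡ 7 ℕ.* T ℕ.+ h₁ → 1 ℕ.≤ T → HBound C₀ δ G h → iter F h s ℕ.≤ n → Conclusion δ f G P₀
  regularise D J K T h₁ h 1/D≤δ 0<D 0<E 0<n N≤ 4≤K₀ 4DN≤K₀e T-large sK₀≤ h≡ 1≤T hb large =
    R.H , edit-ι R.H (≤-trans R.edit (≤-trans (*-monoʳ (0≤ι (edges G)) 1/D≤δ) (≤-reflexive (*-comm (ι (edges G)) δ)))) ,
    R.order , R.Q , Equi⇒IsEquipartition R.equi , (λ u v q → R₁.refines u v (R.refines u v q)) , R.regular , h , hb ,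
    ℕP.≤-trans R.order≤ order≤h
    where
    v₀ : Fin n
    v₀ = Fin.fromℕ< 0<n
    0<s : 0 ℕ.< s
    0<s = ℕ.>-nonZero⁻¹ s {{FinP.nonZeroIndex (P₀ v₀)}}
    h₁<h : suc h₁ ℕ.≤ h
    h₁<h = ℕP.≤-trans (ℕP.+-monoˡ-≤ h₁ (ℕP.≤-trans 1≤T (ℕP.m≤n*m T 7))) (ℕP.≤-reflexive (sym h≡))
    2sK₀≤n : 2 ℕ.* (s ℕ.* suc K) ℕ.≤ n
    2sK₀≤n = begin
      2 ℕ.* (s ℕ.* suc K) ≤⟨ ℕP.*-monoʳ-≤ 2 sK₀≤ ⟩
      2 ℕ.* iter F h₁ s ≤⟨ 2n≤2^n (iter F h₁ s) (ℕP.≤-trans 0<s (x≤iter h₁ s)) ⟩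
      2 ℕ.^ iter F h₁ s ≤⟨ 2^≤F (iter F h₁ s) ⟩
      iter F (suc h₁) s ≤⟨ iter-≤ s h₁<h ⟩
      iter F h s ≤⟨ large ⟩
      n ∎
      where open ℕP.≤-Reasoning
    -- Refining for the empty set just splits each class of `P₀` equitably into nonempty cells.
    r₁ : Refinement P₀ (suc K) (λ _ → false)
    r₁ = refine K (λ _ → false) (proj₂ (IsEquipartition⇒Equi (P₀ v₀) equi₀)) 2sK₀≤n
    module R₁ = Refinement r₁
    open Outer f range decreasing G D J (suc K) 0<D 0<E 0<n N≤ 4≤K₀ 4DN≤K₀e using (Regularised; outer; enough-fuel)
    order≤h : iter F (7 ℕ.* T) (s ℕ.* suc K) ℕ.≤ iter F h s
    order≤h = ℕP.≤-trans (iter-mono (7 ℕ.* T) sK₀≤) (ℕP.≤-reflexive (trans (sym (iter-+ (7 ℕ.* T) h₁ s)) (cong (λ t → iter F t s) (sym h≡))))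
    r : Regularised R₁.R' (iter F (7 ℕ.* T) (s ℕ.* suc K))
    r = outer T R₁.R' R₁.R' R₁.equi (λ _ _ q → q) (ℕP.m≤n*m (suc K) s {{ℕ.>-nonZero 0<s}}) (ℕP.≤-trans order≤h large) (enough-fuel R₁.R' nonadj T e+x T-large)
    module R = Regularised r

  module Sparse (δ<1 : δ < 1ℚ) (0<E : 0 ℕ.< edges G) where

    a b : ℕ
    a = num δ
    b = ↧ₙ δ

    instance
      a≢0 : ℕ.NonZero a
      a≢0 = ℕ.>-nonZero (0<num δ 0<δ)

    -- The reciprocal of D stands for δ = a/b: D exceeds 1/δ and is at most 2/δ.
    D : ℕ
    D = suc (b ℕ./ a)

    b≤Da : b ℕ.≤ D ℕ.* a
    b≤Da = ℕP.≤-trans (ℕP.≤-reflexive (m≡m%n+[m/n]*n b a)) (ℕP.+-monoˡ-≤ _ (ℕP.<⇒≤ (m%n<n b a)))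

    Da≤2b : D ℕ.* a ℕ.≤ b ℕ.+ b
    Da≤2b = ℕP.+-mono-≤ (subst₂ ℕ._≤_ (ℕP.*-identityʳ a) (ℕP.*-identityˡ b) (num-cross {δ} {1ℚ} 0<δ 0<1 (<⇒≤ δ<1))) (m/n*n≤m b a)

    1≤Dδ : 1ℚ ≤ ι D * δ
    1≤Dδ = *-cancel {ι b} (0<ι (s≤s z≤n)) (begin
      ι b * 1ℚ ≡⟨ *-identityʳ (ι b) ⟩
      ι b ≤⟨ ι-mono b≤Da ⟩
      ι (D ℕ.* a) ≡⟨ trans (ι-* D a) (cong (ι D *_) (sym (*-denominator 0<δ))) ⟩
      ι D * (δ * ι b) ≡⟨ solve 3 (λ D δ b → D :* (δ :* b) := b :* (D :* δ)) refl (ι D) δ (ι b) ⟩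
      ι b * (ι D * δ) ∎)
      where open ≤-Reasoning

    1/D≤δ : inv (ι D) ≤ δ
    1/D≤δ = *-cancel {ι D} (0<ι {D} (s≤s z≤n)) (≤-trans (≤-reflexive (*-inv (0<ι {D} (s≤s z≤n)))) 1≤Dδ)

    -- Here log(1/p) may be too small to pay for the starting costs. But at most |E|/D ≤ δ|E| pairs
    -- are missing, so all of them between distinct classes can be added.
    use-complete : 2 ℕ.* (D ℕ.* nonadj) ℕ.≤ e → Conclusion δ f G P₀
    use-complete 2Dx≤e = keep-P₀ (glue G P₀ (λ _ _ → true)) (≤-trans (ι-mono (editDist-complete P₀)) x≤δE) λ 0<ε ε≤1 →
        glue-complete-regular G P₀ 0<ε ε≤1 (proj₁ equi₀)
      where
      Dx≤E : D ℕ.* nonadj ℕ.≤ edges G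
      Dx≤E = ℕP.*-cancelˡ-≤ 2 (ℕP.≤-trans 2Dx≤e (ℕP.≤-reflexive (cong (edges G ℕ.+_) (sym (ℕP.+-identityʳ (edges G))))))
      x≤δE : ι nonadj ≤ δ * ι (edges G)
      x≤δE = begin
        ι nonadj ≡⟨ sym (*-identityˡ (ι nonadj)) ⟩
        1ℚ * ι nonadj ≤⟨ *-monoˡ (0≤ι nonadj) 1≤Dδ ⟩
        ι D * δ * ι nonadj ≡⟨ solve 3 (λ D δ x → D :* δ :* x := δ :* (D :* x)) refl (ι D) δ (ι nonadj) ⟩
        δ * (ι D * ι nonadj) ≤⟨ *-monoʳ (<⇒≤ 0<δ) (≤-trans (≤-reflexive (sym (ι-* D nonadj))) (ι-mono Dx≤E)) ⟩
        δ * ι (edges G) ∎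
        where open ≤-Reasoning

    module Main (e≤2Dx : e ℕ.≤ 2 ℕ.* (D ℕ.* nonadj)) (J : ℕ) (2ᴶe≤N : 2 ℕ.^ J ℕ.* e ℕ.≤ n ℕ.* n) (N<2ᴶ⁺¹e : n ℕ.* n ℕ.< 2 ℕ.^ suc J ℕ.* e) where

      0<e : 0 ℕ.< e
      0<e = ℕP.≤-trans 0<E (ℕP.m≤m+n (edges G) (edges G))

      0<n² : 0 ℕ.< n ℕ.* n
      0<n² = ℕP.≤-trans 0<e e≤n²

      0<n : 0 ℕ.< n
      0<n = ℕP.n≢0⇒n>0 λ { refl → ℕP.<⇒≱ 0<n² z≤n }

      instance
        n²≢0 : ℕ.NonZero (n ℕ.* n)
        n²≢0 = ℕ.>-nonZero 0<n²

      weight T h₁ h : ℕ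
      weight = 1024 ℕ.* (D ℕ.* D) ℕ.* (nonadj ℕ.+ 2 ℕ.* (J ℕ.* (n ℕ.* n)))
      T = suc (weight ℕ./ (n ℕ.* n))
      h₁ = 4 ℕ.+ D ℕ.+ J
      h = 7 ℕ.* T ℕ.+ h₁

      T-large : weight ℕ.< T ℕ.* (n ℕ.* n)
      T-large = ℕP.≤-trans (ℕP.≤-reflexive (cong suc (m≡m%n+[m/n]*n weight (n ℕ.* n)))) (ℕP.+-monoˡ-≤ _ (m%n<n weight (n ℕ.* n)))

      T-small : T ℕ.* (n ℕ.* n) ℕ.≤ weight ℕ.+ n ℕ.* n
      T-small = ℕP.≤-trans (ℕP.+-monoʳ-≤ (n ℕ.* n) (m/n*n≤m weight (n ℕ.* n))) (ℕP.≤-reflexive (ℕP.+-comm (n ℕ.* n) weight))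

      hb : HBound C₀ δ G h
      hb = HBound-intro G δ h (subst (λ t → 2 ℕ.^ (h ℕ.* (a ℕ.* a)) ℕ.* e ℕ.^ t ℕ.≤ (n ℕ.* n) ℕ.^ t) B+B
        (power-bound {x = nonadj} {J} {h} {c₀ ℕ.* (D ℕ.* D)} {a ℕ.* a} {B} 0<e e+x 2ᴶe≤N
          (subst (λ t → h ℕ.* (n ℕ.* n) ℕ.≤ t ℕ.* (D ℕ.* D) ℕ.* (nonadj ℕ.+ J ℕ.* (n ℕ.* n))) (sym c₀≡)
            (h-bound 1024 {D = D} {J} {T} (s≤s z≤n) e+x e≤2Dx T-small)) Ar≤B))
        where
        B : ℕ
        B = c₀ ℕ.* (4 ℕ.* (b ℕ.* b))
        B+B : B ℕ.+ B ≡ C₀ ℕ.* (b ℕ.* b)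
        B+B = expand c₀ (b ℕ.* b)
          where
          expand : ∀ c y → c ℕ.* (4 ℕ.* y) ℕ.+ c ℕ.* (4 ℕ.* y) ≡ (c ℕ.* 4 ℕ.+ c ℕ.* 4) ℕ.* y
          expand = solveℕ 2 (λ c y → c ⊠ (conℕ 4 ⊠ y) ⊞ c ⊠ (conℕ 4 ⊠ y) ≐ (c ⊠ conℕ 4 ⊞ c ⊠ conℕ 4) ⊠ y) refl
        Ar≤B : c₀ ℕ.* (D ℕ.* D) ℕ.* (a ℕ.* a) ℕ.≤ B
        Ar≤B = begin
          c₀ ℕ.* (D ℕ.* D) ℕ.* (a ℕ.* a) ≡⟨ regroup c₀ D a ⟩
          c₀ ℕ.* ((D ℕ.* a) ℕ.* (D ℕ.* a)) ≤⟨ ℕP.*-monoʳ-≤ c₀ (ℕP.*-mono-≤ Da≤2b Da≤2b) ⟩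
          c₀ ℕ.* ((b ℕ.+ b) ℕ.* (b ℕ.+ b)) ≡⟨ cong (c₀ ℕ.*_) (square b) ⟩
          B ∎
          where
          open ℕP.≤-Reasoning
          regroup : ∀ c D a → c ℕ.* (D ℕ.* D) ℕ.* (a ℕ.* a) ≡ c ℕ.* ((D ℕ.* a) ℕ.* (D ℕ.* a))
          regroup = solveℕ 3 (λ c D a → c ⊠ (D ⊠ D) ⊠ (a ⊠ a) ≐ c ⊠ ((D ⊠ a) ⊠ (D ⊠ a))) refl
          square : ∀ b → (b ℕ.+ b) ℕ.* (b ℕ.+ b) ≡ 4 ℕ.* (b ℕ.* b)
          square = solveℕ 1 (λ b → (b ⊞ b) ⊠ (b ⊞ b) ≐ conℕ 4 ⊠ (b ⊠ b)) refl

      K₁ K₀ : ℕ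
      -- Since N < 2ᴶ⁺¹e, the factor 8·2ᴶ = 4·2ᴶ⁺¹ yields `4DN≤K₀e`.
      K₁ = 8 ℕ.* (D ℕ.* 2 ℕ.^ J)
      K₀ = suc (ℕ.pred K₁)

      1≤D2ᴶ : 1 ℕ.≤ D ℕ.* 2 ℕ.^ J
      1≤D2ᴶ = ℕP.*-mono-≤ {1} {D} (s≤s z≤n) (ℕP.m^n>0 2 J)

      8≤K₁ : 8 ℕ.≤ K₁
      8≤K₁ = ℕP.*-monoʳ-≤ 8 1≤D2ᴶ

      K₀≡ : K₀ ≡ K₁
      K₀≡ = ℕP.suc-pred K₁ {{ℕ.>-nonZero (ℕP.≤-trans (s≤s z≤n) 8≤K₁)}}

      4DN≤K₀e : 4 ℕ.* (D ℕ.* (n ℕ.* n)) ℕ.≤ K₀ ℕ.* e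
      4DN≤K₀e = begin
        4 ℕ.* (D ℕ.* (n ℕ.* n)) ≤⟨ ℕP.*-monoʳ-≤ 4 (ℕP.*-monoʳ-≤ D (ℕP.<⇒≤ N<2ᴶ⁺¹e)) ⟩
        4 ℕ.* (D ℕ.* (2 ℕ.* 2 ℕ.^ J ℕ.* e)) ≡⟨ regroup D (2 ℕ.^ J) e ⟩
        8 ℕ.* (D ℕ.* 2 ℕ.^ J) ℕ.* e ≡⟨ cong (ℕ._* e) (sym K₀≡) ⟩
        K₀ ℕ.* e ∎
        where
        open ℕP.≤-Reasoning
        regroup : ∀ D y e → 4 ℕ.* (D ℕ.* (2 ℕ.* y ℕ.* e)) ≡ 8 ℕ.* (D ℕ.* y) ℕ.* e
        regroup = solveℕ 3 (λ D y e → conℕ 4 ⊠ (D ⊠ (conℕ 2 ⊠ y ⊠ e)) ≐ conℕ 8 ⊠ (D ⊠ y) ⊠ e) refl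

      sK₀≤ : s ℕ.* K₀ ℕ.≤ iter F h₁ s
      sK₀≤ = ℕP.≤-trans (ℕP.*-monoʳ-≤ s (ℕP.≤-reflexive K₀≡)) (initial-scale s D J)

      use-regularised : iter F h s ℕ.≤ n → Conclusion δ f G P₀
      use-regularised = regularise D J (ℕ.pred K₁) T h₁ h 1/D≤δ (s≤s z≤n) 0<E 0<n
        (ℕP.≤-trans (ℕP.<⇒≤ N<2ᴶ⁺¹e) (ℕP.≤-reflexive (ℕP.*-assoc 2 (2 ℕ.^ J) e)))
        (ℕP.≤-trans (ℕP.m≤m+n 4 4) (ℕP.≤-trans 8≤K₁ (ℕP.≤-reflexive (sym K₀≡)))) 4DN≤K₀e T-large sK₀≤ refl (s≤s z≤n) hb

      main : Conclusion δ f G P₀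
      main = [ use-singletons h hb , use-regularised ]′ (ℕP.≤-total n (iter F h s))

    sparse : Conclusion δ f G P₀
    sparse = [ use-complete , (λ e≤2Dx → let J , lo , hi = logarithm in Main.main e≤2Dx J lo hi) ]′ (ℕP.≤-total (2 ℕ.* (D ℕ.* nonadj)) e)
      where logarithm = log-ratio (n ℕ.* n) e (ℕP.≤-trans 0<E (ℕP.m≤m+n (edges G) (edges G))) e≤n²

  conclusion : Conclusion δ f G P₀
  conclusion = [ (λ 1≤δ → use-empty (≤-trans (≤-reflexive (sym (*-identityˡ (ι (edges G))))) (*-monoˡ (0≤ι (edges G)) 1≤δ))) ,
                 (λ δ<1 → [ (λ E≤0 → use-empty (≤-trans (ι-mono E≤0) (≤-trans (≤-reflexive ι-0) (0≤* (<⇒≤ 0<δ) (0≤ι (edges G)))))) ,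
                            Sparse.sparse δ<1 ]′ (ℕP.≤-<-connex (edges G) 0)) ]′
    (≤-dec⊎ 1ℚ δ)

theorem3p8 : Σ ℕ λ C →
    (δ : ℚ) → 0ℚ < δ → (s : ℕ) → (f : ℕ → ℚ) →
    (∀ x → (0ℚ < f x) × (f x < 1ℚ)) →
    (∀ x y → x ℕ.≤ y → f y ℚ.≤ f x) →
    (n : ℕ) (G : Graph n) (P₀ : Fin n → Fin s) → IsEquipartition P₀ →
    Σ[ H ∈ Graph n ] (ℕ→ℚ (editDist G H) ℚ.≤ δ ℚ.* ℕ→ℚ (edges G)) ×
    (Σ[ k ∈ ℕ ] Σ[ Q ∈ (Fin n → Fin k) ]
    IsEquipartition Q × Refines Q P₀ × IsFRegular f H Q ×
    (Σ[ h ∈ ℕ ] HBound C δ G h × k ℕ.≤ iter (Ffloor f) h s))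
theorem3p8 = C₀ , λ δ 0<δ s f range decreasing n G P₀ equi₀ → Theorem.conclusion δ 0<δ f range decreasing G P₀ equi₀
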